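{- For every integer $d\ge 1$, every $d$-dimensional simplex $S\subseteq\mathbb{R}^\infty$ is P-Ramsey.
   Context: $\mathbb{R}^\infty$ denotes the subspace of $\ell^2$ of real sequences with only finitely many nonzero entries, with the Euclidean metric. A configuration is a set of points of $\mathbb{R}^\infty$. A copy of a configuration $B$ is a configuration $B'$ for which there is a distance-preserving bijection $B\to B'$. A configuration $Z$ is $X$-free if no subset of $Z$ is a copy of $X$. For configurations $A,B$ and an integer $r\ge1$, $A\rightarrow(B)_r$ means that every coloring of the points of $A$ with $r$ colors admits a monochromatic subset of $A$ that is a copy of $B$. A $d$-dimensional simplex is a configuration consisting of $d+1$ affinely independent points in $\mathbb{R}^\infty$. A finite configuration $X\subseteq\mathbb{R}^\infty$ is P-Ramsey if there exist a configuration $Y\subseteq\mathbb{R}^\infty$ and a real number $\mu>0$ such that: (i) $Y\rightarrow(X)_r$ for every integer $r\ge1$; (ii) every finite $Y'\subseteq Y$ contains a subset $Z\subseteq Y'$ with $|Z|\ge\mu|Y'|$ such that $Z$ is $X$-free. -}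

module Defs where

open import Level using (0ℓ) renaming (suc to lsuc)
open import Algebra.Bundles using (CommutativeRing)
open import Data.Fin.Base using (Fin; zero; suc; toℕ)
open import Data.Nat.Base as ℕ using (ℕ; suc)
open import Data.Product.Base using (Σ; ∃; ∃-syntax; _×_; _,_; proj₁; proj₂)
open import Data.Sum.Base using (inj₁; inj₂)
open import Data.Vec.Functional using (Vector)
open import Function.Bundles using (Func; Bijection)
open import Relation.Binary.Bundles using (Setoid)
open import Relation.Binary.Core using (Rel)
open import Relation.Binary.Definitions using (_Respects_)
open import Relation.Binary.PropositionalEquality.Core using (_≡_)
open import Relation.Binary.Structures using (IsTotalOrder)
open import Relation.Nullary.Negation.Core using (¬_)
open import Relation.Unary using (Pred; _∈_; _⊆_)
import Algebra.Definitions.RawMonoid as RawMonoidDefinitions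
import Algebra.Properties.Ring as RingProperties
import Relation.Binary.Construct.NonStrictToStrict as NonStrictToStrict
import Relation.Binary.Construct.On as On
import Relation.Binary.PropositionalEquality.Properties as ≡

-- The real numbers, axiomatised as a Dedekind-complete ordered field (which
-- is unique up to isomorphism).  Both the totality of the order and the
-- existence of arbitrary suprema are to be read classically.
record RealNumbers : Set₁ where
  field
    commutativeRing : CommutativeRing 0ℓ 0ℓ

  open CommutativeRing commutativeRing public

  field
    1≉0     : ¬ 1# ≈ 0#
    inverse : ∀ x → ¬ x ≈ 0# → ∃[ y ] x * y ≈ 1#

  infix 4 _≤_
  field
    _≤_          : Rel Carrier 0ℓ
    isTotalOrder : IsTotalOrder _≈_ _≤_
    +-monoʳ-≤    : ∀ z {x y} → x ≤ y → z + x ≤ z + y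
    *-nonNeg     : ∀ {x y} → 0# ≤ x → 0# ≤ y → 0# ≤ x * y

  UpperBound : Pred Carrier 0ℓ → Pred Carrier 0ℓ
  UpperBound P u = ∀ x → x ∈ P → x ≤ u

  Supremum : Pred Carrier 0ℓ → Pred Carrier 0ℓ
  Supremum P s = UpperBound P s × (∀ u → UpperBound P u → s ≤ u)

  field
    supremum : ∀ P → ∃ P → ∃ (UpperBound P) → ∃ (Supremum P)

  module ≤ = IsTotalOrder isTotalOrder

  open NonStrictToStrict _≈_ _≤_ public using (_<_)
  open RawMonoidDefinitions +-rawMonoid public using (sum) renaming (_×_ to _·_)

  fromℕ : ℕ → Carrier
  fromℕ n = n · 1#

module SquareRoot (ℝ : RealNumbers) where
  open RealNumbers ℝ hiding (zero) renaming (Carrier to R)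
  open RingProperties ring using (-‿distribˡ-*; -‿distribʳ-*; -‿involutive)

  ≤-respˡ : ∀ {x y z} → x ≈ y → x ≤ z → y ≤ z
  ≤-respˡ = ≤.≤-respˡ-≈

  ≤-respʳ : ∀ {x y z} → x ≈ y → z ≤ x → z ≤ y
  ≤-respʳ = ≤.≤-respʳ-≈

  +-monoˡ-≤ : ∀ z {x y} → x ≤ y → x + z ≤ y + z
  +-monoˡ-≤ z p = ≤-respˡ (+-comm z _) (≤-respʳ (+-comm z _) (+-monoʳ-≤ z p))

  nonNeg-+ : ∀ {x y} → 0# ≤ x → 0# ≤ y → 0# ≤ x + y
  nonNeg-+ {x} p q = ≤.trans p (≤-respˡ (+-identityʳ x) (+-monoʳ-≤ x q))

  nonPos⇒-nonNeg : ∀ {x} → x ≤ 0# → 0# ≤ - x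
  nonPos⇒-nonNeg {x} p =
    ≤-respˡ (-‿inverseˡ x) (≤-respʳ (+-identityʳ (- x)) (+-monoʳ-≤ (- x) p))

  square-nonNeg : ∀ x → 0# ≤ x * x
  square-nonNeg x with ≤.total 0# x
  ... | inj₁ p = *-nonNeg p p
  ... | inj₂ p = ≤-respʳ -x*-x≈x*x (*-nonNeg (nonPos⇒-nonNeg p) (nonPos⇒-nonNeg p))
    where
    -x*-x≈x*x : - x * - x ≈ x * x
    -x*-x≈x*x = trans (sym (-‿distribˡ-* x (- x)))
      (trans (-‿cong (sym (-‿distribʳ-* x x))) (-‿involutive (x * x)))

  0≤1 : 0# ≤ 1#
  0≤1 = ≤-respʳ (*-identityˡ 1#) (square-nonNeg 1#)

  sum-nonNeg : ∀ {n} (v : Vector R n) → (∀ i → 0# ≤ v i) → 0# ≤ sum v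
  sum-nonNeg {ℕ.zero} v p = ≤.refl
  sum-nonNeg {suc n}  v p =
    nonNeg-+ (p zero) (sum-nonNeg (λ i → v (suc i)) (λ i → p (suc i)))

  x≤y⇒0≤y-x : ∀ {x y} → x ≤ y → 0# ≤ y - x
  x≤y⇒0≤y-x {x} p = ≤-respˡ (-‿inverseʳ x) (+-monoˡ-≤ (- x) p)

  1≤x⇒x≤x² : ∀ {x} → 1# ≤ x → x ≤ x * x
  1≤x⇒x≤x² {x} p = ≤-respˡ (+-identityˡ x) (≤-respʳ eq
      (+-monoˡ-≤ x (*-nonNeg (≤.trans 0≤1 p) (x≤y⇒0≤y-x p))))
    where
    eq : x * (x - 1#) + x ≈ x * x
    eq = trans (+-congˡ (sym (*-identityʳ x)))
      (trans (sym (distribˡ x (x - 1#) 1#))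
        (*-congˡ (trans (+-assoc x (- 1#) 1#)
          (trans (+-congˡ (-‿inverseˡ 1#)) (+-identityʳ x)))))

  sqrt-bound : ∀ {a} → 0# ≤ a → UpperBound (λ x → x * x ≤ a) (1# + a)
  sqrt-bound {a} 0≤a x x²≤a with ≤.total x (1# + a)
  ... | inj₁ p = p
  ... | inj₂ p = ≤.trans (1≤x⇒x≤x² (≤.trans 1≤1+a p)) (≤.trans x²≤a a≤1+a)
    where
    1≤1+a : 1# ≤ 1# + a
    1≤1+a = ≤-respˡ (+-identityʳ 1#) (+-monoʳ-≤ 1# 0≤a)
    a≤1+a : a ≤ 1# + a
    a≤1+a = ≤-respˡ (+-identityˡ a) (+-monoˡ-≤ a 0≤1)

  sqrt : ∀ a → 0# ≤ a → R
  sqrt a 0≤a = proj₁ (supremum (λ x → x * x ≤ a)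
    (0# , ≤-respˡ (sym (zeroˡ 0#)) 0≤a)
    (1# + a , sqrt-bound 0≤a))

module Euclidean (ℝ : RealNumbers) where
  open RealNumbers ℝ hiding (zero) renaming (Carrier to R)
  open SquareRoot ℝ using (sqrt; sum-nonNeg; square-nonNeg)

  -- The stored bound need not be optimal, and is ignored by _≈ₚ_.
  record Point : Set where
    field
      coord   : ℕ → R
      bound   : ℕ
      support : ∀ k → bound ℕ.≤ k → coord k ≈ 0#

  open Point public

  _≈ₚ_ : Rel Point 0ℓ
  x ≈ₚ y = ∀ k → coord x k ≈ coord y k

  pointSetoid : Setoid 0ℓ 0ℓ
  pointSetoid = record
    { Carrier       = Point
    ; _≈_           = _≈ₚ_
    ; isEquivalence = record
      { refl  = λ k → refl
      ; sym   = λ p k → sym (p k)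
      ; trans = λ p q k → trans (p k) (q k)
      }
    }

  -- All coordinates from bound x ⊔ bound y onwards vanish in both points.
  squaredDifferences : (x y : Point) → Vector R (bound x ℕ.⊔ bound y)
  squaredDifferences x y i = δ * δ
    where δ = coord x (toℕ i) - coord y (toℕ i)

  dist : Point → Point → R
  dist x y = sqrt (sum (squaredDifferences x y))
    (sum-nonNeg (squaredDifferences x y) (λ _ → square-nonNeg _))

  record Configuration : Set₁ where
    field
      points   : Pred Point 0ℓ
      respects : points Respects _≈ₚ_

  open Configuration public

  _⊑_ : Rel Configuration 0ℓ
  A ⊑ B = points A ⊆ points B

  elements : Configuration → Setoid 0ℓ 0ℓ
  elements A = On.setoid {B = Σ Point (points A)} pointSetoid proj₁

  HasCardinality : Configuration → ℕ → Set
  HasCardinality A n = Bijection (≡.setoid (Fin n)) (elements A)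

  Finite : Configuration → Set
  Finite A = ∃ (HasCardinality A)

  -- Copy B B′ : B′ is a copy of B.
  Copy : Rel Configuration 0ℓ
  Copy B B′ = Σ (Bijection (elements B) (elements B′)) λ f →
    let open Bijection f in
    ∀ x y → dist (proj₁ (to x)) (proj₁ (to y)) ≈ dist (proj₁ x) (proj₁ y)

  _-Free_ : Configuration → Configuration → Set₁
  X -Free Z = ∀ W → W ⊑ Z → ¬ Copy X W

  Coloring : Configuration → ℕ → Set
  Coloring A r = Func (elements A) (≡.setoid (Fin r))

  Monochromatic : ∀ A {r} → Coloring A r → ∀ B → B ⊑ A → Set
  Monochromatic A χ B B⊑A =
    ∃[ c ] ∀ x (x∈B : x ∈ points B) → Func.to χ (x , B⊑A x∈B) ≡ c

  -- A ⟶[ r ] B renders A → (B)_r.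
  _⟶[_]_ : Configuration → ℕ → Configuration → Set₁
  A ⟶[ r ] B = (χ : Coloring A r) →
    Σ Configuration λ B′ → Σ (B′ ⊑ A) λ B′⊑A → Monochromatic A χ B′ B′⊑A × Copy B B′

  AffinelyIndependent : ∀ {n} → (Fin n → Point) → Set
  AffinelyIndependent {n} v = (c : Vector R n) →
    sum c ≈ 0# →
    (∀ k → sum (λ i → c i * coord (v i) k) ≈ 0#) →
    ∀ i → c i ≈ 0#

  IsSimplex : ℕ → Configuration → Set
  IsSimplex d S = Σ (HasCardinality S (suc d)) λ e →
    AffinelyIndependent (λ i → proj₁ (Bijection.to e i))

  LargeFreeSubsets : Configuration → Configuration → R → Set₁
  LargeFreeSubsets X Y μ = ∀ Y′ → Y′ ⊑ Y → ∀ n → HasCardinality Y′ n →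
    Σ Configuration λ Z → Z ⊑ Y′ ×
      (∃[ m ] HasCardinality Z m × μ * fromℕ n ≤ fromℕ m) ×
      X -Free Z

  PRamsey : Configuration → Set₁
  PRamsey X = Finite X ×
    (Σ Configuration λ Y → ∃[ μ ]
      0# < μ × (∀ r → 1 ℕ.≤ r → Y ⟶[ r ] X) × LargeFreeSubsets X Y μ)

{-# OPTIONS --safe #-}
module Submission where

-- Y consists of the points p_J = Σ_s a_s e_(J s), J ranging over the increasing k-tuples of
-- natural numbers, for a suitable weight vector a. If the squared distances of S occur among
-- tuples J_0, …, J_d, then Ramsey's theorem for k-tuples gives Y → (S)_r. Given finitely many
-- tuples, a k-colouring of ℕ chosen by averaging has J s coloured s, for all s, for a fraction
-- k^(-k) of them; distances within this fraction are subset sums of the weights 2 a_s², so it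
-- is S-free as soon as one squared distance D_01 of S is not such a subset sum.
--
-- To choose a: concatenating tuples adds distance matrices, so the realisable matrices form a
-- convex cone. Shifting a long tent function by integers shows that all matrices (t_i - t_j)²
-- lie in its closure. By affine independence D = ρ + M off the diagonal, with ρ > 0 and M a sum
-- of such matrices, so D = (1 - θ) G + E with G realisable and E nearly constant. A nearly
-- constant matrix is a sum of a constant and of two-element blocks (x , -x), each of which
-- increases a single distance; moving a parameter in this sum moves every non-empty subset sum.

open import Defs
open import Level using (0ℓ; Lift; lift) renaming (suc to lsuc)
open import Axiom.ExcludedMiddle using (ExcludedMiddle)
open import Algebra.Solver.Ring.AlmostCommutativeRing using (fromCommutativeRing; _-Raw-AlmostCommutative⟶_)
import Algebra.Properties.AbelianGroup as AbelianGroupProperties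
import Algebra.Properties.Ring as RingProperties
import Algebra.Properties.Semiring.Mult as SemiringMult
import Algebra.Properties.Semiring.Mult.TCOptimised as Mult
import Algebra.Properties.Semiring.Sum as SemiringSum
import Algebra.Solver.Ring as RingSolver
open import Data.Bool.Base using (Bool; true; false; if_then_else_; not)
open import Data.Empty using (⊥-elim)
open import Data.Fin.Base as Fin using (Fin; zero; suc; toℕ)
import Data.Fin.Properties as Finₚ
import Data.Integer.Base as ℤ
import Data.Integer.Properties as ℤₚ
open import Data.Maybe.Base using (Maybe; just; nothing)
open import Data.Nat.Base as ℕ using (ℕ; ∣_-_∣)
import Data.Nat.Properties as ℕₚ
open import Data.Product.Base using (Σ; ∃-syntax; _×_; _,_; proj₁; proj₂)
open import Data.Sum.Base using (_⊎_; inj₁; inj₂)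
open import Data.Unit.Base using (tt)
open import Data.Vec.Base as Vec using (Vec; []; _∷_; lookup; _++_)
open import Data.Vec.Functional using (Vector)
import Data.Vec.Properties as Vecₚ
open import Data.Vec.Relation.Binary.Pointwise.Inductive as Pointwise using (Pointwise; []; _∷_)
open import Data.Vec.Relation.Unary.All as All using (All; []; _∷_)
import Data.Vec.Relation.Unary.All.Properties as Allₚ
open import Function.Base using (_∘_)
open import Function.Bundles using (Func; Bijection)
open import Relation.Nullary using (¬_; Dec; yes; no; does)
open import Relation.Nullary.Decidable using (dec-true; dec-false)
open import Relation.Binary.PropositionalEquality as ≡ using (_≡_; _≢_)

-- If two points of the pattern shared labels only within equal slots, their squared distance would
-- be a subset sum of the weights and the density argument would break down. Labels therefore have
-- to coincide across different slots. The approximating scheme gives no control over its subset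
-- sums, so an exact correction with a parameter of its own is added. Two parameters are needed. A
-- subset sum of the whole scheme is (1 - θ) x + y with x, y subset sums of the weights of G and of
-- E. The parameter h of E moves y unless its subset is empty; the case y = 0 has to be excluded by
-- θ, which is chosen first so that no (1 - θ) x equals D_01. Each condition fails for at most one
-- parameter value, so all sufficiently small values work. The matrices (t_i - t_j)² generate the
-- cone of squared Euclidean distance matrices, but they are reached only in the closure. Affine
-- independence puts D in the interior: the constant ρ pays for the error of the approximation and
-- for the blocks that repair it.

-- Ring solver over the reals with integer coefficients

module IntegerCoefficients (ℝ : RealNumbers) where
  open RealNumbers ℝ hiding (zero) renaming (Carrier to R)
  open RingProperties ring
  open AbelianGroupProperties +-abelianGroup using (⁻¹-∙-comm)
  open Mult semiring using (1+×; ×-homo-+; ×1-homo-*) renaming (_×_ to _×′_)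
  open import Relation.Binary.Reasoning.Setoid setoid

  -- Unlike fromℕ, this sends 1 to 1# definitionally, as the solver requires.
  fromℕ′ : ℕ → R
  fromℕ′ n = n ×′ 1#

  fromℤ : ℤ.ℤ → R
  fromℤ (ℤ.+ n)    = fromℕ′ n
  fromℤ ℤ.-[1+ n ] = - fromℕ′ (ℕ.suc n)

  cancel-suc : ∀ x y → (1# + x) - (1# + y) ≈ x - y
  cancel-suc x y = begin
    (1# + x) - (1# + y)         ≈⟨ +-congˡ (sym (⁻¹-∙-comm 1# y)) ⟩
    (1# + x) + (- 1# + - y)     ≈⟨ +-congʳ (+-comm 1# x) ⟩
    (x + 1#) + (- 1# + - y)     ≈⟨ +-assoc x 1# _ ⟩
    x + (1# + (- 1# + - y))     ≈⟨ +-congˡ (sym (+-assoc 1# (- 1#) (- y))) ⟩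
    x + ((1# - 1#) + - y)       ≈⟨ +-congˡ (+-congʳ (-‿inverseʳ 1#)) ⟩
    x + (0# + - y)              ≈⟨ +-congˡ (+-identityˡ (- y)) ⟩
    x - y                       ∎

  fromℤ-⊖ : ∀ m n → fromℤ (m ℤ.⊖ n) ≈ fromℕ′ m - fromℕ′ n
  fromℤ-⊖ m ℕ.zero = sym (trans (+-congˡ -0#≈0#) (+-identityʳ (fromℕ′ m)))
  fromℤ-⊖ ℕ.zero (ℕ.suc n) = sym (+-identityˡ _)
  fromℤ-⊖ (ℕ.suc m) (ℕ.suc n) rewrite ℤₚ.[1+m]⊖[1+n]≡m⊖n m n =
    begin
    fromℤ (m ℤ.⊖ n)                            ≈⟨ fromℤ-⊖ m n ⟩
    fromℕ′ m - fromℕ′ n                        ≈⟨ sym (cancel-suc (fromℕ′ m) (fromℕ′ n)) ⟩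
    (1# + fromℕ′ m) - (1# + fromℕ′ n)          ≈⟨ +-cong (sym (1+× m 1#)) (-‿cong (sym (1+× n 1#))) ⟩
    fromℕ′ (ℕ.suc m) - fromℕ′ (ℕ.suc n)        ∎

  fromℤ-+ : ∀ i j → fromℤ (i ℤ.+ j) ≈ fromℤ i + fromℤ j
  fromℤ-+ (ℤ.+ m)    (ℤ.+ n)    = ×-homo-+ 1# m n
  fromℤ-+ (ℤ.+ m)    ℤ.-[1+ n ] = fromℤ-⊖ m (ℕ.suc n)
  fromℤ-+ ℤ.-[1+ m ] (ℤ.+ n)    = trans (fromℤ-⊖ n (ℕ.suc m)) (+-comm _ _)
  fromℤ-+ ℤ.-[1+ m ] ℤ.-[1+ n ] = begin
    - fromℕ′ (ℕ.suc (ℕ.suc (m ℕ.+ n)))           ≡⟨ ≡.cong (λ k → - fromℕ′ k) (≡.sym (≡.cong ℕ.suc (ℕₚ.+-suc m n))) ⟩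
    - fromℕ′ (ℕ.suc m ℕ.+ ℕ.suc n)               ≈⟨ -‿cong (×-homo-+ 1# (ℕ.suc m) (ℕ.suc n)) ⟩
    - (fromℕ′ (ℕ.suc m) + fromℕ′ (ℕ.suc n))       ≈⟨ sym (⁻¹-∙-comm _ _) ⟩
    - fromℕ′ (ℕ.suc m) + - fromℕ′ (ℕ.suc n)       ∎

  fromℤ-neg : ∀ i → fromℤ (ℤ.- i) ≈ - fromℤ i
  fromℤ-neg (ℤ.+ ℕ.zero)  = sym -0#≈0#
  fromℤ-neg ℤ.+[1+ n ]    = refl
  fromℤ-neg ℤ.-[1+ n ]    = sym (-‿involutive _)

  fromℤ-pos-* : ∀ m j → fromℤ (ℤ.+ m ℤ.* j) ≈ fromℕ′ m * fromℤ j
  fromℤ-pos-* m (ℤ.+ n) = trans (reflexive (≡.cong fromℤ (≡.sym (ℤₚ.pos-* m n)))) (×1-homo-* m n)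
  fromℤ-pos-* m ℤ.-[1+ n ] = begin
    fromℤ (ℤ.+ m ℤ.* ℤ.-[1+ n ])            ≡⟨ ≡.cong fromℤ (≡.sym (ℤₚ.neg-distribʳ-* (ℤ.+ m) ℤ.+[1+ n ])) ⟩
    fromℤ (ℤ.- (ℤ.+ m ℤ.* ℤ.+[1+ n ]))      ≈⟨ fromℤ-neg (ℤ.+ m ℤ.* ℤ.+[1+ n ]) ⟩
    - fromℤ (ℤ.+ m ℤ.* ℤ.+[1+ n ])          ≈⟨ -‿cong (fromℤ-pos-* m ℤ.+[1+ n ]) ⟩
    - (fromℕ′ m * fromℕ′ (ℕ.suc n))           ≈⟨ -‿distribʳ-* _ _ ⟩
    fromℕ′ m * - fromℕ′ (ℕ.suc n)             ∎

  fromℤ-* : ∀ i j → fromℤ (i ℤ.* j) ≈ fromℤ i * fromℤ j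
  fromℤ-* (ℤ.+ m) j = fromℤ-pos-* m j
  fromℤ-* ℤ.-[1+ m ] j = begin
    fromℤ (ℤ.-[1+ m ] ℤ.* j)                ≡⟨ ≡.cong fromℤ (≡.sym (ℤₚ.neg-distribˡ-* ℤ.+[1+ m ] j)) ⟩
    fromℤ (ℤ.- (ℤ.+[1+ m ] ℤ.* j))          ≈⟨ fromℤ-neg (ℤ.+[1+ m ] ℤ.* j) ⟩
    - fromℤ (ℤ.+[1+ m ] ℤ.* j)              ≈⟨ -‿cong (fromℤ-pos-* (ℕ.suc m) j) ⟩
    - (fromℕ′ (ℕ.suc m) * fromℤ j)           ≈⟨ -‿distribˡ-* _ _ ⟩
    - fromℕ′ (ℕ.suc m) * fromℤ j             ∎

  morphism : ℤ.+-*-rawRing -Raw-AlmostCommutative⟶ fromCommutativeRing commutativeRing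
  morphism = record
    { ⟦_⟧    = fromℤ
    ; +-homo = fromℤ-+
    ; *-homo = fromℤ-*
    ; -‿homo = fromℤ-neg
    ; 0-homo = refl
    ; 1-homo = refl
    }

  equal? : ∀ i j → Maybe (fromℤ i ≈ fromℤ j)
  equal? i j with i ℤₚ.≟ j
  ... | yes p = just (reflexive (≡.cong fromℤ p))
  ... | no _  = nothing

  module Solver = RingSolver ℤ.+-*-rawRing (fromCommutativeRing commutativeRing) morphism equal?

-- Ordered field, square roots and finite sums

module Order (em : ExcludedMiddle (lsuc 0ℓ)) (ℝ : RealNumbers) where
  open RealNumbers ℝ hiding (zero) renaming (Carrier to R) public
  open SquareRoot ℝ public
  open IntegerCoefficients ℝ public using (module Solver)
  open Solver public using (solve; con; _:+_; _:*_; _:-_; :-_; _:=_; Polynomial)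
  open RingProperties ring public using (-0#≈0#; -‿involutive)
  open SemiringMult semiring public using () renaming (×-homo-+ to ·-homo-+; ×1-homo-* to ·1-homo-*)
  module Sums = SemiringSum semiring

  2# : R
  2# = 1# + 1#

  :0 :1 :2 : ∀ {n} → Polynomial n
  :0 = con ℤ.0ℤ
  :1 = con ℤ.1ℤ
  :2 = con (ℤ.+ 2)

  -- Excluded middle is assumed one universe up; `Lift` carries it down to small propositions such
  -- as inequalities between reals.
  dec : (P : Set) → Dec P
  dec P with em {Lift (lsuc 0ℓ) P}
  ... | yes p = yes (Lift.lower p)
  ... | no ¬p = no (λ p → ¬p (lift p))

  -- The standard way here to prove an inequality: name a non-negative difference `d` and leave the
  -- identity to the ring solver.
  ≤-add : ∀ {x y d} → 0# ≤ d → x + d ≈ y → x ≤ y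
  ≤-add {x} p eq = ≤-respˡ (+-identityʳ x) (≤-respʳ eq (+-monoʳ-≤ x p))

  ≤-reflexive : ∀ {x y} → x ≈ y → x ≤ y
  ≤-reflexive = ≤.reflexive

  +-mono-≤ : ∀ {x y u v} → x ≤ y → u ≤ v → x + u ≤ y + v
  +-mono-≤ {y = y} p q = ≤.trans (+-monoˡ-≤ _ p) (+-monoʳ-≤ y q)

  *-monoʳ-≤ : ∀ {c x y} → 0# ≤ c → x ≤ y → c * x ≤ c * y
  *-monoʳ-≤ {c} {x} {y} p q = ≤-add (*-nonNeg p (x≤y⇒0≤y-x q))
    (solve 3 (λ c x y → c :* x :+ c :* (y :- x) := c :* y) refl c x y)

  *-mono-≤ : ∀ {x y u v} → 0# ≤ x → 0# ≤ v → x ≤ y → u ≤ v → x * u ≤ y * v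
  *-mono-≤ {x} {y} {u} {v} 0≤x 0≤v p q =
    ≤.trans (*-monoʳ-≤ 0≤x q) (≤-respˡ (*-comm v x) (≤-respʳ (*-comm v y) (*-monoʳ-≤ 0≤v p)))

  <⇒≤ : ∀ {x y} → x < y → x ≤ y
  <⇒≤ = proj₁

  <⇒≉ : ∀ {x y} → x < y → ¬ x ≈ y
  <⇒≉ = proj₂

  >⇒≉ : ∀ {x y} → x < y → ¬ y ≈ x
  >⇒≉ p q = proj₂ p (sym q)

  <⇒≱ : ∀ {x y} → x < y → ¬ y ≤ x
  <⇒≱ (p , q) r = q (≤.antisym p r)

  ≰⇒> : ∀ {x y} → ¬ x ≤ y → y < x
  ≰⇒> {x} {y} p with ≤.total x y
  ... | inj₁ q = ⊥-elim (p q)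
  ... | inj₂ q = q , λ e → p (≤-reflexive (sym e))

  _≤?_ : ∀ x y → x ≤ y ⊎ y < x
  x ≤? y with dec (x ≤ y)
  ... | yes p = inj₁ p
  ... | no ¬p = inj₂ (≰⇒> ¬p)

  <-respʳ : ∀ {x y z} → x ≈ y → z < x → z < y
  <-respʳ e (p , q) = ≤-respʳ e p , λ r → q (trans r (sym e))

  <-≤-trans : ∀ {x y z} → x < y → y ≤ z → x < z
  <-≤-trans p q = ≤.trans (proj₁ p) q , λ e → <⇒≱ p (≤-respʳ (sym e) q)

  ≤-<-trans : ∀ {x y z} → x ≤ y → y < z → x < z
  ≤-<-trans p q = ≤.trans p (proj₁ q) , λ e → <⇒≱ q (≤-respˡ e p)

  0<1 : 0# < 1#
  0<1 = 0≤1 , λ e → 1≉0 (sym e)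

  pos-+-nonNeg : ∀ {x y} → 0# < x → 0# ≤ y → 0# < x + y
  pos-+-nonNeg {x} {y} p q = <-≤-trans p (≤-add q refl)

  0<2 : 0# < 2#
  0<2 = pos-+-nonNeg 0<1 0≤1

  zero-product : ∀ {x y} → ¬ x ≈ 0# → x * y ≈ 0# → y ≈ 0#
  zero-product {x} {y} x≉0 xy≈0 =
    let (z , xz≈1) = inverse x x≉0 in
    trans (sym (*-identityˡ y)) (trans (*-congʳ (sym xz≈1))
      (trans (solve 3 (λ x y z → x :* z :* y := z :* (x :* y)) refl x y z)
        (trans (*-congˡ xy≈0) (zeroʳ z))))

  pos-* : ∀ {x y} → 0# < x → 0# < y → 0# < x * y
  pos-* {x} {y} (p , p′) (q , q′) = *-nonNeg p q , λ e → q′ (sym (zero-product (λ e → p′ (sym e)) (sym e)))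

  pos-inverse : ∀ {x} → 0# < x → ∃[ y ] 0# < y × x * y ≈ 1#
  pos-inverse {x} 0<x with inverse x (>⇒≉ 0<x)
  ... | y , e with ≤.total 0# y
  ...   | inj₁ p = y , (p , λ z → 1≉0 (trans (sym e) (trans (*-congˡ (sym z)) (zeroʳ x)))) , e
  ...   | inj₂ p = ⊥-elim (<⇒≱ 0<1
    (≤-respˡ e (≤-respʳ (zeroʳ x) (*-monoʳ-≤ (<⇒≤ 0<x) p))))

  ½ : R
  ½ = proj₁ (pos-inverse 0<2)

  0<½ : 0# < ½
  0<½ = proj₁ (proj₂ (pos-inverse 0<2))

  2½≈1 : 2# * ½ ≈ 1#
  2½≈1 = proj₂ (proj₂ (pos-inverse 0<2))

  halves : ∀ x → ½ * x + ½ * x ≈ x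
  halves x = trans (solve 2 (λ h x → h :* x :+ h :* x := (:2 :* h) :* x) refl ½ x)
    (trans (*-congʳ 2½≈1) (*-identityˡ x))

  *-cancelˡ-≤ : ∀ {c x y} → 0# < c → c * x ≤ c * y → x ≤ y
  *-cancelˡ-≤ {c} {x} {y} 0<c p with x ≤? y
  ... | inj₁ q = q
  ... | inj₂ q = ⊥-elim (<⇒≱ (pos-* 0<c (x≤y⇒0≤y-x (<⇒≤ q) , λ e → <⇒≉ q (sym (diff e))))
          (≤-add (x≤y⇒0≤y-x p) (solve 3 (λ c x y → c :* (x :- y) :+ (c :* y :- c :* x) := :0) refl c x y)))
    where
    diff : 0# ≈ x - y → x ≈ y
    diff e = trans (solve 2 (λ x y → x := (x :- y) :+ y) refl x y) (trans (+-congʳ (sym e)) (+-identityˡ y))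

  difference≈0 : ∀ {x y} → x - y ≈ 0# → x ≈ y
  difference≈0 {x} {y} e = trans (solve 2 (λ x y → x := (x :- y) :+ y) refl x y) (trans (+-congʳ e) (+-identityˡ y))

  <⇒0<difference : ∀ {x y} → x < y → 0# < y - x
  <⇒0<difference (p , q) = x≤y⇒0≤y-x p , λ e → q (sym (difference≈0 (sym e)))

  x<x+y : ∀ {x y} → 0# < y → x < x + y
  x<x+y {x} {y} 0<y = ≤-add (<⇒≤ 0<y) refl , λ e → <⇒≉ 0<y
    (sym (trans (solve 2 (λ x y → y := x :+ y :- x) refl x y)
      (trans (+-congʳ (sym e)) (-‿inverseʳ x))))

  min₊ : ∀ x y → 0# < x → 0# < y → ∃[ z ] 0# < z × z ≤ x × z ≤ y
  min₊ x y p q with ≤.total x y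
  ... | inj₁ r = x , p , ≤.refl , r
  ... | inj₂ r = y , q , r , ≤.refl

  square-mono-≤ : ∀ {x y} → 0# ≤ x → x ≤ y → x * x ≤ y * y
  square-mono-≤ p q = *-mono-≤ p (≤.trans p q) q q

  fromℕ-nonNeg : ∀ n → 0# ≤ fromℕ n
  fromℕ-nonNeg ℕ.zero    = ≤.refl
  fromℕ-nonNeg (ℕ.suc n) = nonNeg-+ 0≤1 (fromℕ-nonNeg n)

  fromℕ-mono-≤ : ∀ {m n} → m ℕ.≤ n → fromℕ m ≤ fromℕ n
  fromℕ-mono-≤ {n = n} ℕ.z≤n = fromℕ-nonNeg n
  fromℕ-mono-≤ (ℕ.s≤s p)     = +-monoʳ-≤ 1# (fromℕ-mono-≤ p)

  fromℕ-pos : ∀ {n} → 1 ℕ.≤ n → 0# < fromℕ n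
  fromℕ-pos {ℕ.suc n} _ = pos-+-nonNeg 0<1 (fromℕ-nonNeg n)

  -- Otherwise the naturals have a supremum s. Since n + 1 ≤ s for every n, already s - 1 bounds
  -- them, against minimality.
  archimedean : ∀ x → ∃[ n ] x ≤ fromℕ n
  archimedean x with dec (∃[ n ] x ≤ fromℕ n)
  ... | yes p = p
  ... | no ¬p = ⊥-elim (<⇒≱ s-1<s (s-least (s - 1#) bounded))
    where
    naturals : R → Set
    naturals y = ∃[ n ] y ≈ fromℕ n
    above : UpperBound naturals x
    above y (n , e) = ≤-respˡ (sym e) (<⇒≤ (≰⇒> λ q → ¬p (n , q)))
    sup = supremum naturals (0# , 0 , refl) (x , above)
    s = proj₁ sup
    s-least = proj₂ (proj₂ sup)
    s-1<s : s - 1# < s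
    s-1<s = ≤-add 0≤1 (solve 1 (λ s → s :- :1 :+ :1 := s) refl s)
      , λ e → 1≉0 (trans (solve 1 (λ s → :1 := s :- (s :- :1)) refl s)
                    (trans (+-congˡ (-‿cong e)) (-‿inverseʳ s)))
    bounded : UpperBound naturals (s - 1#)
    bounded y (n , e) = ≤-respˡ (sym e) (≤-respˡ
      (solve 1 (λ m → :1 :+ m :- :1 := m) refl (fromℕ n))
      (+-monoˡ-≤ (- 1#) (proj₁ (proj₂ sup) (fromℕ (ℕ.suc n)) (ℕ.suc n , refl))))

  larger-square : ∀ {s a} → 0# ≤ s → s * s < a → ∃[ t ] s < t × t * t ≤ a
  larger-square {s} {a} 0≤s s²<a = s + h , s<s+h , s+h-small
    where
    e = a - s * s
    0<e = <⇒0<difference s²<a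
    -- The step is h = e / k. The summand `e` of k gives h ≤ 1; since also (2s + 1) h ≤ e, it
    -- follows that (s + h)² ≤ s² + (2s + 1) h ≤ a.
    k = e + (2# * s + 1#)
    0≤2s+1 = nonNeg-+ (*-nonNeg (<⇒≤ 0<2) 0≤s) 0≤1
    inv = pos-inverse (pos-+-nonNeg 0<e 0≤2s+1)
    k⁻¹ = proj₁ inv
    h = e * k⁻¹
    0<h = pos-* 0<e (proj₁ (proj₂ inv))
    0≤h = <⇒≤ 0<h
    kh≈e : k * h ≈ e
    kh≈e = trans (solve 3 (λ k e i → k :* (e :* i) := (k :* i) :* e) refl k e k⁻¹)
      (trans (*-congʳ (proj₂ (proj₂ inv))) (*-identityˡ e))
    h≤1 : h ≤ 1#
    h≤1 = ≤-respʳ (proj₂ (proj₂ inv)) (≤-respˡ (*-comm k⁻¹ e) (≤-respʳ (*-comm k⁻¹ k)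
      (*-monoʳ-≤ (<⇒≤ (proj₁ (proj₂ inv))) (≤-add 0≤2s+1 refl))))
    s<s+h : s < s + h
    s<s+h = x<x+y 0<h
    s+h-small : (s + h) * (s + h) ≤ a
    s+h-small = ≤-add (nonNeg-+ (*-nonNeg 0≤h (x≤y⇒0≤y-x h≤1)) (*-nonNeg (<⇒≤ 0<e) 0≤h))
      (trans (solve 3 (λ s h e → (s :+ h) :* (s :+ h) :+ (h :* (:1 :- h) :+ e :* h)
                  := s :* s :+ (e :+ (:2 :* s :+ :1)) :* h) refl s h e)
        (trans (+-congˡ kh≈e) (solve 2 (λ s a → s :* s :+ (a :- s :* s) := a) refl s a)))

  smaller-square : ∀ {s a} → 0# ≤ s → 0# ≤ a → a < s * s →
    ∃[ t ] t < s × 0# ≤ t × a < t * t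
  smaller-square {s} {a} 0≤s 0≤a a<s² = s - h , s-h<s , 0≤s-h , a<[s-h]²
    where
    0<s : 0# < s
    0<s = 0≤s , λ e → <⇒≱ a<s² (≤-respˡ (trans (sym (zeroˡ 0#)) (*-cong e e)) 0≤a)
    e = s * s - a
    0<e = <⇒0<difference a<s²
    inv = pos-inverse (pos-* 0<2 0<s)
    i = proj₁ inv
    -- The Newton step for t² = a: here (s - h)² = a + h², which still exceeds a.
    h = e * i
    0<h = pos-* 0<e (proj₁ (proj₂ inv))
    2sh≈e : 2# * s * h ≈ e
    2sh≈e = trans (solve 3 (λ t e i → t :* (e :* i) := (t :* i) :* e) refl (2# * s) e i)
      (trans (*-congʳ (proj₂ (proj₂ inv))) (*-identityˡ e))
    s-h<s : s - h < s
    s-h<s = <-respʳ (solve 2 (λ s h → s :- h :+ h := s) refl s h) (x<x+y 0<h)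
    a<[s-h]² : a < (s - h) * (s - h)
    a<[s-h]² = <-respʳ
        (trans (solve 3 (λ a s h → a :+ h :* h := (s :* s :- (s :* s :- a)) :+ h :* h) refl a s h)
         (trans (+-congʳ (+-congˡ (-‿cong (sym 2sh≈e))))
          (solve 2 (λ s h → s :* s :- :2 :* s :* h :+ h :* h := (s :- h) :* (s :- h)) refl s h)))
      (x<x+y (pos-* 0<h 0<h))
    0≤s-h : 0# ≤ s - h
    0≤s-h = *-cancelˡ-≤ (pos-* 0<2 0<s) (≤-respˡ (sym (zeroʳ _))
      (≤-respʳ (trans
        (solve 2 (λ a s → a :+ s :* s := :2 :* s :* s :- (s :* s :- a)) refl a s)
        (trans (+-congˡ (-‿cong (sym 2sh≈e)))
          (solve 2 (λ s h → :2 :* s :* s :- :2 :* s :* h := :2 :* s :* (s :- h)) refl s h)))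
       (nonNeg-+ 0≤a (square-nonNeg s))))

  supremum-square : ∀ {s a} → 0# ≤ s → 0# ≤ a → Supremum (λ x → x * x ≤ a) s → s * s ≈ a
  supremum-square {s} {a} 0≤s 0≤a (upper , least) with (s * s) ≤? a | a ≤? (s * s)
  ... | inj₁ p | inj₁ q = ≤.antisym p q
  ... | inj₁ p | inj₂ q =
    let (t , s<t , t²≤a) = larger-square 0≤s q in ⊥-elim (<⇒≱ s<t (upper t t²≤a))
  ... | inj₂ p | _ =
    let (t , t<s , 0≤t , a<t²) = smaller-square 0≤s 0≤a p in
    ⊥-elim (<⇒≱ t<s (least t λ x x²≤a → bounded 0≤t a<t² x x²≤a (x ≤? t)))
    where
    bounded : ∀ {t} → 0# ≤ t → a < t * t → ∀ x → x * x ≤ a → x ≤ t ⊎ t < x → x ≤ t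
    bounded 0≤t a<t² x x²≤a (inj₁ q) = q
    bounded 0≤t a<t² x x²≤a (inj₂ q) =
      ⊥-elim (<⇒≱ a<t² (≤.trans (square-mono-≤ 0≤t (<⇒≤ q)) x²≤a))

  module _ (a : R) (0≤a : 0# ≤ a) where
    private
      -- Literally the supremum that defines `sqrt`, so its properties speak of `sqrt a 0≤a` by
      -- definition.
      bounds = supremum (λ x → x * x ≤ a) (0# , ≤-respˡ (sym (zeroˡ 0#)) 0≤a) (1# + a , sqrt-bound 0≤a)

    sqrt-nonNeg : 0# ≤ sqrt a 0≤a
    sqrt-nonNeg = proj₁ (proj₂ bounds) 0# (≤-respˡ (sym (zeroˡ 0#)) 0≤a)

    sqrt-square : sqrt a 0≤a * sqrt a 0≤a ≈ a
    sqrt-square = supremum-square sqrt-nonNeg 0≤a (proj₂ bounds)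

  sqrt-injective : ∀ {a b p q} → sqrt a p ≈ sqrt b q → a ≈ b
  sqrt-injective {a} {b} {p} {q} e = trans (sym (sqrt-square a p)) (trans (*-cong e e) (sqrt-square b q))

  square-injective : ∀ {x y} → 0# ≤ x → 0# ≤ y → x * x ≈ y * y → x ≈ y
  square-injective {x} {y} p q e with dec (x + y ≈ 0#)
  ... | no z = difference≈0 (zero-product z (trans
      (solve 2 (λ x y → (x :+ y) :* (x :- y) := x :* x :- y :* y) refl x y)
      (trans (+-congʳ e) (-‿inverseʳ _))))
  ... | yes z = trans (≤.antisym (≤-respʳ z (≤-add q refl)) p) (≤.antisym q (≤-respʳ z (≤-add p (+-comm y x))))

  sqrt-cong : ∀ {a b p q} → a ≈ b → sqrt a p ≈ sqrt b q
  sqrt-cong {a} {b} {p} {q} e = square-injective (sqrt-nonNeg a p) (sqrt-nonNeg b q)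
    (trans (sqrt-square a p) (trans e (sym (sqrt-square b q))))

  sum-cong : ∀ {n} {f g : Vector R n} → (∀ i → f i ≈ g i) → sum f ≈ sum g
  sum-cong = Sums.sum-cong-≋

  sum-mono-≤ : ∀ {n} {f g : Vector R n} → (∀ i → f i ≤ g i) → sum f ≤ sum g
  sum-mono-≤ {ℕ.zero}  p = ≤.refl
  sum-mono-≤ {ℕ.suc n} p = +-mono-≤ (p zero) (sum-mono-≤ (λ i → p (suc i)))

  sum-zero : ∀ {n} {f : Vector R n} → (∀ i → f i ≈ 0#) → sum f ≈ 0#
  sum-zero {n} p = trans (sum-cong p) (Sums.sum-replicate-zero n)

  sum-const : ∀ n x → sum {n} (λ _ → x) ≈ fromℕ n * x
  sum-const ℕ.zero    x = sym (zeroˡ x)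
  sum-const (ℕ.suc n) x = trans (+-congˡ (sum-const n x))
    (solve 2 (λ x m → x :+ m :* x := (:1 :+ m) :* x) refl x (fromℕ n))

  sum-+ : ∀ {n} (f g : Vector R n) → sum (λ i → f i + g i) ≈ sum f + sum g
  sum-+ = Sums.∑-distrib-+

  sum-* : ∀ {n} c (f : Vector R n) → sum (λ i → c * f i) ≈ c * sum f
  sum-* c f = sym (Sums.*-distribˡ-sum c f)

  ≤-sum : ∀ {n} (f : Vector R n) → (∀ i → 0# ≤ f i) → ∀ i → f i ≤ sum f
  ≤-sum f p zero    = ≤-add (sum-nonNeg (λ i → f (suc i)) (λ i → p (suc i))) refl
  ≤-sum f p (suc i) = ≤.trans (≤-sum (λ i → f (suc i)) (λ i → p (suc i)) i)
    (≤-add (p zero) (+-comm _ _))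

-- Ramsey's theorem for increasing tuples

module TupleCombinatorics where
  import Algebra.Properties.Semiring.Sum as SemiringSum
  open import Data.Bool.Base using (Bool; true; false; if_then_else_)
  open import Data.Empty using (⊥-elim)
  open import Data.Fin.Base as Fin using (Fin; zero; suc)
  import Data.Fin.Properties as Finₚ
  open import Data.Nat.Base using (ℕ; zero; suc; _+_; _*_; _^_; _≤_; _<_; _⊔_; z≤n; s≤s)
  open import Data.Nat.Properties
  open import Data.Product.Base using (Σ; ∃-syntax; _×_; _,_; proj₁; proj₂)
  open import Data.Sum.Base using (_⊎_; inj₁; inj₂)
  open import Data.Unit.Base using (⊤; tt)
  open import Data.Vec.Base using (Vec; []; _∷_; map; lookup; allFin)
  open import Data.Vec.Properties using (map-∘; lookup-allFin)
  open import Function.Base using (_∘_; id)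
  open import Function.Definitions using (Injective)
  open import Relation.Binary.Definitions using (tri<; tri≈; tri>)
  open import Relation.Nullary using (¬_; Dec; yes; no; does)
  open import Relation.Nullary.Decidable using (_×-dec_; dec-true; dec-false)
  open import Relation.Binary.PropositionalEquality as ≡ using (_≡_; _≢_; refl; sym; trans; cong; cong₂; subst; module ≡-Reasoning)

  StrictlyIncreasing : (ℕ → ℕ) → Set
  StrictlyIncreasing h = ∀ {m n} → m < n → h m < h n

  strictlyIncreasing⇒injective : ∀ {h} → StrictlyIncreasing h → ∀ {m n} → h m ≡ h n → m ≡ n
  strictlyIncreasing⇒injective {h} inc {m} {n} eq with <-cmp m n
  ... | tri< m<n _ _ = ⊥-elim (<-irrefl eq (inc m<n))
  ... | tri≈ _ m≡n _ = m≡n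
  ... | tri> _ _ n<m = ⊥-elim (<-irrefl (sym eq) (inc n<m))

  Increasing : ℕ → ∀ {k} → Vec ℕ k → Set
  Increasing b []       = ⊤
  Increasing b (x ∷ xs) = b ≤ x × Increasing (suc x) xs

  increasing? : ∀ b {k} (J : Vec ℕ k) → Dec (Increasing b J)
  increasing? b []       = yes tt
  increasing? b (x ∷ xs) = (b ≤? x) ×-dec increasing? (suc x) xs

  increasing-weaken : ∀ {a b k} {J : Vec ℕ k} → a ≤ b → Increasing b J → Increasing a J
  increasing-weaken {J = []}    a≤b _        = tt
  increasing-weaken {J = x ∷ J} a≤b (p , ps) = ≤-trans a≤b p , ps

  increasing-map : ∀ {h} → StrictlyIncreasing h → ∀ {b k} {J : Vec ℕ k} →
    Increasing b J → Increasing (h b) (map h J)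
  increasing-map inc {J = []} _ = tt
  increasing-map {h} inc {b} {J = x ∷ J} (p , ps) =
    monotone (m≤n⇒m<n∨m≡n p) , increasing-weaken (inc (n<1+n x)) (increasing-map inc ps)
    where
    monotone : b < x ⊎ b ≡ x → h b ≤ h x
    monotone (inj₁ q) = <⇒≤ (inc q)
    monotone (inj₂ q) = ≤-reflexive (cong h q)

  increasing-pred : ∀ {b k} {J : Vec ℕ k} → Increasing (suc b) J →
    ∃[ J′ ] Increasing b J′ × J ≡ map suc J′
  increasing-pred {J = []} _ = [] , tt , refl
  increasing-pred {J = suc x ∷ J} (s≤s p , ps) =
    let (J′ , q , eq) = increasing-pred ps in x ∷ J′ , (p , q) , cong (suc x ∷_) eq

  upperBound : ∀ {n} (f : Fin n → ℕ) → ∃[ M ] (∀ i → f i ≤ M)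
  upperBound {zero}  f = 0 , λ ()
  upperBound {suc n} f =
    let (M , p) = upperBound (f ∘ suc) in
    f zero ⊔ M , λ { zero → m≤m⊔n (f zero) M ; (suc i) → ≤-trans (p i) (m≤n⊔m (f zero) M) }

  module Ramsey (dec : (P : Set) → Dec P) where

    -- If every colour disappeared from some position on, the colour of a position `M` beyond all of
    -- these would be a contradiction.
    pigeonhole : ∀ {r} (f : ℕ → Fin r) → ∃[ c ] (∀ m → ∃[ n ] m ≤ n × f n ≡ c)
    pigeonhole {r} f with dec (∃[ c ] (∀ m → ∃[ n ] m ≤ n × f n ≡ c))
    ... | yes p = p
    ... | no ¬p = ⊥-elim (proj₂ (last (f M)) M (proj₂ bound (f M)) refl)
      where
      last : ∀ c → ∃[ m ] (∀ n → m ≤ n → f n ≢ c)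
      last c with dec (∃[ m ] (∀ n → m ≤ n → f n ≢ c))
      ... | yes q = q
      ... | no ¬q = ⊥-elim (¬p (c , often))
        where
        often : ∀ m → ∃[ n ] m ≤ n × f n ≡ c
        often m with dec (∃[ n ] m ≤ n × f n ≡ c)
        ... | yes q′ = q′
        ... | no ¬q′ = ⊥-elim (¬q (m , λ n m≤n eq → ¬q′ (n , m≤n , eq)))
      bound = upperBound (λ c → proj₁ (last c))
      M = proj₁ bound

    constantSubsequence : ∀ {r} (f : ℕ → Fin r) →
      ∃[ t ] StrictlyIncreasing t × ∃[ c ] (∀ i → f (t i) ≡ c)
    constantSubsequence f = t , t-increasing , c , t-constant
      where
      c = proj₁ (pigeonhole f)
      often = proj₂ (pigeonhole f)
      t : ℕ → ℕ
      t zero    = proj₁ (often 0)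
      t (suc i) = proj₁ (often (suc (t i)))
      t-step : ∀ i → t i < t (suc i)
      t-step i = proj₁ (proj₂ (often (suc (t i))))
      t-increasing : StrictlyIncreasing t
      t-increasing {m} {suc n} (s≤s m≤n) with m≤n⇒m<n∨m≡n m≤n
      ... | inj₁ m<n  = <-trans (t-increasing m<n) (t-step n)
      ... | inj₂ refl = t-step m
      t-constant : ∀ i → f (t i) ≡ c
      t-constant zero    = proj₂ (proj₂ (often 0))
      t-constant (suc i) = proj₂ (proj₂ (often (suc (t i))))

    ramsey : ∀ k {r} (χ : Vec ℕ k → Fin r) →
      ∃[ h ] StrictlyIncreasing h × ∃[ c ] (∀ (J : Vec ℕ k) → Increasing 0 J → χ (map h J) ≡ c)
    ramsey zero    χ = id , id , χ [] , λ { [] _ → refl }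
    ramsey (suc k) χ = h , h-increasing , c , homogeneous
      where
      -- Each choice of the least element g 0 restricts the later ones to a set
      -- on which the colour depends on that least element only.
      fix : ∀ g → ∃[ h ] StrictlyIncreasing h ×
        ∃[ c ] (∀ J → Increasing 0 J → χ (g 0 ∷ map (g ∘ suc) (map h J)) ≡ c)
      fix g = ramsey k (λ J → χ (g 0 ∷ map (g ∘ suc) J))

      next : (ℕ → ℕ) → ℕ → ℕ
      next g = g ∘ suc ∘ proj₁ (fix g)

      -- `g (index g i)` is the i-th chosen least element: choice m + 1 from `g` is choice m from
      -- `next g`, carried back into `g` through `fix g`.
      index : (ℕ → ℕ) → ℕ → ℕ
      index g zero    = 0
      index g (suc m) = suc (proj₁ (fix g) (index (next g) m))

      colour : (ℕ → ℕ) → ℕ → Fin _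
      colour g zero    = proj₁ (proj₂ (proj₂ (fix g)))
      colour g (suc m) = colour (next g) m

      index-increasing : ∀ g → StrictlyIncreasing (index g)
      index-increasing g {zero}  {suc n} _         = s≤s z≤n
      index-increasing g {suc m} {suc n} (s≤s m<n) =
        s≤s (proj₁ (proj₂ (fix g)) (index-increasing (next g) m<n))

      -- Entries after the i-th choice lie in the set to which that choice restricted the sequence,
      -- and there `fix` has made the colour constant. Later choices reduce to the first choice of a
      -- thinner sequence.
      leastDetermines : ∀ g i J → Increasing (suc i) J →
        χ (g (index g i) ∷ map (g ∘ index g) J) ≡ colour g i
      leastDetermines g zero J inc with increasing-pred inc
      ... | J′ , inc′ , refl = trans (cong (λ K → χ (g 0 ∷ K)) split)
          (proj₂ (proj₂ (proj₂ (fix g))) (map (index (next g)) J′)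
            (increasing-map (index-increasing (next g)) inc′))
        where
        split : map (g ∘ index g) (map suc J′) ≡
          map (g ∘ suc) (map (proj₁ (fix g)) (map (index (next g)) J′))
        split = trans (sym (map-∘ _ _ J′)) (trans (map-∘ _ _ J′) (cong (map (g ∘ suc)) (map-∘ _ _ J′)))
      leastDetermines g (suc i) J inc with increasing-pred inc
      ... | J′ , inc′ , refl = trans
        (cong (λ K → χ (g (index g (suc i)) ∷ K)) (sym (map-∘ _ _ J′)))
        (leastDetermines (next g) i J′ inc′)

      -- The colour of a tuple now depends on its least element alone; passing to a constant
      -- subsequence removes this dependence too.
      subsequence = constantSubsequence (colour id)
      t = proj₁ subsequence
      t-increasing = proj₁ (proj₂ subsequence)
      c = proj₁ (proj₂ (proj₂ subsequence))

      h : ℕ → ℕ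
      h = index id ∘ t

      h-increasing : StrictlyIncreasing h
      h-increasing m<n = index-increasing id (t-increasing m<n)

      homogeneous : ∀ J → Increasing 0 J → χ (map h J) ≡ c
      homogeneous (x ∷ J) (_ , inc) = trans
        (cong (λ K → χ (h x ∷ K)) (map-∘ _ _ J))
        (trans (leastDetermines id (t x) (map t J)
            (increasing-weaken (t-increasing (n<1+n x)) (increasing-map t-increasing inc)))
          (proj₂ (proj₂ (proj₂ subsequence)) x))

  -- Colourings of ℕ by conditional expectations

  open SemiringSum +-*-semiring using (sum; sum-cong-≗; ∑-comm; *-distribˡ-sum; sum-replicate-zero)

  sum-mono-≤ : ∀ {n} {f g : Fin n → ℕ} → (∀ i → f i ≤ g i) → sum f ≤ sum g
  sum-mono-≤ {zero}  p = z≤n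
  sum-mono-≤ {suc n} p = +-mono-≤ (p zero) (sum-mono-≤ (p ∘ suc))

  sum-const : ∀ n x → sum {n} (λ _ → x) ≡ n * x
  sum-const zero    x = refl
  sum-const (suc n) x = cong (x +_) (sum-const n x)

  sum-indicator : ∀ {n} (s : Fin n) x → sum (λ c → if does (c Finₚ.≟ s) then x else 0) ≡ x
  sum-indicator {suc n} zero x = trans (cong (x +_) (sum-replicate-zero n)) (+-identityʳ x)
  sum-indicator {suc n} (suc s) x = trans (sum-cong-≗ shift) (sum-indicator s x)
    where
    shift : ∀ c → (if does (suc c Finₚ.≟ suc s) then x else 0) ≡ (if does (c Finₚ.≟ s) then x else 0)
    shift c with c Finₚ.≟ s
    ... | yes _ = refl
    ... | no _  = refl

  average≤max : ∀ {k} (f : Fin (suc k) → ℕ) a → suc k * a ≤ sum f → ∃[ c ] a ≤ f c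
  average≤max {zero}  f a p = zero , subst (_≤ f zero) (+-identityʳ a) (subst (a + 0 ≤_) (+-identityʳ (f zero)) p)
  average≤max {suc k} f a p with a ≤? f zero
  ... | yes q = zero , q
  ... | no ¬q =
    let (c , r) = average≤max (f ∘ suc) a (+-cancelˡ-≤ (f zero) _ _ (≤-trans (+-monoˡ-≤ _ (<⇒≤ (≰⇒> ¬q))) p))
    in suc c , r

  count : ∀ {n} → (Fin n → Bool) → ℕ
  count good = sum (λ i → if good i then 1 else 0)

  module Transversals (k-1 : ℕ) where

    k = suc k-1

    update : (ℕ → Fin k) → ℕ → Fin k → ℕ → Fin k
    update f M c x = if does (x ≟ M) then c else f x

    -- Conditional expectations: weight M f ps J is k^m times the probability that the m-tuple J
    -- is coloured by ps when the colours of all x ≥ M are drawn at random.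
    factor : ℕ → (ℕ → Fin k) → Fin k → ℕ → ℕ
    factor M f s x with x <? M
    ... | no _  = 1
    ... | yes _ = if does (f x Finₚ.≟ s) then k else 0

    weight : ℕ → (ℕ → Fin k) → ∀ {m} → Vec (Fin k) m → Vec ℕ m → ℕ
    weight M f []       []      = 1
    weight M f (s ∷ ps) (x ∷ J) = factor M f s x * weight M f ps J

    factor-update-≢ : ∀ M f c s x → x ≢ M → factor (suc M) (update f M c) s x ≡ factor M f s x
    factor-update-≢ M f c s x x≢M with x <? suc M | x <? M
    ... | yes p | no q  = ⊥-elim (x≢M (≤-antisym (≤-pred p) (≮⇒≥ q)))
    ... | no p  | yes q = ⊥-elim (p (<-trans q (n<1+n M)))
    ... | no _  | no _  = refl
    ... | yes _ | yes _ rewrite dec-false (x ≟ M) x≢M = refl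

    factor-update-≡ : ∀ M f c s → factor (suc M) (update f M c) s M ≡ (if does (c Finₚ.≟ s) then k else 0)
    factor-update-≡ M f c s with M <? suc M
    ... | no p  = ⊥-elim (p (n<1+n M))
    ... | yes _ rewrite dec-true (M ≟ M) refl = refl

    factor-undecided : ∀ M f s → factor M f s M ≡ 1
    factor-undecided M f s with M <? M
    ... | yes p = ⊥-elim (<-irrefl refl p)
    ... | no _  = refl

    weight-update : ∀ M f c {m} (ps : Vec (Fin k) m) J → Increasing (suc M) J →
      weight (suc M) (update f M c) ps J ≡ weight M f ps J
    weight-update M f c []       []      _        = refl
    weight-update M f c (s ∷ ps) (x ∷ J) (p , inc) = cong₂ _*_
      (factor-update-≢ M f c s x (λ eq → <-irrefl (sym eq) p))
      (weight-update M f c ps J (increasing-weaken (≤-trans p (n≤1+n x)) inc))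

    -- Colouring `M` affects at most one entry of an increasing tuple. If `M` occurs, its factor 1
    -- becomes `k` for one of the `k` colours and 0 for the others; otherwise all summands equal the
    -- old weight.
    weight-average : ∀ M f {b m} (ps : Vec (Fin k) m) J → Increasing b J →
      sum (λ c → weight (suc M) (update f M c) ps J) ≡ k * weight M f ps J
    weight-average M f []       []      _         = sum-const k 1
    weight-average M f (s ∷ ps) (x ∷ J) (_ , inc) with <-cmp x M
    ... | tri< _ x≢M _ = begin
        sum (λ c → factor (suc M) (update f M c) s x * weight (suc M) (update f M c) ps J)
          ≡⟨ sum-cong-≗ (λ c → cong (_* weight (suc M) (update f M c) ps J) (factor-update-≢ M f c s x x≢M)) ⟩
        sum (λ c → a * weight (suc M) (update f M c) ps J)
          ≡⟨ sym (*-distribˡ-sum a (λ c → weight (suc M) (update f M c) ps J)) ⟩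
        a * sum (λ c → weight (suc M) (update f M c) ps J)
          ≡⟨ cong (a *_) (weight-average M f ps J inc) ⟩
        a * (k * w)
          ≡⟨ sym (*-assoc a k w) ⟩
        a * k * w
          ≡⟨ cong (_* w) (*-comm a k) ⟩
        k * a * w
          ≡⟨ *-assoc k a w ⟩
        k * (a * w) ∎
      where
      open ≡-Reasoning
      a = factor M f s x
      w = weight M f ps J
    ... | tri≈ _ refl _ = begin
        sum (λ c → factor (suc M) (update f M c) s M * weight (suc M) (update f M c) ps J)
          ≡⟨ sum-cong-≗ (λ c → trans (cong₂ _*_ (factor-update-≡ M f c s) (weight-update M f c ps J inc))
              (*-comm (if does (c Finₚ.≟ s) then k else 0) w)) ⟩
        sum (λ c → w * (if does (c Finₚ.≟ s) then k else 0))
          ≡⟨ sym (*-distribˡ-sum w (λ c → if does (c Finₚ.≟ s) then k else 0)) ⟩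
        w * sum (λ c → if does (c Finₚ.≟ s) then k else 0)
          ≡⟨ cong (w *_) (sum-indicator s k) ⟩
        w * k
          ≡⟨ *-comm w k ⟩
        k * w
          ≡⟨ cong (k *_) (sym (trans (cong (_* w) (factor-undecided M f s)) (*-identityˡ w))) ⟩
        k * (factor M f s M * w) ∎
      where
      open ≡-Reasoning
      w = weight M f ps J
    ... | tri> _ x≢M M<x = begin
        sum (λ c → factor (suc M) (update f M c) s x * weight (suc M) (update f M c) ps J)
          ≡⟨ sum-cong-≗ (λ c → cong₂ _*_ (factor-update-≢ M f c s x x≢M)
               (weight-update M f c ps J (increasing-weaken (≤-trans M<x (n≤1+n x)) inc))) ⟩
        sum {k} (λ c → factor M f s x * weight M f ps J)
          ≡⟨ sum-const k _ ⟩
        k * (factor M f s x * weight M f ps J) ∎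
      where open ≡-Reasoning

    weight-bound : ∀ M f {m} (ps : Vec (Fin k) m) J → weight M f ps J ≤ k ^ m
    weight-bound M f []       []      = ≤-refl
    weight-bound M f (s ∷ ps) (x ∷ J) = *-mono-≤ factor-bound (weight-bound M f ps J)
      where
      factor-bound : factor M f s x ≤ k
      factor-bound with x <? M
      ... | no _  = s≤s z≤n
      ... | yes _ with does (f x Finₚ.≟ s)
      ...   | true  = ≤-refl
      ...   | false = z≤n

    weight-nonzero : ∀ M f {m} (ps : Vec (Fin k) m) J → (∀ s → lookup J s < M) →
      weight M f ps J ≢ 0 → ∀ s → f (lookup J s) ≡ lookup ps s
    weight-nonzero M f (s ∷ ps) (x ∷ J) below ≢0 (suc i) =
      weight-nonzero M f ps J (below ∘ suc) (λ eq → ≢0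
          (trans (cong (factor M f s x *_) eq) (*-zeroʳ (factor M f s x)))) i
    weight-nonzero M f (s ∷ ps) (x ∷ J) below ≢0 zero with x <? M
    ... | no p  = ⊥-elim (p (below zero))
    ... | yes _ with f x Finₚ.≟ s
    ...   | yes eq = eq
    ...   | no _   = ⊥-elim (≢0 refl)

    module _ {n} (J : Fin n → Vec ℕ k) (inc : ∀ i → Increasing 0 (J i)) where

      total : ℕ → (ℕ → Fin k) → ℕ
      total M f = sum (λ i → weight M f (allFin k) (J i))

      improve : ∀ M f → ∃[ c ] total M f ≤ total (suc M) (update f M c)
      improve M f = average≤max (λ c → total (suc M) (update f M c)) (total M f) (≤-reflexive (begin
        k * total M f
          ≡⟨ *-distribˡ-sum k (λ i → weight M f (allFin k) (J i)) ⟩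
        sum (λ i → k * weight M f (allFin k) (J i))
          ≡⟨ sum-cong-≗ (λ i → sym (weight-average M f (allFin k) (J i) (inc i))) ⟩
        sum (λ i → sum (λ c → weight (suc M) (update f M c) (allFin k) (J i)))
          ≡⟨ ∑-comm (λ i c → weight (suc M) (update f M c) (allFin k) (J i)) ⟩
        sum (λ c → total (suc M) (update f M c)) ∎))
        where open ≡-Reasoning

      -- Before any number is coloured every tuple has weight 1, so the total starts at `n`; some
      -- colour for the next number does not decrease it.
      best : ∀ M → ∃[ f ] n ≤ total M f
      best zero = (λ _ → zero) , ≤-reflexive (sym (trans (sum-cong-≗ (λ i → initial (allFin k) (J i)))
          (trans (sum-const n 1) (*-identityʳ n))))
        where
        initial : ∀ {f m} (ps : Vec (Fin k) m) J → weight 0 f ps J ≡ 1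
        initial []       []      = refl
        initial (s ∷ ps) (x ∷ J) = trans (+-identityʳ _) (initial ps J)
      best (suc M) = let (f , p) = best M ; (c , q) = improve M f in update f M c , ≤-trans p q

      -- Once all entries are coloured, a non-zero weight means that the tuple is coloured as
      -- wanted. Each weight is at most `k ^ k` and the total at least `n`, so at least n / k^k
      -- tuples have non-zero weight.
      transversal : Σ (ℕ → Fin k) λ f → Σ (Fin n → Bool) λ good →
        (∀ i → good i ≡ true → ∀ s → f (lookup (J i) s) ≡ s) × n ≤ k ^ k * count good
      transversal = f , good , coloured , ≤-trans (proj₂ (best M)) (≤-trans (sum-mono-≤ bounded)
          (≤-reflexive (sym (*-distribˡ-sum (k ^ k) (λ i → if good i then 1 else 0)))))
        where
        M = suc (proj₁ (upperBound (λ i → proj₁ (upperBound (lookup (J i))))))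
        below : ∀ i s → lookup (J i) s < M
        below i s = s≤s (≤-trans (proj₂ (upperBound (lookup (J i))) s)
          (proj₂ (upperBound (λ i → proj₁ (upperBound (lookup (J i))))) i))
        f = proj₁ (best M)
        good : Fin n → Bool
        good i with weight M f (allFin k) (J i)
        ... | zero  = false
        ... | suc _ = true
        nonzero : ∀ i → good i ≡ true → weight M f (allFin k) (J i) ≢ 0
        nonzero i eq with weight M f (allFin k) (J i)
        ... | suc _ = λ ()
        coloured : ∀ i → good i ≡ true → ∀ s → f (lookup (J i) s) ≡ s
        coloured i eq s = trans (weight-nonzero M f (allFin k) (J i) (below i) (nonzero i eq) s) (lookup-allFin s)
        bounded : ∀ i → weight M f (allFin k) (J i) ≤ k ^ k * (if good i then 1 else 0)
        bounded i with weight M f (allFin k) (J i) | weight-bound M f (allFin k) (J i)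
        ... | zero  | _ = z≤n
        ... | suc w | p = ≤-trans p (≤-reflexive (sym (*-identityʳ (k ^ k))))

  -- In this form the selected indices supply the bijection from a `Fin` that `HasCardinality` asks
  -- for.
  record Enumeration {n} (good : Fin n → Bool) : Set where
    field
      size      : ℕ
      size≡     : size ≡ count good
      element   : Fin size → Fin n
      injective : Injective _≡_ _≡_ element
      sound     : ∀ j → good (element j) ≡ true
      complete  : ∀ i → good i ≡ true → ∃[ j ] element j ≡ i

  enumerate : ∀ {n} (good : Fin n → Bool) → Enumeration good
  enumerate {zero}  good = record
    { size = 0 ; size≡ = refl ; element = λ () ; injective = λ {} ; sound = λ () ; complete = λ () }
  enumerate {suc n} good with enumerate (good ∘ suc) | good zero in eq
  ... | E | true  = record
    { size      = suc (E.size)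
    ; size≡     = trans (cong suc E.size≡) (cong (λ b → (if b then 1 else 0) + rest) (sym eq))
    ; element   = element
    ; injective = inj
    ; sound     = λ { zero → eq ; (suc j) → E.sound j }
    ; complete  = λ { zero _ → zero , refl
                    ; (suc i) p → let (j , q) = E.complete i p in suc j , cong suc q }
    }
    where
    module E = Enumeration E
    rest = sum (λ i → if good (suc i) then 1 else 0)
    element : Fin (suc E.size) → Fin (suc n)
    element zero    = zero
    element (suc j) = suc (E.element j)
    inj : Injective _≡_ _≡_ element
    inj {zero}  {zero}  _ = refl
    inj {suc i} {suc j} p = cong suc (E.injective (Finₚ.suc-injective p))
  ... | E | false = record
    { size      = E.size
    ; size≡     = trans E.size≡ (cong (λ b → (if b then 1 else 0) + rest) (sym eq))
    ; element   = suc ∘ E.element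
    ; injective = λ p → E.injective (Finₚ.suc-injective p)
    ; sound     = E.sound
    ; complete  = λ { zero p → ⊥-elim (true≢false (trans (sym p) eq))
                    ; (suc i) p → let (j , q) = E.complete i p in j , cong suc q }
    }
    where
    module E = Enumeration E
    rest = sum (λ i → if good (suc i) then 1 else 0)
    true≢false : true ≢ false
    true≢false ()

open TupleCombinatorics using (Increasing; increasing?; increasing-map; increasing-weaken; StrictlyIncreasing;
  strictlyIncreasing⇒injective; upperBound; Enumeration; enumerate; module Ramsey; module Transversals)

-- Points attached to tuples, and their distances

module Tuples (em : ExcludedMiddle (lsuc 0ℓ)) (ℝ : RealNumbers) where
  open Order em ℝ public
  open Euclidean ℝ public
  open import Relation.Binary.Reasoning.Setoid setoid

  sum-single : ∀ {n} (g : Vector R n) s → (∀ t → t ≢ s → g t ≈ 0#) → sum g ≈ g s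
  sum-single g zero    p = trans (+-congˡ (sum-zero (λ t → p (suc t) (λ ())))) (+-identityʳ _)
  sum-single g (suc s) p = trans (+-cong (p zero (λ ()))
    (sum-single (g ∘ suc) s (λ t t≢s → p (suc t) (t≢s ∘ Finₚ.suc-injective)))) (+-identityˡ _)

  sumTo : ℕ → (ℕ → R) → R
  sumTo B g = sum {B} (g ∘ toℕ)

  sumTo-extend : ∀ {m B} (g : ℕ → R) → m ℕ.≤ B → (∀ k → m ℕ.≤ k → g k ≈ 0#) → sumTo m g ≈ sumTo B g
  sumTo-extend {B = B} g ℕ.z≤n p = sym (sum-zero {B} (λ i → p (toℕ i) ℕ.z≤n))
  sumTo-extend g (ℕ.s≤s q)   p = +-congˡ (sumTo-extend (g ∘ ℕ.suc) q (λ k r → p (ℕ.suc k) (ℕ.s≤s r)))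

  square-cong : ∀ {x y} → x ≈ y → x * x ≈ y * y
  square-cong e = *-cong e e

  sqDist : Point → Point → R
  sqDist x y = sum (squaredDifferences x y)

  -- Distances are defined through the bounds stored in the points. Padding with zero terms allows
  -- any common bound, so points with equal coordinates but different stored bounds can be compared.
  sqDist≈sumTo : ∀ x y B → bound x ℕ.≤ B → bound y ℕ.≤ B →
    sqDist x y ≈ sumTo B (λ k → (coord x k - coord y k) * (coord x k - coord y k))
  sqDist≈sumTo x y B p q = sumTo-extend (λ k → (coord x k - coord y k) * (coord x k - coord y k))
    (ℕₚ.⊔-lub p q) vanish
    where
    vanish : ∀ k → bound x ℕ.⊔ bound y ℕ.≤ k → (coord x k - coord y k) * (coord x k - coord y k) ≈ 0#
    vanish k r = trans (square-cong (trans
        (+-cong (support x k (ℕₚ.m⊔n≤o⇒m≤o (bound x) (bound y) r))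
            (-‿cong (support y k (ℕₚ.m⊔n≤o⇒n≤o (bound x) (bound y) r))))
        (-‿inverseʳ 0#))) (zeroˡ 0#)

  sqDist-cong : ∀ {x x′ y y′} → x ≈ₚ x′ → y ≈ₚ y′ → sqDist x y ≈ sqDist x′ y′
  sqDist-cong {x} {x′} {y} {y′} p q = begin
    sqDist x y   ≈⟨ sqDist≈sumTo x y B bx by ⟩
    sumTo B (λ k → (coord x k - coord y k) * (coord x k - coord y k))
      ≈⟨ sum-cong {B} (λ i → square-cong (+-cong (p (toℕ i)) (-‿cong (q (toℕ i))))) ⟩
    sumTo B (λ k → (coord x′ k - coord y′ k) * (coord x′ k - coord y′ k))
      ≈⟨ sym (sqDist≈sumTo x′ y′ B bx′ by′) ⟩
    sqDist x′ y′ ∎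
    where
    B₁ = bound x ℕ.⊔ bound y
    B₂ = bound x′ ℕ.⊔ bound y′
    B = B₁ ℕ.⊔ B₂
    bx = ℕₚ.≤-trans (ℕₚ.m≤m⊔n (bound x) (bound y)) (ℕₚ.m≤m⊔n B₁ B₂)
    by = ℕₚ.≤-trans (ℕₚ.m≤n⊔m (bound x) (bound y)) (ℕₚ.m≤m⊔n B₁ B₂)
    bx′ = ℕₚ.≤-trans (ℕₚ.m≤m⊔n (bound x′) (bound y′)) (ℕₚ.m≤n⊔m B₁ B₂)
    by′ = ℕₚ.≤-trans (ℕₚ.m≤n⊔m (bound x′) (bound y′)) (ℕₚ.m≤n⊔m B₁ B₂)

  sqDist-zero : ∀ {x y} → x ≈ₚ y → sqDist x y ≈ 0#
  sqDist-zero {x} {y} p = sum-zero {f = squaredDifferences x y} (λ i →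
    trans (square-cong (trans (+-congʳ (p (toℕ i))) (-‿inverseʳ _))) (zeroˡ 0#))

  dist-cong : ∀ {x x′ y y′} → sqDist x y ≈ sqDist x′ y′ → dist x y ≈ dist x′ y′
  dist-cong e = sqrt-cong e

  dist-injective : ∀ {x x′ y y′} → dist x y ≈ dist x′ y′ → sqDist x y ≈ sqDist x′ y′
  dist-injective e = sqrt-injective e

  δ : ℕ → ℕ → R → R
  δ j x a = if does (j ℕₚ.≟ x) then a else 0#

  δ-≡ : ∀ {j x} a → j ≡ x → δ j x a ≈ a
  δ-≡ {j} {x} a eq rewrite dec-true (j ℕₚ.≟ x) eq = refl

  δ-≢ : ∀ {j x} a → j ≢ x → δ j x a ≈ 0#
  δ-≢ {j} {x} a ≢ rewrite dec-false (j ℕₚ.≟ x) ≢ = refl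

  coordinate : ∀ {k} → Vec R k → Vec ℕ k → ℕ → R
  coordinate []       []      x = 0#
  coordinate (a ∷ as) (j ∷ J) x = δ j x a + coordinate as J x

  coordinate-sum : ∀ {k} (a : Vec R k) J x → coordinate a J x ≈ sum (λ s → δ (lookup J s) x (lookup a s))
  coordinate-sum []       []      x = refl
  coordinate-sum (a ∷ as) (j ∷ J) x = +-congˡ (coordinate-sum as J x)

  coordinate-∉ : ∀ {k} (a : Vec R k) J x → (∀ s → lookup J s ≢ x) → coordinate a J x ≈ 0#
  coordinate-∉ a J x p = trans (coordinate-sum a J x) (sum-zero (λ s → δ-≢ (lookup a s) (p s)))

  top : ∀ {k} → Vec ℕ k → ℕ
  top []      = 0
  top (j ∷ J) = ℕ.suc j ℕ.⊔ top J

  <top : ∀ {k} (J : Vec ℕ k) s → lookup J s ℕ.< top J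
  <top (j ∷ J) zero    = ℕₚ.m≤m⊔n (ℕ.suc j) (top J)
  <top (j ∷ J) (suc s) = ℕₚ.≤-trans (<top J s) (ℕₚ.m≤n⊔m (ℕ.suc j) (top J))

  point : ∀ {k} → Vec R k → Vec ℕ k → Point
  point a J = record
    { coord   = coordinate a J
    ; bound   = top J
    ; support = λ x p → coordinate-∉ a J x (λ s eq → ℕₚ.<⇒≱ (<top J s) (ℕₚ.≤-trans p (ℕₚ.≤-reflexive (≡.sym eq))))
    }

  -- The inner product of `point a J` with the sequence `g`, taken over the slots instead of the
  -- coordinates.
  pair : ∀ {k} → Vec R k → Vec ℕ k → (ℕ → R) → R
  pair []       []      g = 0#
  pair (a ∷ as) (j ∷ J) g = a * g j + pair as J g

  pair-sum : ∀ {k} (a : Vec R k) J g → pair a J g ≈ sum (λ s → lookup a s * g (lookup J s))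
  pair-sum []       []      g = refl
  pair-sum (a ∷ as) (j ∷ J) g = +-congˡ (pair-sum as J g)

  sumTo-δ : ∀ B j a (g : ℕ → R) → j ℕ.< B → sumTo B (λ x → δ j x a * g x) ≈ a * g j
  sumTo-δ (ℕ.suc B) ℕ.zero    a g _         = trans (+-congˡ (sum-zero {B} (λ i → zeroˡ _))) (+-identityʳ _)
  sumTo-δ (ℕ.suc B) (ℕ.suc j) a g (ℕ.s≤s p) = trans (+-cong (zeroˡ _) (sumTo-δ B j a (g ∘ ℕ.suc) p)) (+-identityˡ _)

  sumTo-coordinate : ∀ {k} B (a : Vec R k) J (g : ℕ → R) → (∀ s → lookup J s ℕ.< B) →
    sumTo B (λ x → coordinate a J x * g x) ≈ pair a J g
  sumTo-coordinate B []       []      g p = sum-zero {B} (λ i → zeroˡ _)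
  sumTo-coordinate B (a ∷ as) (j ∷ J) g p = begin
    sumTo B (λ x → (δ j x a + coordinate as J x) * g x)
      ≈⟨ sum-cong {B} (λ i → distribʳ (g (toℕ i)) (δ j (toℕ i) a) (coordinate as J (toℕ i))) ⟩
    sumTo B (λ x → δ j x a * g x + coordinate as J x * g x)
      ≈⟨ sum-+ {B} (λ i → δ j (toℕ i) a * g (toℕ i)) (λ i → coordinate as J (toℕ i) * g (toℕ i)) ⟩
    sumTo B (λ x → δ j x a * g x) + sumTo B (λ x → coordinate as J x * g x)
      ≈⟨ +-cong (sumTo-δ B j a g (p zero)) (sumTo-coordinate B as J g (p ∘ suc)) ⟩
    a * g j + pair as J g ∎

  norm² : ∀ {k} → Vec R k → Vec ℕ k → R
  norm² a J = pair a J (coordinate a J)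

  -- The law of cosines. In this form no bound on the coordinates enters, and relabelling and
  -- concatenation can be applied to each inner product separately.
  tupleDist : ∀ {k} → Vec R k → (J K : Vec ℕ k) → R
  tupleDist a J K = (norm² a J + norm² a K) - 2# * pair a J (coordinate a K)

  sum-square-difference : ∀ {n} (u v : Vector R n) →
    sum (λ i → (u i - v i) * (u i - v i)) ≈
    (sum (λ i → u i * u i) + sum (λ i → v i * v i)) - 2# * sum (λ i → u i * v i)
  sum-square-difference u v = begin
    sum (λ i → (u i - v i) * (u i - v i))
      ≈⟨ sum-cong (λ i → solve 2 (λ x y → (x :- y) :* (x :- y) := (x :* x :+ y :* y) :+ (:- :2) :* (x :* y)) refl
          (u i) (v i)) ⟩
    sum (λ i → (u i * u i + v i * v i) + (- 2#) * (u i * v i))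
      ≈⟨ sum-+ (λ i → u i * u i + v i * v i) (λ i → (- 2#) * (u i * v i)) ⟩
    sum (λ i → u i * u i + v i * v i) + sum (λ i → (- 2#) * (u i * v i))
      ≈⟨ +-cong (sum-+ (λ i → u i * u i) (λ i → v i * v i)) (sum-* (- 2#) (λ i → u i * v i)) ⟩
    (sum (λ i → u i * u i) + sum (λ i → v i * v i)) + (- 2#) * sum (λ i → u i * v i)
      ≈⟨ solve 3 (λ x y z → (x :+ y) :+ (:- :2) :* z := (x :+ y) :- :2 :* z) refl _ _ _ ⟩
    (sum (λ i → u i * u i) + sum (λ i → v i * v i)) - 2# * sum (λ i → u i * v i) ∎

  sumTo≈tupleDist : ∀ {k} B (a : Vec R k) J K →
    (∀ s → lookup J s ℕ.< B) → (∀ s → lookup K s ℕ.< B) →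
    sumTo B (λ x → (coordinate a J x - coordinate a K x) * (coordinate a J x - coordinate a K x)) ≈ tupleDist a J K
  sumTo≈tupleDist B a J K p q = trans (sum-square-difference {B} (coordinate a J ∘ toℕ) (coordinate a K ∘ toℕ))
    (+-cong (+-cong (sumTo-coordinate B a J (coordinate a J) p) (sumTo-coordinate B a K (coordinate a K) q))
      (-‿cong (*-congˡ (sumTo-coordinate B a J (coordinate a K) p))))

  sqDist-point : ∀ {k} (a : Vec R k) J K → sqDist (point a J) (point a K) ≈ tupleDist a J K
  sqDist-point a J K = trans (sqDist≈sumTo (point a J) (point a K) B p q)
    (sumTo≈tupleDist B a J K (λ s → ℕₚ.<-≤-trans (<top J s) p) (λ s → ℕₚ.<-≤-trans (<top K s) q))
    where
    B = top J ℕ.⊔ top K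
    p = ℕₚ.m≤m⊔n (top J) (top K)
    q = ℕₚ.m≤n⊔m (top J) (top K)

  coordinate-map : ∀ {k} {h : ℕ → ℕ} → (∀ {m n} → h m ≡ h n → m ≡ n) →
    ∀ (a : Vec R k) J x → coordinate a (Vec.map h J) (h x) ≈ coordinate a J x
  coordinate-map inj []       []      x = refl
  coordinate-map {h = h} inj (a ∷ as) (j ∷ J) x = +-cong δ-map (coordinate-map inj as J x)
    where
    δ-map : δ (h j) (h x) a ≈ δ j x a
    δ-map with j ℕₚ.≟ x
    ... | yes p = trans (δ-≡ a (≡.cong h p)) (sym (δ-≡ a p))
    ... | no ¬p = trans (δ-≢ a (¬p ∘ inj)) (sym (δ-≢ a ¬p))

  pair-map : ∀ {k} {h : ℕ → ℕ} (a : Vec R k) J {g f} → (∀ x → g (h x) ≈ f x) → pair a (Vec.map h J) g ≈ pair a J f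
  pair-map []       []      p = refl
  pair-map (a ∷ as) (j ∷ J) p = +-cong (*-congˡ (p j)) (pair-map as J p)

  -- Inner products only see which labels coincide, so an injective relabelling preserves them.
  -- Hence the pattern reappears inside the homogeneous set given by Ramsey's theorem.
  tupleDist-map : ∀ {k} {h : ℕ → ℕ} → (∀ {m n} → h m ≡ h n → m ≡ n) →
    ∀ (a : Vec R k) J K → tupleDist a (Vec.map h J) (Vec.map h K) ≈ tupleDist a J K
  tupleDist-map inj a J K = +-cong
    (+-cong (pair-map a J (coordinate-map inj a J)) (pair-map a K (coordinate-map inj a K)))
    (-‿cong (*-congˡ (pair-map a J (coordinate-map inj a K))))

  subsetSum : ∀ {k} → Vec R k → Vec Bool k → R
  subsetSum []       []       = 0#
  subsetSum (w ∷ ws) (b ∷ bs) = (if b then w else 0#) + subsetSum ws bs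

  subsetSum-tabulate : ∀ {k} (w : Vec R k) (f : Fin k → Bool) →
    subsetSum w (Vec.tabulate f) ≈ sum (λ s → if f s then lookup w s else 0#)
  subsetSum-tabulate []       f = refl
  subsetSum-tabulate (w ∷ ws) f = +-congˡ (subsetSum-tabulate ws (f ∘ suc))

  -- Two points whose labels in a slot differ contribute a² twice, once for each label.
  weight : R → R
  weight a = 2# * (a * a)

  module _ {k} (f : ℕ → Fin k) (a : Vec R k) where

    Transversal : Vec ℕ k → Set
    Transversal J = ∀ s → f (lookup J s) ≡ s

    -- Slot t of a transversal tuple holds a label of colour t, so only the slot matching the colour
    -- of `x` can hold `x`.
    coordinate-transversal : ∀ {K} → Transversal K → ∀ {x s} → f x ≡ s →
      coordinate a K x ≈ δ (lookup K s) x (lookup a s)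
    coordinate-transversal {K} tK {x} {s} eq = trans (coordinate-sum a K x)
      (sum-single (λ t → δ (lookup K t) x (lookup a t)) s
        (λ t t≢s → δ-≢ (lookup a t) (λ K≡x → t≢s (≡.trans (≡.sym (tK t)) (≡.trans (≡.cong f K≡x) eq)))))

    norm²-transversal : ∀ {J} → Transversal J → norm² a J ≈ sum (λ s → lookup a s * lookup a s)
    norm²-transversal {J} tJ = trans (pair-sum a J (coordinate a J)) (sum-cong (λ s →
      *-congˡ (trans (coordinate-transversal tJ (tJ s)) (δ-≡ {lookup J s} (lookup a s) ≡.refl))))

    -- Differently coloured positions are orthogonal, so only a Hamming distance weighted by a survives.
    tupleDist-transversal : ∀ {J K} → Transversal J → Transversal K →
      ∃[ b ] tupleDist a J K ≈ subsetSum (Vec.map weight a) b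
    tupleDist-transversal {J} {K} tJ tK = Vec.tabulate differ , (begin
      (norm² a J + norm² a K) - 2# * pair a J (coordinate a K)
        ≈⟨ +-cong (+-cong (norm²-transversal tJ) (norm²-transversal tK))
            (-‿cong (*-congˡ (pair-sum a J (coordinate a K)))) ⟩
      (sum (λ s → lookup a s * lookup a s) + sum (λ s → lookup a s * lookup a s))
        - 2# * sum (λ s → lookup a s * coordinate a K (lookup J s))
        ≈⟨ solve 2 (λ x y → (x :+ x) :- :2 :* y := :2 :* x :+ (:- :2) :* y) refl _ _ ⟩
      2# * sum (λ s → lookup a s * lookup a s) + (- 2#) * sum (λ s → lookup a s * coordinate a K (lookup J s))
        ≈⟨ sym (+-cong (sum-* 2# squares) (sum-* (- 2#) products)) ⟩
      sum (λ s → 2# * (lookup a s * lookup a s)) + sum (λ s → (- 2#) * (lookup a s * coordinate a K (lookup J s)))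
        ≈⟨ sym (sum-+ (λ s → 2# * squares s) (λ s → (- 2#) * products s)) ⟩
      sum (λ s → 2# * (lookup a s * lookup a s) + (- 2#) * (lookup a s * coordinate a K (lookup J s)))
        ≈⟨ sum-cong term ⟩
      sum (λ s → if differ s then lookup (Vec.map weight a) s else 0#)
        ≈⟨ sym (subsetSum-tabulate (Vec.map weight a) differ) ⟩
      subsetSum (Vec.map weight a) (Vec.tabulate differ) ∎)
      where
      squares products : Vector R k
      squares s  = lookup a s * lookup a s
      products s = lookup a s * coordinate a K (lookup J s)
      differ : Fin k → Bool
      differ s = not (does (lookup K s ℕₚ.≟ lookup J s))
      δ-term : ∀ b {x} → 2# * (x * x) + (- 2#) * (x * (if b then x else 0#)) ≈ (if not b then weight x else 0#)
      δ-term true  {x} = solve 1 (λ x → :2 :* (x :* x) :+ (:- :2) :* (x :* x) := :0) refl x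
      δ-term false {x} = trans (+-congˡ (trans (*-congˡ (zeroʳ x)) (zeroʳ _))) (+-identityʳ _)
      term : ∀ s → 2# * (lookup a s * lookup a s) + (- 2#) * (lookup a s * coordinate a K (lookup J s))
        ≈ (if differ s then lookup (Vec.map weight a) s else 0#)
      term s = trans (+-congˡ (*-congˡ (*-congˡ (coordinate-transversal tK (tJ s)))))
        (trans (δ-term (does (lookup K s ℕₚ.≟ lookup J s)))
            (reflexive (≡.cong (λ w → if differ s then w else 0#) (≡.sym (Vecₚ.lookup-map s weight a)))))

-- From a realised pattern to the P-Ramsey property

module Patterns (em : ExcludedMiddle (lsuc 0ℓ)) (ℝ : RealNumbers) where
  open Tuples em ℝ public

  -- To be read as the n points Σ_s a_s e_(J l s).
  record Scheme (n k : ℕ) : Set where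
    field
      a          : Vec R k
      J          : Fin n → Vec ℕ k
      size       : ℕ
      increasing : ∀ l → Increasing 0 (J l)
      bounded    : ∀ l → All (ℕ._< size) (J l)

    matrix : Fin n → Fin n → R
    matrix l m = tupleDist a (J l) (J m)

    weights : Vec R k
    weights = Vec.map weight a

  module _ {n k-1} (S : Configuration) (e : HasCardinality S (ℕ.suc (ℕ.suc n)))
    (P : Scheme (ℕ.suc (ℕ.suc n)) (ℕ.suc k-1)) where
    private
      k = ℕ.suc k-1
      module P = Scheme P
      module e = Bijection e

      x : Fin (ℕ.suc (ℕ.suc n)) → Point
      x l = proj₁ (e.to l)

      D : Fin (ℕ.suc (ℕ.suc n)) → Fin (ℕ.suc (ℕ.suc n)) → R
      D l m = sqDist (x l) (x m)

      index : Σ Point (points S) → Fin (ℕ.suc (ℕ.suc n))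
      index y = proj₁ (e.surjective y)

      index-spec : ∀ y → x (index y) ≈ₚ proj₁ y
      index-spec y = proj₂ (e.surjective y) ≡.refl

    Y : Configuration
    Y = record
      { points   = λ y → ∃[ J ] Increasing 0 J × y ≈ₚ point P.a J
      ; respects = λ y≈z (J , inc , eq) → J , inc , λ i → trans (sym (y≈z i)) (eq i)
      }

    module _ (realises : ∀ l m → l ≢ m → P.matrix l m ≈ D l m)
             (distinct : ∀ l m → l ≢ m → ¬ D l m ≈ 0#) where

      Y-arrows : ∀ r → 1 ℕ.≤ r → Y ⟶[ r ] S
      Y-arrows r 1≤r χ = B , (λ {y} → B⊑Y {y}) , (c , monochromatic) , copy
        where
        χ′ : Vec ℕ k → Fin r
        χ′ J with increasing? 0 J
        ... | yes inc = Func.to χ (point P.a J , J , inc , λ _ → refl)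
        -- An arbitrary default, available because r ≥ 1: Ramsey's theorem takes a colouring of all
        -- tuples but is consulted on increasing ones only.
        ... | no _    = Fin.fromℕ< 1≤r

        χ′-spec : ∀ J y (y∈Y : points Y y) → Increasing 0 J → y ≈ₚ point P.a J → Func.to χ (y , y∈Y) ≡ χ′ J
        χ′-spec J y y∈Y inc eq with increasing? 0 J
        -- The colouring respects equality of points, so it does not matter which membership proof
        -- `χ′` supplied.
        ... | yes inc′ = Func.cong χ eq
        ... | no ¬inc  = ⊥-elim (¬inc inc)

        homogeneous = Ramsey.ramsey dec k χ′
        h = proj₁ homogeneous
        h-increasing : StrictlyIncreasing h
        h-increasing = proj₁ (proj₂ homogeneous)
        c = proj₁ (proj₂ (proj₂ homogeneous))

        p : Fin (ℕ.suc (ℕ.suc n)) → Point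
        p l = point P.a (Vec.map h (P.J l))

        hJ-increasing : ∀ l → Increasing 0 (Vec.map h (P.J l))
        hJ-increasing l = increasing-weaken ℕ.z≤n (increasing-map h-increasing (P.increasing l))

        B : Configuration
        B = record
          { points   = λ y → ∃[ l ] y ≈ₚ p l
          ; respects = λ y≈z (l , eq) → l , λ i → trans (sym (y≈z i)) (eq i)
          }

        B⊑Y : B ⊑ Y
        B⊑Y (l , eq) = Vec.map h (P.J l) , hJ-increasing l , eq

        monochromatic : ∀ y (y∈B : points B y) → Func.to χ (y , B⊑Y {y} y∈B) ≡ c
        monochromatic y (l , eq) = ≡.trans
          (χ′-spec (Vec.map h (P.J l)) y (B⊑Y {y} (l , eq)) (hJ-increasing l) eq)
          (proj₂ (proj₂ (proj₂ homogeneous)) (P.J l) (P.increasing l))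

        p-dist : ∀ l m → l ≢ m → sqDist (p l) (p m) ≈ D l m
        p-dist l m l≢m = trans (sqDist-point P.a (Vec.map h (P.J l)) (Vec.map h (P.J m)))
          (trans (tupleDist-map (strictlyIncreasing⇒injective h-increasing) P.a (P.J l) (P.J m)) (realises l m l≢m))

        p-isometric : ∀ l m → sqDist (p l) (p m) ≈ D l m
        p-isometric l m with l Finₚ.≟ m
        -- The realised matrix is known off the diagonal only; on the diagonal both sides vanish.
        ... | yes ≡.refl = trans (sqDist-zero {p l} {p l} (λ _ → refl)) (sym (sqDist-zero {x l} {x l} (λ _ → refl)))
        ... | no l≢m     = p-dist l m l≢m

        p-injective : ∀ l m → p l ≈ₚ p m → l ≡ m
        p-injective l m eq with l Finₚ.≟ m
        ... | yes l≡m = l≡m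
        ... | no l≢m  = ⊥-elim (distinct l m l≢m (trans (sym (p-dist l m l≢m)) (sqDist-zero {p l} {p m} eq)))

        index-cong : ∀ {y z : Σ Point (points S)} → proj₁ y ≈ₚ proj₁ z → index y ≡ index z
        index-cong {y} {z} eq = e.injective (λ i →
          trans (index-spec y i) (trans (eq i) (sym (index-spec z i))))

        copy : Copy S B
        copy = record
          { to        = λ y → p (index y) , index y , λ _ → refl
          ; cong      = λ {y} {z} eq i → reflexive (≡.cong (λ l → coord (p l) i) (index-cong {y} {z} eq))
          ; bijective = (λ {y} {z} eq i → trans (sym (index-spec y i))
                (trans (reflexive (≡.cong (λ l → coord (x l) i) (p-injective (index y) (index z) eq)))
                    (index-spec z i)))
              , λ (y , l , y≈p) → e.to l , λ {z} z≈x i → trans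
                  (reflexive (≡.cong (λ l → coord (p l) i)
                    (e.injective (λ i → trans (index-spec z i) (z≈x i)))))
                  (sym (y≈p i))
          } , λ y z → dist-cong {p (index y)} {proj₁ y} {p (index z)} {proj₁ z}
                (trans (p-isometric (index y) (index z))
                    (sqDist-cong {x (index y)} {proj₁ y} {x (index z)} {proj₁ z} (index-spec y) (index-spec z)))

    module _ (avoids : ∀ b → ¬ subsetSum P.weights b ≈ D zero (suc zero)) where

      open Transversals k-1 using (transversal)

      density : ∃[ μ ] 0# < μ × fromℕ (k ℕ.^ k) * μ ≈ 1#
      density = pos-inverse (fromℕ-pos {k ℕ.^ k} (ℕₚ.m^n>0 k k))

      -- `Z` keeps the points of `Y′` whose tuples are transversal for the colouring `f`. A copy of
      -- `S` in `Z` would have two points at squared distance `D zero (suc zero)`, whereas all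
      -- squared distances in `Z` are subset sums of the weights.
      Y-sparse : LargeFreeSubsets S Y (proj₁ density)
      Y-sparse Y′ Y′⊑Y N c = Z , Z⊑Y′ , (E.size , Z-cardinality , large) , free
        where
        module c = Bijection c
        μ = proj₁ density
        y : Fin N → Point
        y i = proj₁ (c.to i)
        J : Fin N → Vec ℕ k
        J i = proj₁ (Y′⊑Y (proj₂ (c.to i)))
        T = transversal J (λ i → proj₁ (proj₂ (Y′⊑Y (proj₂ (c.to i)))))
        f = proj₁ T
        good = proj₁ (proj₂ T)
        module E = Enumeration (enumerate good)

        Z : Configuration
        Z = record
          { points   = λ z → ∃[ i ] good i ≡ true × z ≈ₚ y i
          ; respects = λ z≈w (i , g , eq) → i , g , λ s → trans (sym (z≈w s)) (eq s)
          }

        Z⊑Y′ : Z ⊑ Y′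
        Z⊑Y′ (i , _ , eq) = respects Y′ (λ s → sym (eq s)) (proj₂ (c.to i))

        Z-cardinality : HasCardinality Z E.size
        Z-cardinality = record
          { to        = λ j → y (E.element j) , E.element j , E.sound j , λ _ → refl
          ; cong      = λ { ≡.refl _ → refl }
          ; bijective = (λ eq → E.injective (c.injective eq))
              , λ (z , i , g , eq) → let (j , q) = E.complete i g in
                  j , λ { ≡.refl s → trans (reflexive (≡.cong (λ i → coord (y i) s) q)) (sym (eq s)) }
          }

        large : μ * fromℕ N ≤ fromℕ E.size
        large = *-cancelˡ-≤ (fromℕ-pos {k ℕ.^ k} (ℕₚ.m^n>0 k k)) (≤-respˡ
          (trans (sym (*-identityˡ _)) (trans (*-congʳ (sym (proj₂ (proj₂ density)))) (*-assoc _ _ _)))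
          (≤-respʳ (·1-homo-* (k ℕ.^ k) E.size)
            (fromℕ-mono-≤ (≡.subst (λ s → N ℕ.≤ k ℕ.^ k ℕ.* s) (≡.sym E.size≡) (proj₂ (proj₂ (proj₂ T)))))))

        free : S -Free Z
        free W W⊑Z (g , isometric) = avoids b (sym (trans D≈ eq))
          where
          open Bijection g using (to)
          z : Fin (ℕ.suc (ℕ.suc n)) → Point
          z l = proj₁ (to (e.to l))
          z∈Z : ∀ l → points Z (z l)
          z∈Z l = W⊑Z (proj₂ (to (e.to l)))
          i : Fin (ℕ.suc (ℕ.suc n)) → Fin N
          i l = proj₁ (z∈Z l)
          z≈point : ∀ l → z l ≈ₚ point P.a (J (i l))
          z≈point l s = trans (proj₂ (proj₂ (z∈Z l)) s) (proj₂ (proj₂ (Y′⊑Y (proj₂ (c.to (i l))))) s)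
          hamming = tupleDist-transversal f P.a {J (i zero)} {J (i (suc zero))}
            (proj₁ (proj₂ (proj₂ T)) (i zero) (proj₁ (proj₂ (z∈Z zero))))
            (proj₁ (proj₂ (proj₂ T)) (i (suc zero)) (proj₁ (proj₂ (z∈Z (suc zero)))))
          b = proj₁ hamming
          eq = proj₂ hamming
          D≈ : D zero (suc zero) ≈ tupleDist P.a (J (i zero)) (J (i (suc zero)))
          D≈ = trans (sym (dist-injective {z zero} {x zero} {z (suc zero)} {x (suc zero)}
              (isometric (e.to zero) (e.to (suc zero)))))
            (trans (sqDist-cong {z zero} {point P.a (J (i zero))} {z (suc zero)} {point P.a (J (i (suc zero)))}
                (z≈point zero) (z≈point (suc zero)))
              (sqDist-point P.a (J (i zero)) (J (i (suc zero)))))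

    pRamsey : (∀ l m → l ≢ m → P.matrix l m ≈ D l m) → (∀ l m → l ≢ m → ¬ D l m ≈ 0#) →
      (∀ b → ¬ subsetSum P.weights b ≈ D zero (suc zero)) → PRamsey S
    pRamsey realises distinct avoids = (_ , e) , Y , proj₁ density′ , proj₁ (proj₂ density′) ,
      Y-arrows realises distinct , Y-sparse avoids
      where density′ = density avoids

-- Sums and multiples of realisable matrices

increasing-++ : ∀ {b B j k} {J : Vec ℕ j} {K : Vec ℕ k} → b ℕ.≤ B → Increasing b J → All (ℕ._< B) J →
  Increasing B K → Increasing b (J ++ K)
increasing-++ {J = []}    b≤B _         _        inc = increasing-weaken b≤B inc
increasing-++ {J = x ∷ J} b≤B (b≤x , p) (q ∷ qs) inc = b≤x , increasing-++ q p qs inc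

module Operations (em : ExcludedMiddle (lsuc 0ℓ)) (ℝ : RealNumbers) where
  open Patterns em ℝ public
  open import Relation.Binary.Reasoning.Setoid setoid

  Matrix : ℕ → Set
  Matrix n = Fin n → Fin n → R

  infix 4 _≋_
  _≋_ : ∀ {n} → Matrix n → Matrix n → Set
  D ≋ E = ∀ l m → l ≢ m → D l m ≈ E l m

  -- Only off-diagonal entries matter: the diagonal of a distance matrix vanishes anyway.
  record Realises {n k} (w : Vec R k) (D : Matrix n) : Set where
    field
      scheme  : Scheme n k
      weights : Pointwise _≈_ (Scheme.weights scheme) w
      matrix  : Scheme.matrix scheme ≋ D

  realises-cong : ∀ {n k} {w : Vec R k} {D E : Matrix n} → D ≋ E → Realises w D → Realises w E
  realises-cong e r = record
    { scheme = Realises.scheme r ; weights = Realises.weights r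
    ; matrix = λ l m l≢m → trans (Realises.matrix r l m l≢m) (e l m l≢m) }

  subsetSum-cong : ∀ {k} {w w′ : Vec R k} → Pointwise _≈_ w w′ → ∀ b → subsetSum w b ≈ subsetSum w′ b
  subsetSum-cong []       []          = refl
  subsetSum-cong (p ∷ ps) (true ∷ b)  = +-cong p (subsetSum-cong ps b)
  subsetSum-cong (p ∷ ps) (false ∷ b) = +-congˡ (subsetSum-cong ps b)

  subsetSum-++ : ∀ {j k} (w : Vec R j) (w′ : Vec R k) b → ∃[ c ] ∃[ c′ ] subsetSum (w ++ w′) b ≈ subsetSum w c +
      subsetSum w′ c′
  subsetSum-++ []      w′ b       = [] , b , sym (+-identityˡ _)
  subsetSum-++ (w ∷ ws) w′ (x ∷ b) =
    let (c , c′ , eq) = subsetSum-++ ws w′ b in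
    x ∷ c , c′ , trans (+-congˡ eq) (sym (+-assoc _ _ _))

  subsetSum-scale : ∀ {k} c (w : Vec R k) b → subsetSum (Vec.map (c *_) w) b ≈ c * subsetSum w b
  subsetSum-scale c []       []          = sym (zeroʳ c)
  subsetSum-scale c (w ∷ ws) (true ∷ b)  = trans (+-congˡ (subsetSum-scale c ws b)) (sym (distribˡ c w _))
  subsetSum-scale c (w ∷ ws) (false ∷ b) = trans (+-identityˡ _)
      (trans (subsetSum-scale c ws b) (*-congˡ (sym (+-identityˡ _))))

  coordinate-++ : ∀ {j k} (a : Vec R j) (a′ : Vec R k) J K x →
    coordinate (a ++ a′) (J ++ K) x ≈ coordinate a J x + coordinate a′ K x
  coordinate-++ []       a′ []      K x = sym (+-identityˡ _)
  coordinate-++ (a ∷ as) a′ (j ∷ J) K x = trans (+-congˡ (coordinate-++ as a′ J K x)) (sym (+-assoc _ _ _))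

  pair-++ : ∀ {j k} (a : Vec R j) (a′ : Vec R k) J K g → pair (a ++ a′) (J ++ K) g ≈ pair a J g + pair a′ K g
  pair-++ []       a′ []      K g = sym (+-identityˡ _)
  pair-++ (a ∷ as) a′ (j ∷ J) K g = trans (+-congˡ (pair-++ as a′ J K g)) (sym (+-assoc _ _ _))

  pair-cong : ∀ {k} (a : Vec R k) {J} {g f : ℕ → R} → All (λ x → g x ≈ f x) J → pair a J g ≈ pair a J f
  pair-cong []       []       = refl
  pair-cong (a ∷ as) (p ∷ ps) = +-cong (*-congˡ p) (pair-cong as ps)

  -- Labels of the first block lie below `B`, those of the second from `B` on, so mixed products
  -- vanish.
  pair-append : ∀ {j k B} (a : Vec R j) (a′ : Vec R k) {J J′ K K′} →
    All (ℕ._< B) J → All (ℕ._< B) J′ →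
    pair (a ++ a′) (J ++ Vec.map (B ℕ.+_) K) (coordinate (a ++ a′) (J′ ++ Vec.map (B ℕ.+_) K′)) ≈
    pair a J (coordinate a J′) + pair a′ K (coordinate a′ K′)
  pair-append {B = B} a a′ {J} {J′} {K} {K′} J<B J′<B = trans
    (pair-++ a a′ J (Vec.map (B ℕ.+_) K) _)
    (+-cong
      (pair-cong a (All.map low J<B))
      (pair-map a′ K λ x → trans (coordinate-++ a a′ J′ (Vec.map (B ℕ.+_) K′) (B ℕ.+ x)) (trans
        (+-cong (coordinate-∉ a J′ (B ℕ.+ x) (λ s eq → ℕₚ.<⇒≱ (Allₚ.lookup⁺ J′<B s)
            (ℕₚ.≤-trans (ℕₚ.m≤m+n B x) (ℕₚ.≤-reflexive (≡.sym eq)))))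
          (coordinate-map (ℕₚ.+-cancelˡ-≡ B _ _) a′ K′ x))
        (+-identityˡ _))))
    where
    low : ∀ {x} → x ℕ.< B → coordinate (a ++ a′) (J′ ++ Vec.map (B ℕ.+_) K′) x ≈ coordinate a J′ x
    low {x} x<B = trans (coordinate-++ a a′ J′ (Vec.map (B ℕ.+_) K′) x) (trans
      (+-congˡ (coordinate-∉ a′ (Vec.map (B ℕ.+_) K′) x (λ s eq → ℕₚ.<⇒≱ x<B
        (ℕₚ.≤-trans (ℕₚ.m≤m+n B (lookup K′ s))
            (ℕₚ.≤-reflexive (≡.trans (≡.sym (Vecₚ.lookup-map s (B ℕ.+_) K′)) eq))))))
      (+-identityʳ _))

  -- An orthogonal direct sum: the labels of the second scheme are moved past `S.size`, so squared
  -- distances add.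
  append : ∀ {n j k} {w : Vec R j} {w′ : Vec R k} {D E : Matrix n} →
    Realises w D → Realises w′ E → Realises (w ++ w′) (λ l m → D l m + E l m)
  append {w = w} {w′} {D} {E} r s = record
    { scheme = record
      { a          = S.a ++ T.a
      ; J          = λ l → S.J l ++ Vec.map (S.size ℕ.+_) (T.J l)
      ; size       = S.size ℕ.+ T.size
      ; increasing = λ l → increasing-++ ℕ.z≤n (S.increasing l) (S.bounded l)
          (increasing-weaken (ℕₚ.m≤m+n S.size 0) (increasing-map (ℕₚ.+-monoʳ-< S.size) (T.increasing l)))
      ; bounded    = λ l → Allₚ.++⁺ (All.map (λ p → ℕₚ.<-≤-trans p (ℕₚ.m≤m+n S.size T.size)) (S.bounded l))
          (Allₚ.map⁺ (All.map (ℕₚ.+-monoʳ-< S.size) (T.bounded l)))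
      }
    ; weights = ≡.subst (λ v → Pointwise _≈_ v (w ++ w′)) (≡.sym (Vecₚ.map-++ weight S.a T.a))
        (Pointwise.++⁺ (Realises.weights r) (Realises.weights s))
    ; matrix = λ l m l≢m → begin
        tupleDist (S.a ++ T.a) (S.J l ++ Vec.map (S.size ℕ.+_) (T.J l)) (S.J m ++ Vec.map (S.size ℕ.+_) (T.J m))
          ≈⟨ +-cong (+-cong (split l l) (split m m)) (-‿cong (*-congˡ (split l m))) ⟩
        ((pS l l + pT l l) + (pS m m + pT m m)) - 2# * (pS l m + pT l m)
          ≈⟨ solve 6 (λ x y z u v w → ((x :+ u) :+ (y :+ v)) :- :2 :* (z :+ w)
                := ((x :+ y) :- :2 :* z) :+ ((u :+ v) :- :2 :* w)) refl (pS l l) (pS m m) (pS l m) (pT l l)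
                    (pT m m) (pT l m) ⟩
        S.matrix l m + T.matrix l m
          ≈⟨ +-cong (Realises.matrix r l m l≢m) (Realises.matrix s l m l≢m) ⟩
        D l m + E l m ∎
    }
    where
    module S = Scheme (Realises.scheme r)
    module T = Scheme (Realises.scheme s)
    pS pT : Fin _ → Fin _ → R
    pS l m = pair S.a (S.J l) (coordinate S.a (S.J m))
    pT l m = pair T.a (T.J l) (coordinate T.a (T.J m))
    split : ∀ l m → pair (S.a ++ T.a) (S.J l ++ Vec.map (S.size ℕ.+_) (T.J l))
      (coordinate (S.a ++ T.a) (S.J m ++ Vec.map (S.size ℕ.+_) (T.J m))) ≈ pS l m + pT l m
    split l m = pair-append S.a T.a {K = T.J l} {K′ = T.J m} (S.bounded l) (S.bounded m)

  coordinate-scale : ∀ {k} c (a : Vec R k) J x → coordinate (Vec.map (c *_) a) J x ≈ c * coordinate a J x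
  coordinate-scale c []       []      x = sym (zeroʳ c)
  coordinate-scale c (a ∷ as) (j ∷ J) x = trans (+-cong δ-scale (coordinate-scale c as J x)) (sym (distribˡ c _ _))
    where
    δ-scale : δ j x (c * a) ≈ c * δ j x a
    δ-scale with j ℕₚ.≟ x
    ... | yes p = trans (δ-≡ (c * a) p) (*-congˡ (sym (δ-≡ a p)))
    ... | no ¬p = trans (δ-≢ (c * a) ¬p) (trans (sym (zeroʳ c)) (*-congˡ (sym (δ-≢ a ¬p))))

  pair-scale : ∀ {k} c (a : Vec R k) J {g f : ℕ → R} → (∀ x → g x ≈ c * f x) →
    pair (Vec.map (c *_) a) J g ≈ (c * c) * pair a J f
  pair-scale c []       []      p = sym (zeroʳ _)
  pair-scale c (a ∷ as) (j ∷ J) {g} {f} p = trans (+-cong (*-congˡ (p j)) (pair-scale c as J p))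
    (solve 4 (λ c a x y → c :* a :* (c :* x) :+ (c :* c) :* y := (c :* c) :* (a :* x :+ y)) refl c a (f j)
        (pair as J f))

  -- Squared distances and weights are both quadratic in the vector `a`, hence the factor `√c` on
  -- it.
  scale : ∀ {n k} {w : Vec R k} {D : Matrix n} c → 0# ≤ c → Realises w D → Realises (Vec.map (c *_) w)
      (λ l m → c * D l m)
  scale {w = w} {D} c 0≤c r = record
    { scheme = record
      { a = Vec.map (√c *_) S.a ; J = S.J ; size = S.size ; increasing = S.increasing ; bounded = S.bounded }
    ; weights = scaled S.a w (Realises.weights r)
    ; matrix = λ l m l≢m → begin
        tupleDist (Vec.map (√c *_) S.a) (S.J l) (S.J m)
          ≈⟨ +-cong (+-cong (pairs l l) (pairs m m)) (-‿cong (*-congˡ (pairs l m))) ⟩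
        (√c * √c * p l l + √c * √c * p m m) - 2# * (√c * √c * p l m)
          ≈⟨ solve 4 (λ c x y z → (c :* x :+ c :* y) :- :2 :* (c :* z) := c :* ((x :+ y) :- :2 :* z)) refl
              (√c * √c) (p l l) (p m m) (p l m) ⟩
        √c * √c * S.matrix l m
          ≈⟨ *-cong √c²≈c (Realises.matrix r l m l≢m) ⟩
        c * D l m ∎
    }
    where
    module S = Scheme (Realises.scheme r)
    √c = sqrt c 0≤c
    √c²≈c : √c * √c ≈ c
    √c²≈c = sqrt-square c 0≤c
    p : Fin _ → Fin _ → R
    p l m = pair S.a (S.J l) (coordinate S.a (S.J m))
    pairs : ∀ l m → pair (Vec.map (√c *_) S.a) (S.J l) (coordinate (Vec.map (√c *_) S.a) (S.J m)) ≈ √c * √c * p l m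
    pairs l m = pair-scale √c S.a (S.J l) (coordinate-scale √c S.a (S.J m))
    rescale : ∀ s a → 2# * ((s * a) * (s * a)) ≈ (s * s) * (2# * (a * a))
    rescale = solve 2 (λ s a → :2 :* ((s :* a) :* (s :* a)) := (s :* s) :* (:2 :* (a :* a))) refl
    scaled : ∀ {k} (a w : Vec R k) → Pointwise _≈_ (Vec.map weight a) w →
      Pointwise _≈_ (Vec.map weight (Vec.map (√c *_) a)) (Vec.map (c *_) w)
    scaled []       []       []       = []
    scaled (a ∷ as) (w ∷ ws) (p ∷ ps) = trans (rescale √c a) (*-cong √c²≈c p) ∷ scaled as ws ps

  realised : ∀ {n k} (S : Scheme n k) → Realises (Scheme.weights S) (Scheme.matrix S)
  realised S = record { scheme = S ; weights = Pointwise.refl refl ; matrix = λ _ _ _ → refl }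

  empty : ∀ {n} → Realises {n} [] (λ _ _ → 0#)
  empty = record
    { scheme = record { a = [] ; J = λ _ → [] ; size = 0 ; increasing = λ _ → tt ; bounded = λ _ → [] }
    ; weights = []
    ; matrix = λ _ _ _ → solve 0 ((:0 :+ :0) :- :2 :* :0 := :0) refl
    }

  -- As a sum of squares the matrix is visibly symmetric and non-negative, which the law of cosines
  -- hides.
  tupleDist≈sumTo : ∀ {n k} (S : Scheme n k) l m → Scheme.matrix S l m ≈
    sumTo (Scheme.size S) (λ x → (coordinate (Scheme.a S) (Scheme.J S l) x - coordinate (Scheme.a S) (Scheme.J S m) x)
      * (coordinate (Scheme.a S) (Scheme.J S l) x - coordinate (Scheme.a S) (Scheme.J S m) x))
  tupleDist≈sumTo S l m = sym (sumTo≈tupleDist S.size S.a (S.J l) (S.J m) (Allₚ.lookup⁺ (S.bounded l))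
      (Allₚ.lookup⁺ (S.bounded m)))
    where module S = Scheme S

  matrix-symmetric : ∀ {n k} (S : Scheme n k) l m → Scheme.matrix S l m ≈ Scheme.matrix S m l
  matrix-symmetric S l m = trans (tupleDist≈sumTo S l m) (trans
    (sum-cong {Scheme.size S} (λ i → solve 2 (λ x y → (x :- y) :* (x :- y) := (y :- x) :* (y :- x)) refl _ _))
    (sym (tupleDist≈sumTo S m l)))

  matrix-nonNeg : ∀ {n k} (S : Scheme n k) l m → 0# ≤ Scheme.matrix S l m
  matrix-nonNeg S l m = ≤-respʳ (sym (tupleDist≈sumTo S l m)) (sum-nonNeg {Scheme.size S} _ (λ i → square-nonNeg _))

-- Squared differences of shifted tent functions

module Tents where
  open import Data.Nat.Base
  open import Data.Nat.Properties
  open import Data.Fin.Base using (toℕ; zero; suc)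
  import Data.Fin.Properties as Finₚ
  open import Data.Sum.Base using (inj₁; inj₂)
  open import Data.Product.Base using (_×_; _,_)
  open import Function.Base using (_∘_)
  open import Algebra.Properties.Semiring.Sum +-*-semiring using (sum; sum-cong-≗)
  open import Relation.Binary.PropositionalEquality using (_≡_; refl; sym; trans; cong; cong₂; subst; module ≡-Reasoning)
  open import Data.Nat.Solver using (module +-*-Solver)
  open +-*-Solver using (solve; _:+_; _:*_; _:=_)
  open TupleCombinatorics using (sum-mono-≤; sum-const)

  sumBelow : ℕ → (ℕ → ℕ) → ℕ
  sumBelow B g = sum {B} (g ∘ toℕ)

  sumBelow-+ : ∀ m n g → sumBelow (m + n) g ≡ sumBelow m g + sumBelow n (g ∘ (m +_))
  sumBelow-+ zero    n g = refl
  sumBelow-+ (suc m) n g = trans (cong (g 0 +_) (sumBelow-+ m n (g ∘ suc))) (sym (+-assoc (g 0) _ _))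

  sumBelow-const : ∀ n c g → (∀ i → i < n → g i ≡ c) → sumBelow n g ≡ n * c
  sumBelow-const n c g p = trans (sum-cong-≗ {n} (λ i → p (toℕ i) (Finₚ.toℕ<n i))) (sum-const n c)

  ∣-∣-bound : ∀ {a b u} → a ≤ b + u → b ≤ a + u → ∣ a - b ∣ ≤ u
  ∣-∣-bound {a} {b} p q with ∣m-n∣≡[m∸n]∨[n∸m] a b
  ... | inj₁ eq = subst (_≤ _) (sym eq) (m≤n+o⇒m∸n≤o a b p)
  ... | inj₂ eq = subst (_≤ _) (sym eq) (m≤n+o⇒m∸n≤o b a q)

  -- Slope 1 up to the peak at s = N, then slope -1; truncated subtraction keeps the value at 0 from
  -- 2N on.
  tent : ℕ → ℕ → ℕ
  tent N s = s ⊓ (N + N ∸ s)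

  tent-lipschitz : ∀ N {s t u} → s ≤ t → t ≤ s + u → ∣ tent N t - tent N s ∣ ≤ u
  tent-lipschitz N {s} {t} {u} s≤t t≤s+u = ∣-∣-bound
    (subst (tent N t ≤_) (sym (+-distribʳ-⊓ u s (N + N ∸ s)))
      (⊓-mono-≤ t≤s+u (≤-trans (∸-monoʳ-≤ (N + N) s≤t) (m≤m+n _ u))))
    (subst (tent N s ≤_) (sym (+-distribʳ-⊓ u t (N + N ∸ t)))
      (⊓-mono-≤ (≤-trans s≤t (m≤m+n t u)) (m≤n+o⇒m∸n≤o (N + N) s (≤-trans (m≤n+m∸n (N + N) t)
        (≤-trans (+-monoˡ-≤ (N + N ∸ t) t≤s+u) (≤-reflexive (trans (+-assoc s u _) (cong (s +_) (+-comm u _)))))))))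

  tent-rising : ∀ {N s} → s ≤ N → tent N s ≡ s
  tent-rising {N} {s} s≤N = m≤n⇒m⊓n≡m (subst (s ≤_) (sym (+-∸-assoc N s≤N)) (≤-trans s≤N (m≤m+n N _)))

  tent-falling : ∀ {N s} → s ≤ N → tent N (N + s) ≡ N ∸ s
  tent-falling {N} {s} s≤N = trans (cong ((N + s) ⊓_) ([m+n]∸[m+o]≡n∸o N N s))
    (m≥n⇒m⊓n≡n (≤-trans (m∸n≤m N s) (m≤m+n N s)))

  tent-outside : ∀ {N s} → N + N ≤ s → tent N s ≡ 0
  tent-outside {N} {s} p = trans (cong (s ⊓_) (m≤n⇒m∸n≡0 p)) (⊓-zeroʳ s)

  -- For x below `p` the truncated `x ∸ p` is 0, where the tent vanishes, so this is an honest
  -- translation by `p`.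
  gap : ℕ → ℕ → ℕ → ℕ → ℕ
  gap N p p′ x = ∣ tent N (x ∸ p) - tent N (x ∸ p′) ∣

  gap-≤ : ∀ N p u x → gap N p (p + u) x ≤ u
  gap-≤ N p u x = tent-lipschitz N (∸-monoʳ-≤ x (m≤m+n p u))
    (subst (λ z → x ∸ p ≤ z + u) (∸-+-assoc x p u) (subst (x ∸ p ≤_) (+-comm u _) (m≤n+m∸n (x ∸ p) u)))

  gap-rising : ∀ {N} p u i → u + i ≤ N → gap N p (p + u) ((p + u) + i) ≡ u
  gap-rising {N} p u i u+i≤N = begin
    ∣ tent N (p + u + i ∸ p) - tent N (p + u + i ∸ (p + u)) ∣
      ≡⟨ cong₂ (λ a b → ∣ tent N a - tent N b ∣) (trans (cong (_∸ p) (+-assoc p u i)) (m+n∸m≡n p (u + i)))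
          (m+n∸m≡n (p + u) i) ⟩
    ∣ tent N (u + i) - tent N i ∣
      ≡⟨ cong₂ ∣_-_∣ (tent-rising u+i≤N) (tent-rising (≤-trans (m≤n+m i u) u+i≤N)) ⟩
    ∣ (u + i) - i ∣     ≡⟨ cong ∣_- i ∣ (+-comm u i) ⟩
    ∣ (i + u) - i ∣     ≡⟨ ∣-∣-comm (i + u) i ⟩
    ∣ i - (i + u) ∣     ≡⟨ ∣m-m+n∣≡n i u ⟩
    u ∎
    where open ≡-Reasoning

  gap-falling : ∀ {N} p u i → u + i ≤ N → gap N p (p + u) ((p + u) + (N + i)) ≡ u
  gap-falling {N} p u i u+i≤N = begin
    ∣ tent N (p + u + (N + i) ∸ p) - tent N (p + u + (N + i) ∸ (p + u)) ∣
      ≡⟨ cong₂ (λ a b → ∣ tent N a - tent N b ∣) shift (m+n∸m≡n (p + u) (N + i)) ⟩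
    ∣ tent N (N + (u + i)) - tent N (N + i) ∣
      ≡⟨ cong₂ ∣_-_∣ (tent-falling u+i≤N) (tent-falling (≤-trans (m≤n+m i u) u+i≤N)) ⟩
    ∣ (N ∸ (u + i)) - (N ∸ i) ∣
      ≡⟨ cong (λ z → ∣ (N ∸ (u + i)) - z ∣) split ⟩
    ∣ (N ∸ (u + i)) - ((N ∸ (u + i)) + u) ∣
      ≡⟨ ∣m-m+n∣≡n (N ∸ (u + i)) u ⟩
    u ∎
    where
    open ≡-Reasoning
    shift : p + u + (N + i) ∸ p ≡ N + (u + i)
    shift = trans (cong (_∸ p) (+-assoc p u (N + i))) (trans (m+n∸m≡n p _)
      (trans (sym (+-assoc u N i)) (trans (cong (_+ i) (+-comm u N)) (+-assoc N u i))))
    split : N ∸ i ≡ (N ∸ (u + i)) + u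
    split = sym (trans (cong (_+ u) (trans (cong (N ∸_) (+-comm u i)) (sym (∸-+-assoc N i u))))
      (m∸n+n≡m (m+n≤o⇒m≤o∸n u u+i≤N)))

  gap-sum-upper : ∀ N p u B → sumBelow B (λ x → gap N p (p + u) x * gap N p (p + u) x) ≤ B * (u * u)
  gap-sum-upper N p u B = ≤-trans
    (sum-mono-≤ {B} (λ i → *-mono-≤ (gap-≤ N p u (toℕ i)) (gap-≤ N p u (toℕ i))))
    (≤-reflexive (sum-const B (u * u)))

  -- With N = u + t there are `t` places where both tents rise and `t` where both fall; at each the
  -- gap is exactly `u`, and all other places are dropped. Writing N as a sum avoids subtraction.
  gap-sum-lower : ∀ t p u r →
    t * (u * u) + t * (u * u) ≤
    sumBelow ((p + u) + (((u + t) + t) + r)) (λ x → gap (u + t) p (p + u) x * gap (u + t) p (p + u) x)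
  gap-sum-lower t p u r = begin
    t * c + t * c
      ≡⟨ cong₂ _+_ (sym (sumBelow-const t c (g ∘ ((p + u) +_)) rising))
                   (sym (sumBelow-const t c (g ∘ ((p + u) +_) ∘ ((u + t) +_)) falling)) ⟩
    sumBelow t h + sumBelow t (h ∘ ((u + t) +_))
      ≤⟨ +-monoˡ-≤ _ (≤-trans (m≤m+n (sumBelow t h) _)
          (≤-reflexive (trans (sym (sumBelow-+ t u h)) (cong (λ z → sumBelow z h) (+-comm t u))))) ⟩
    sumBelow (u + t) h + sumBelow t (h ∘ ((u + t) +_))
      ≡⟨ sym (sumBelow-+ (u + t) t h) ⟩
    sumBelow ((u + t) + t) h
      ≤⟨ ≤-trans (m≤m+n _ _) (≤-reflexive (sym (sumBelow-+ ((u + t) + t) r h))) ⟩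
    sumBelow (((u + t) + t) + r) h
      ≤⟨ ≤-trans (m≤n+m _ _) (≤-reflexive (sym (sumBelow-+ (p + u) (((u + t) + t) + r) g))) ⟩
    sumBelow ((p + u) + (((u + t) + t) + r)) g ∎
    where
    open ≤-Reasoning
    c = u * u
    g h : ℕ → ℕ
    g x = gap (u + t) p (p + u) x * gap (u + t) p (p + u) x
    h = g ∘ ((p + u) +_)
    rising : ∀ i → i < t → g ((p + u) + i) ≡ c
    rising i i<t = cong (λ z → z * z) (gap-rising p u i (+-monoʳ-≤ u (<⇒≤ i<t)))
    falling : ∀ i → i < t → g ((p + u) + ((u + t) + i)) ≡ c
    falling i i<t = cong (λ z → z * z) (gap-falling p u i (+-monoʳ-≤ u (<⇒≤ i<t)))

  gapSum : ℕ → ℕ → ℕ → ℕ → ℕ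
  gapSum B N p p′ = sumBelow B (λ x → gap N p p′ x * gap N p p′ x)

  gapSum-comm : ∀ B N p p′ → gapSum B N p p′ ≡ gapSum B N p′ p
  gapSum-comm B N p p′ = sum-cong-≗ {B} (λ i → cong (λ z → z * z)
      (∣-∣-comm (tent N (toℕ i ∸ p)) (tent N (toℕ i ∸ p′))))

  -- The main term stands for 2N places with gap u. The lower bound misses 2u of them, the upper
  -- bound counts V too many, and u ≤ V bounds either error by 2V · V².
  gapSum-ordered : ∀ V t p u → p + u ≤ V → V ≤ u + t →
    let N = u + t ; c = u * u in
    (N + N) * c ≤ gapSum (N + N + V) N p (p + u) + (V + V) * (V * V) ×
    gapSum (N + N + V) N p (p + u) ≤ (N + N) * c + (V + V) * (V * V)
  gapSum-ordered V t p u p+u≤V V≤N = lower , upper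
    where
    open ≤-Reasoning
    N = u + t
    c = u * u
    u≤V = ≤-trans (m≤n+m u p) p+u≤V
    c≤V² = *-mono-≤ u≤V u≤V
    length≡ : (p + u) + ((N + t) + (V ∸ p)) ≡ N + N + V
    length≡ = trans
      (solve 4 (λ p u t r → (p :+ u) :+ (((u :+ t) :+ t) :+ r) := ((u :+ t) :+ (u :+ t)) :+ (r :+ p)) refl p u t
          (V ∸ p))
      (cong (N + N +_) (m∸n+n≡m (≤-trans (m≤m+n p u) p+u≤V)))
    lower : (N + N) * c ≤ gapSum (N + N + V) N p (p + u) + (V + V) * (V * V)
    lower = begin
      (N + N) * c
        ≡⟨ solve 3 (λ u t c → ((u :+ t) :+ (u :+ t)) :* c := (t :* c :+ t :* c) :+ (u :+ u) :* c) refl u t c ⟩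
      (t * c + t * c) + (u + u) * c
        ≤⟨ +-mono-≤ (gap-sum-lower t p u (V ∸ p)) (*-mono-≤ (+-mono-≤ u≤V u≤V) c≤V²) ⟩
      gapSum ((p + u) + ((N + t) + (V ∸ p))) N p (p + u) + (V + V) * (V * V)
        ≡⟨ cong (λ B → gapSum B N p (p + u) + (V + V) * (V * V)) length≡ ⟩
      gapSum (N + N + V) N p (p + u) + (V + V) * (V * V) ∎
    upper : gapSum (N + N + V) N p (p + u) ≤ (N + N) * c + (V + V) * (V * V)
    upper = begin
      gapSum (N + N + V) N p (p + u)       ≤⟨ gap-sum-upper N p u (N + N + V) ⟩
      (N + N + V) * c                      ≡⟨ *-distribʳ-+ c (N + N) V ⟩
      (N + N) * c + V * c                  ≤⟨ +-monoʳ-≤ ((N + N) * c) (*-mono-≤ (m≤m+n V V) c≤V²) ⟩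
      (N + N) * c + (V + V) * (V * V)      ∎

  -- The squared distance of two shifted tents is 2N (p - p′)² up to an error independent of N.
  gapSum-bounds : ∀ V N p p′ → p ≤ V → p′ ≤ V → V ≤ N →
    let c = ∣ p - p′ ∣ * ∣ p - p′ ∣ in
    (N + N) * c ≤ gapSum (N + N + V) N p p′ + (V + V) * (V * V) ×
    gapSum (N + N + V) N p p′ ≤ (N + N) * c + (V + V) * (V * V)
  gapSum-bounds V N p p′ p≤V p′≤V V≤N with ≤-total p p′
  ... | inj₁ p≤p′ with m≤n⇒∃[o]m+o≡n p≤p′
  ...   | u , refl with m≤n⇒∃[o]m+o≡n (≤-trans (≤-trans (m≤n+m u p) p′≤V) V≤N)
  ...     | t , refl rewrite ∣m-m+n∣≡n p u = gapSum-ordered V t p u p′≤V V≤N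
  gapSum-bounds V N p p′ p≤V p′≤V V≤N | inj₂ p′≤p with m≤n⇒∃[o]m+o≡n p′≤p
  ...   | u , refl with m≤n⇒∃[o]m+o≡n (≤-trans (≤-trans (m≤n+m u p′) p≤V) V≤N)
  ...     | t , refl rewrite ∣-∣-comm (p′ + u) p′ | ∣m-m+n∣≡n p′ u | gapSum-comm (u + t + (u + t) + V) (u + t)
      (p′ + u) p′ =
    gapSum-ordered V t p′ u p≤V V≤N

open Tents using (sumBelow; tent; tent-outside; gap; gapSum; gapSum-bounds)

-- Closure of the set of realisable matrices

run : ℕ → ∀ k → Vec ℕ k
run p ℕ.zero    = []
run p (ℕ.suc k) = p ∷ run (ℕ.suc p) k

run-increasing : ∀ p k → Increasing p (run p k)
run-increasing p ℕ.zero    = tt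
run-increasing p (ℕ.suc k) = ℕₚ.≤-refl , run-increasing (ℕ.suc p) k

run-bounded : ∀ {B} p k → p ℕ.+ k ℕ.≤ B → All (ℕ._< B) (run p k)
run-bounded p ℕ.zero    q = []
run-bounded {B} p (ℕ.suc k) q =
  ℕₚ.≤-trans (ℕₚ.≤-trans (ℕ.s≤s (ℕₚ.m≤m+n p k)) (ℕₚ.≤-reflexive (≡.sym (ℕₚ.+-suc p k)))) q ∷
  run-bounded (ℕ.suc p) k (≡.subst (ℕ._≤ B) (ℕₚ.+-suc p k) q)

run-lower : ∀ p k s → p ℕ.≤ lookup (run p k) s
run-lower p (ℕ.suc k) zero    = ℕₚ.≤-refl
run-lower p (ℕ.suc k) (suc s) = ℕₚ.≤-trans (ℕₚ.n≤1+n p) (run-lower (ℕ.suc p) k s)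

module Approximation (em : ExcludedMiddle (lsuc 0ℓ)) (ℝ : RealNumbers) where
  open Operations em ℝ public
  open import Relation.Binary.Reasoning.Setoid setoid

  values : (ℕ → R) → ℕ → ∀ k → Vec R k
  values g s ℕ.zero    = []
  values g s (ℕ.suc k) = g s ∷ values g (ℕ.suc s) k

  -- Stated for an arbitrary first index `s`, since the induction removes values from the front.
  coordinate-run-above : ∀ g s p k j → (∀ t → s ℕ.+ k ℕ.≤ t → g t ≈ 0#) →
    coordinate (values g s k) (run p k) (p ℕ.+ j) ≈ g (s ℕ.+ j)
  coordinate-run-above g s p ℕ.zero j vanish =
    sym (vanish (s ℕ.+ j) (ℕₚ.≤-trans (ℕₚ.≤-reflexive (ℕₚ.+-identityʳ s)) (ℕₚ.m≤m+n s j)))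
  coordinate-run-above g s p (ℕ.suc k) ℕ.zero vanish = trans
    (+-cong (trans (δ-≡ (g s) (≡.sym (ℕₚ.+-identityʳ p))) (reflexive (≡.cong g (≡.sym (ℕₚ.+-identityʳ s)))))
      (coordinate-∉ (values g (ℕ.suc s) k) (run (ℕ.suc p) k) (p ℕ.+ 0)
        (λ i eq → ℕₚ.<-irrefl (≡.sym (≡.trans eq (ℕₚ.+-identityʳ p))) (run-lower (ℕ.suc p) k i))))
    (+-identityʳ _)
  coordinate-run-above g s p (ℕ.suc k) (ℕ.suc j) vanish = trans
    (+-cong (δ-≢ (g s) (ℕₚ.m≢1+m+n p ∘ λ eq → ≡.trans eq (ℕₚ.+-suc p j)))
      (trans (reflexive (≡.cong (coordinate (values g (ℕ.suc s) k) (run (ℕ.suc p) k)) (ℕₚ.+-suc p j)))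
        (coordinate-run-above g (ℕ.suc s) (ℕ.suc p) k j
            (λ t q → vanish t (≡.subst (ℕ._≤ t) (≡.sym (ℕₚ.+-suc s k)) q)))))
    (trans (+-identityˡ _) (reflexive (≡.cong g (≡.sym (ℕₚ.+-suc s j)))))

  -- Consecutive labels from `p` on translate the graph of `g` by `p`. Below `p` the truncated
  -- `x ∸ p` is 0, which is why `g 0` has to vanish.
  coordinate-run : ∀ g p k x → g 0 ≈ 0# → (∀ t → k ℕ.≤ t → g t ≈ 0#) →
    coordinate (values g 0 k) (run p k) x ≈ g (x ℕ.∸ p)
  coordinate-run g p k x g0 vanish with ℕₚ.≤-total p x
  ... | inj₁ p≤x = trans
    (reflexive (≡.cong (coordinate (values g 0 k) (run p k)) (≡.sym (ℕₚ.m+[n∸m]≡n p≤x))))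
    (coordinate-run-above g 0 p k (x ℕ.∸ p) vanish)
  ... | inj₂ x≤p with ℕₚ.m≤n⇒m<n∨m≡n x≤p
  ...   | inj₂ ≡.refl = trans
    (reflexive (≡.cong (coordinate (values g 0 k) (run p k)) (≡.sym (ℕₚ.+-identityʳ p))))
    (trans (coordinate-run-above g 0 p k 0 vanish) (reflexive (≡.cong g (≡.sym (ℕₚ.n∸n≡0 p)))))
  ...   | inj₁ x<p = trans
    (coordinate-∉ (values g 0 k) (run p k) x (λ s eq → ℕₚ.<⇒≱ x<p (ℕₚ.≤-trans (run-lower p k s) (ℕₚ.≤-reflexive eq))))
    (trans (sym g0) (reflexive (≡.cong g (≡.sym (ℕₚ.m≤n⇒m∸n≡0 x≤p)))))

  fromℕ-sum : ∀ B g → fromℕ (sumBelow B g) ≈ sumTo B (fromℕ ∘ g)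
  fromℕ-sum ℕ.zero    g = refl
  fromℕ-sum (ℕ.suc B) g = trans (·-homo-+ 1# (g 0) _) (+-congˡ (fromℕ-sum B (g ∘ ℕ.suc)))

  square-difference-comm : ∀ x y → (x - y) * (x - y) ≈ (y - x) * (y - x)
  square-difference-comm = solve 2 (λ x y → (x :- y) :* (x :- y) := (y :- x) :* (y :- x)) refl

  fromℕ-∣-∣² : ∀ a b → (fromℕ a - fromℕ b) * (fromℕ a - fromℕ b) ≈ fromℕ (∣ a - b ∣ ℕ.* ∣ a - b ∣)
  fromℕ-∣-∣² a b with ℕₚ.≤-total a b
  ... | inj₁ a≤b = trans (square-difference-comm _ _) (ordered a b a≤b)
    where
    ordered : ∀ a b → a ℕ.≤ b → (fromℕ b - fromℕ a) * (fromℕ b - fromℕ a) ≈ fromℕ (∣ a - b ∣ ℕ.* ∣ a - b ∣)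
    ordered a b a≤b with ℕₚ.m≤n⇒∃[o]m+o≡n a≤b
    ... | u , ≡.refl = trans (square-cong (trans (+-congʳ (·-homo-+ 1# a u))
        (solve 2 (λ x y → x :+ y :- x := y) refl (fromℕ a) (fromℕ u))))
      (trans (sym (·1-homo-* u u)) (reflexive (≡.cong (λ z → fromℕ (z ℕ.* z)) (≡.sym (ℕₚ.∣m-m+n∣≡n a u)))))
  ... | inj₂ b≤a with ℕₚ.m≤n⇒∃[o]m+o≡n b≤a
  ...   | u , ≡.refl = trans (square-cong (trans (+-congʳ (·-homo-+ 1# b u))
        (solve 2 (λ x y → x :+ y :- x := y) refl (fromℕ b) (fromℕ u))))
      (trans (sym (·1-homo-* u u)) (reflexive (≡.cong (λ z → fromℕ (z ℕ.* z))
        (≡.sym (≡.trans (ℕₚ.∣-∣-comm (b ℕ.+ u) b) (ℕₚ.∣m-m+n∣≡n b u))))))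

  Close : R → R → R → Set
  Close ε x y = x ≤ y + ε × y ≤ x + ε

  -- Membership in the entrywise closure of the realisable matrices; the length `k` of the scheme
  -- may grow as `ε` shrinks.
  Approximable : ∀ {n} → Matrix n → Set
  Approximable {n} M = ∀ ε → 0# < ε →
    ∃[ k ] Σ (Scheme n k) λ S → ∀ l m → l ≢ m → Close ε (Scheme.matrix S l m) (M l m)

  close-trans : ∀ {ε ε′ x y z} → Close ε x y → Close ε′ y z → Close (ε + ε′) x z
  close-trans {ε} {ε′} (p , p′) (q , q′) =
    ≤.trans p (≤-respʳ (trans (+-assoc _ _ _) (+-congˡ (+-comm _ _))) (+-monoˡ-≤ ε q)) ,
    ≤.trans q′ (≤-respʳ (+-assoc _ _ _) (+-monoˡ-≤ ε′ p′))

  close-+ : ∀ {ε ε′ x y u v} → Close ε x y → Close ε′ u v → Close (ε + ε′) (x + u) (y + v)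
  close-+ (p , p′) (q , q′) = ≤-respʳ (shuffle _ _ _ _) (+-mono-≤ p q) , ≤-respʳ (shuffle _ _ _ _) (+-mono-≤ p′ q′)
    where
    shuffle : ∀ x y u v → (x + y) + (u + v) ≈ (x + u) + (y + v)
    shuffle = solve 4 (λ x y u v → (x :+ y) :+ (u :+ v) := (x :+ u) :+ (y :+ v)) refl

  close-* : ∀ {ε x y} c → 0# ≤ c → Close ε x y → Close (c * ε) (c * x) (c * y)
  close-* c 0≤c (p , p′) = ≤-respʳ (distribˡ c _ _) (*-monoʳ-≤ 0≤c p) , ≤-respʳ (distribˡ c _ _) (*-monoʳ-≤ 0≤c p′)

  close-weaken : ∀ {ε ε′ x y} → ε ≤ ε′ → Close ε x y → Close ε′ x y
  close-weaken q (p , p′) = ≤.trans p (+-monoʳ-≤ _ q) , ≤.trans p′ (+-monoʳ-≤ _ q)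

  close-resp : ∀ {ε x x′ y y′} → x ≈ x′ → y ≈ y′ → Close ε x y → Close ε x′ y′
  close-resp e e′ (p , p′) = ≤-respˡ e (≤-respʳ (+-congʳ e′) p) , ≤-respˡ e′ (≤-respʳ (+-congʳ e) p′)

  scheme-of : ∀ {n k} {w : Vec R k} {D M : Matrix n} {ε} → Realises w D → (∀ l m → l ≢ m → Close ε (D l m) (M l m)) →
    ∃[ k ] Σ (Scheme n k) λ S → ∀ l m → l ≢ m → Close ε (Scheme.matrix S l m) (M l m)
  scheme-of r c = _ , Realises.scheme r , λ l m l≢m → close-resp (sym (Realises.matrix r l m l≢m)) refl (c l m l≢m)

  approximable-cong : ∀ {n} {M M′ : Matrix n} → M ≋ M′ → Approximable M → Approximable M′
  approximable-cong e A ε 0<ε = let (k , S , c) = A ε 0<ε in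
    k , S , λ l m l≢m → close-resp refl (e l m l≢m) (c l m l≢m)

  approximable-closed : ∀ {n} {M : Matrix n} →
    (∀ ε → 0# < ε → Σ (Matrix n) λ M′ → Approximable M′ × ∀ l m → l ≢ m → Close ε (M′ l m) (M l m)) → Approximable M
  approximable-closed A ε 0<ε =
    let 0<½ε = pos-* 0<½ 0<ε
        (M′ , A′ , c) = A (½ * ε) 0<½ε
        (k , S , c′) = A′ (½ * ε) 0<½ε
    in k , S , λ l m l≢m → close-weaken (≤-reflexive (halves ε)) (close-trans (c′ l m l≢m) (c l m l≢m))

  approximable-+ : ∀ {n} {M M′ : Matrix n} → Approximable M → Approximable M′ → Approximable (λ l m → M l m + M′ l m)
  approximable-+ A A′ ε 0<ε =
    let 0<½ε = pos-* 0<½ 0<ε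
        (_ , S , c) = A (½ * ε) 0<½ε
        (_ , T , c′) = A′ (½ * ε) 0<½ε
    in scheme-of (append (realised S) (realised T))
         (λ l m l≢m → close-weaken (≤-reflexive (halves ε)) (close-+ (c l m l≢m) (c′ l m l≢m)))

  approximable-* : ∀ {n} {M : Matrix n} c → 0# ≤ c → Approximable M → Approximable (λ l m → c * M l m)
  approximable-* c 0≤c A ε 0<ε =
    -- Taking 1 / (1 + c) instead of 1 / c covers c = 0 as well.
    let (i , 0<i , ei) = pos-inverse (pos-+-nonNeg 0<1 0≤c)
        (_ , S , cl) = A (i * ε) (pos-* 0<i 0<ε)
        cε′≤ε = ≤-add (*-nonNeg (<⇒≤ 0<i) (<⇒≤ 0<ε)) (trans
          (solve 3 (λ c i e → c :* (i :* e) :+ i :* e := (:1 :+ c) :* i :* e) refl c i ε)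
          (trans (*-congʳ ei) (*-identityˡ ε)))
    in scheme-of (scale c 0≤c (realised S)) (λ l m l≢m → close-weaken cε′≤ε (close-* c 0≤c (cl l m l≢m)))

  approximable-zero : ∀ {n} → Approximable {n} (λ _ _ → 0#)
  approximable-zero ε 0<ε = scheme-of empty (λ _ _ _ → (≤-add (<⇒≤ 0<ε) refl) , (≤-add (<⇒≤ 0<ε) refl))

  approximable-sum : ∀ {n N} (M : Fin N → Matrix n) → (∀ i → Approximable (M i)) → Approximable
      (λ l m → sum (λ i → M i l m))
  approximable-sum {N = ℕ.zero}  M A = approximable-zero
  approximable-sum {N = ℕ.suc N} M A = approximable-+ (A zero) (approximable-sum (λ i → M (suc i)) (λ i → A (suc i)))

  reciprocal-small : ∀ K {ε} → 0# < ε →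
    ∃[ n ] (∀ N → n ℕ.≤ N → ∀ {c} → 0# ≤ c → fromℕ N * c ≈ 1# → c * K ≤ ε)
  reciprocal-small K {ε} 0<ε = proj₁ large , λ N n≤N {c} 0≤c Nc≈1 →
    ≤-respʳ (trans (sym (*-assoc c (fromℕ N) ε)) (trans (*-congʳ (trans (*-comm c (fromℕ N)) Nc≈1)) (*-identityˡ ε)))
      (*-monoʳ-≤ 0≤c (≤-respˡ (trans (*-assoc K i ε) (trans (*-congˡ (trans (*-comm i ε) iε≈1)) (*-identityʳ K)))
        (≤-respʳ (*-comm ε (fromℕ N)) (≤-respˡ (*-comm ε (K * i))
          (*-monoʳ-≤ (<⇒≤ 0<ε) (≤.trans (proj₂ large) (fromℕ-mono-≤ n≤N)))))))
    where
    i = proj₁ (pos-inverse 0<ε)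
    iε≈1 = proj₂ (proj₂ (pos-inverse 0<ε))
    large = archimedean (K * i)

  module _ {n} (V N : ℕ) (p : Fin n → ℕ) (p≤V : ∀ l → p l ℕ.≤ V) where

    tentScheme : Scheme n (N ℕ.+ N)
    tentScheme = record
      { a          = values (fromℕ ∘ tent N) 0 (N ℕ.+ N)
      ; J          = λ l → run (p l) (N ℕ.+ N)
      ; size       = N ℕ.+ N ℕ.+ V
      ; increasing = λ l → increasing-weaken ℕ.z≤n (run-increasing (p l) (N ℕ.+ N))
      ; bounded    = λ l → run-bounded (p l) (N ℕ.+ N)
          (ℕₚ.≤-trans (ℕₚ.≤-reflexive (ℕₚ.+-comm (p l) (N ℕ.+ N))) (ℕₚ.+-monoʳ-≤ (N ℕ.+ N) (p≤V l)))
      }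

    tentScheme-matrix : ∀ l m → Scheme.matrix tentScheme l m ≈ fromℕ (gapSum (N ℕ.+ N ℕ.+ V) N (p l) (p m))
    tentScheme-matrix l m = trans (tupleDist≈sumTo tentScheme l m) (trans
      (sum-cong {N ℕ.+ N ℕ.+ V} (λ i → trans (square-cong (+-cong (shifted l (toℕ i)) (-‿cong (shifted m (toℕ i)))))
        (fromℕ-∣-∣² (tent N (toℕ i ℕ.∸ p l)) (tent N (toℕ i ℕ.∸ p m)))))
      (sym (fromℕ-sum (N ℕ.+ N ℕ.+ V) (λ x → gap N (p l) (p m) x ℕ.* gap N (p l) (p m) x))))
      where
      shifted : ∀ l x → coordinate (values (fromℕ ∘ tent N) 0 (N ℕ.+ N)) (run (p l) (N ℕ.+ N)) x ≈ fromℕ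
          (tent N (x ℕ.∸ p l))
      shifted l x = coordinate-run (fromℕ ∘ tent N) (p l) (N ℕ.+ N) x refl
          (λ t q → reflexive (≡.cong fromℕ (tent-outside {N} q)))

  -- Dividing the tent scheme by 2N turns its bounded error `K` into K / 2N, while the main term
  -- becomes the wanted square.
  approximable-integral : ∀ {n} (p : Fin n → ℕ) →
    Approximable (λ l m → (fromℕ (p l) - fromℕ (p m)) * (fromℕ (p l) - fromℕ (p m)))
  approximable-integral p ε 0<ε = scheme-of (scale c (<⇒≤ 0<c) (realised (tentScheme V N p p≤V)))
      (λ l m l≢m → close-weaken cK≤ε (close-resp
        (*-congˡ (sym (tentScheme-matrix V N p p≤V l m)))
        (trans (sym (*-assoc _ _ _)) (trans (*-congʳ (trans (*-comm c A) Ac≈1))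
            (trans (*-identityˡ _) (sym (fromℕ-∣-∣² (p l) (p m))))))
        (close-* c (<⇒≤ 0<c) (estimate l m))))
    where
    V = proj₁ (upperBound p)
    p≤V = proj₂ (upperBound p)
    K = fromℕ ((V ℕ.+ V) ℕ.* (V ℕ.* V))
    reciprocal = reciprocal-small K 0<ε
    -- The summand `V` gives the condition V ≤ N of the tent estimate; the other makes N positive
    -- and large enough for K / 2N ≤ ε.
    N = V ℕ.+ ℕ.suc (proj₁ reciprocal)
    A = fromℕ (N ℕ.+ N)
    n₀≤N : ℕ.suc (proj₁ reciprocal) ℕ.≤ N ℕ.+ N
    n₀≤N = ℕₚ.≤-trans (ℕₚ.m≤n+m _ V) (ℕₚ.m≤m+n N N)
    invA = pos-inverse (fromℕ-pos {N ℕ.+ N} (ℕₚ.≤-trans (ℕ.s≤s ℕ.z≤n) n₀≤N))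
    c = proj₁ invA
    0<c = proj₁ (proj₂ invA)
    Ac≈1 = proj₂ (proj₂ invA)
    cK≤ε : c * K ≤ ε
    cK≤ε = proj₂ reciprocal (N ℕ.+ N) (ℕₚ.≤-trans (ℕₚ.n≤1+n _) n₀≤N) (<⇒≤ 0<c) Ac≈1
    estimate : ∀ l m → Close K (fromℕ (gapSum (N ℕ.+ N ℕ.+ V) N (p l) (p m)))
        (A * fromℕ (∣ p l - p m ∣ ℕ.* ∣ p l - p m ∣))
    estimate l m =
      ≤-respʳ (trans (·-homo-+ 1# ((N ℕ.+ N) ℕ.* _) _) (+-congʳ (·1-homo-* (N ℕ.+ N) _)))
          (fromℕ-mono-≤ (proj₂ bounds)) ,
      ≤-respˡ (·1-homo-* (N ℕ.+ N) _) (≤-respʳ (·-homo-+ 1# (gapSum (N ℕ.+ N ℕ.+ V) N (p l) (p m)) _)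
          (fromℕ-mono-≤ (proj₁ bounds)))
      where bounds = gapSum-bounds V N (p l) (p m) (p≤V l) (p≤V m) (ℕₚ.m≤m+n V _)

-- Splitting a regular part off a simplex

module Decomposition (em : ExcludedMiddle (lsuc 0ℓ)) (ℝ : RealNumbers) where
  open Approximation em ℝ public
  open import Relation.Binary.Reasoning.Setoid setoid

  floor : ∀ n {x} → 0# ≤ x → x ≤ fromℕ n → ∃[ p ] fromℕ p ≤ x × x ≤ fromℕ p + 1#
  floor ℕ.zero    {x} 0≤x x≤n = 0 , 0≤x , ≤.trans x≤n (≤-respʳ (sym (+-identityˡ 1#)) 0≤1)
  floor (ℕ.suc n) {x} 0≤x x≤n with x ≤? fromℕ n
  ... | inj₁ p = floor n 0≤x p
  ... | inj₂ p = n , <⇒≤ p , ≤-respʳ (+-comm 1# (fromℕ n)) x≤n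

  upperBoundᴿ : ∀ {n} (t : Fin n → R) → ∃[ N ] ∀ l → t l ≤ fromℕ N
  upperBoundᴿ t =
    let (N , p) = upperBound (λ l → proj₁ (archimedean (t l))) in
    N , λ l → ≤.trans (proj₂ (archimedean (t l))) (fromℕ-mono-≤ (p l))

  -- From the identity 2ab - 2uv = (a - u)(b + v) + (a + u)(b - v).
  product-bound : ∀ {a b u v} → u ≤ a → - u ≤ a → v ≤ b → - v ≤ b → u * v ≤ a * b
  product-bound {a} {b} {u} {v} u≤a -u≤a v≤b -v≤b = *-cancelˡ-≤ 0<2 (≤-add
    (nonNeg-+ (*-nonNeg (x≤y⇒0≤y-x u≤a) (x≤y⇒0≤y-x -v≤b)) (*-nonNeg (x≤y⇒0≤y-x -u≤a) (x≤y⇒0≤y-x v≤b)))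
    (solve 4 (λ a b u v → :2 :* (u :* v) :+ ((a :- u) :* (b :- :- v) :+ (a :- :- u) :* (b :- v)) := :2 :*
        (a :* b)) refl a b u v))

  difference-bound : ∀ {x y c} → 0# ≤ x → 0# ≤ y → x ≤ c → y ≤ c → x - y ≤ c
  difference-bound {x} {y} {c} 0≤x 0≤y x≤c y≤c =
    ≤-add (nonNeg-+ 0≤y (x≤y⇒0≤y-x x≤c)) (solve 3 (λ x y c → x :- y :+ (y :+ (c :- x)) := c) refl x y c)

  -- Factor y² - x² as (y - x)(x + y); `a` bounds the first factor and `b` the second in absolute
  -- value.
  close-squares : ∀ {a b x y} → x - y ≤ a → y - x ≤ a → x + y ≤ b → - (x + y) ≤ b →
    Close (a * b) (y * y) (x * x)
  close-squares {a} {b} {x} {y} p p′ q q′ =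
    shift (product-bound p′ (≤-respˡ (solve 2 (λ x y → x :- y := :- (y :- x)) refl x y) p) q q′)
      (solve 2 (λ x y → (y :- x) :* (x :+ y) :+ x :* x := y :* y) refl x y) ,
    shift (product-bound p (≤-respˡ (solve 2 (λ x y → y :- x := :- (x :- y)) refl x y) p′) q q′)
      (solve 2 (λ x y → (x :- y) :* (x :+ y) :+ y :* y := x :* x) refl x y)
    where
    shift : ∀ {u v w} → u ≤ a * b → u + v ≈ w → w ≤ v + a * b
    shift {v = v} r e = ≤-respˡ e (≤-respʳ (+-comm _ v) (+-monoˡ-≤ v r))

  squares : ∀ {n} → (Fin n → R) → Matrix n
  squares t l m = (t l - t m) * (t l - t m)

  -- Rounding `t` down to multiples of 1 / q reduces to integers. Each square then changes by at
  -- most 2T / q, where `T` bounds `t`.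
  approximable-squares⁺ : ∀ {n} (t : Fin n → R) → (∀ l → 0# ≤ t l) → Approximable (squares t)
  approximable-squares⁺ {n} t 0≤t = approximable-closed approximate
    where
    T = fromℕ (proj₁ (upperBoundᴿ t))
    t≤T = proj₂ (upperBoundᴿ t)
    module _ (ε : R) (0<ε : 0# < ε) where
      reciprocal = reciprocal-small (T + T) 0<ε
      q = fromℕ (ℕ.suc (proj₁ reciprocal))
      0<q = fromℕ-pos {ℕ.suc (proj₁ reciprocal)} (ℕ.s≤s ℕ.z≤n)
      invq = pos-inverse 0<q
      i = proj₁ invq
      0≤i = <⇒≤ (proj₁ (proj₂ invq))
      qi≈1 = proj₂ (proj₂ invq)
      floors : ∀ l → ∃[ p ] fromℕ p ≤ q * t l × q * t l ≤ fromℕ p + 1#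
      floors l = floor (proj₁ (archimedean (q * t l))) (*-nonNeg (<⇒≤ 0<q) (0≤t l)) (proj₂ (archimedean (q * t l)))
      p : Fin n → ℕ
      p l = proj₁ (floors l)
      τ : Fin n → R
      τ l = i * fromℕ (p l)
      iq-cancel : ∀ x → i * (q * x) ≈ x
      iq-cancel x = trans (sym (*-assoc i q x)) (trans (*-congʳ (trans (*-comm i q) qi≈1)) (*-identityˡ x))
      τ≤t : ∀ l → τ l ≤ t l
      τ≤t l = ≤-respʳ (iq-cancel (t l)) (*-monoʳ-≤ 0≤i (proj₁ (proj₂ (floors l))))
      t≤τ+i : ∀ l → t l ≤ τ l + i
      t≤τ+i l = ≤-respˡ (iq-cancel (t l)) (≤-respʳ (trans (distribˡ i _ 1#) (+-congˡ (*-identityʳ i)))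
        (*-monoʳ-≤ 0≤i (proj₂ (proj₂ (floors l)))))
      error≤i : ∀ l → t l - τ l ≤ i
      error≤i l = ≤-respʳ (solve 2 (λ x i → x :+ i :- x := i) refl (τ l) i) (+-monoˡ-≤ (- τ l) (t≤τ+i l))
      0≤τ : ∀ l → 0# ≤ τ l
      0≤τ l = *-nonNeg 0≤i (fromℕ-nonNeg (p l))
      errors : ∀ l m → (t l - t m) - (τ l - τ m) ≤ i
      errors l m = ≤-respˡ (solve 4 (λ a b c d → (a :- c) :- (b :- d) := (a :- b) :- (c :- d)) refl (t l) (t m)
          (τ l) (τ m))
        (difference-bound (x≤y⇒0≤y-x (τ≤t l)) (x≤y⇒0≤y-x (τ≤t m)) (error≤i l) (error≤i m))
      sums : ∀ l m → (t l - t m) + (τ l - τ m) ≤ T + T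
      sums l m = ≤-respˡ (solve 4 (λ a b c d → (a :+ c) :- (b :+ d) := (a :- b) :+ (c :- d)) refl (t l) (t m)
          (τ l) (τ m))
        (difference-bound (nonNeg-+ (0≤t l) (0≤τ l)) (nonNeg-+ (0≤t m) (0≤τ m)) (bound′ l) (bound′ m))
        where
        bound′ : ∀ l → t l + τ l ≤ T + T
        bound′ l = +-mono-≤ (t≤T l) (≤.trans (τ≤t l) (t≤T l))
      approximate : Σ (Matrix n) λ M′ → Approximable M′ × ∀ l m → l ≢ m → Close ε (M′ l m) (squares t l m)
      approximate = squares τ ,
        approximable-cong (λ l m _ → solve 3 (λ i x y → (i :* i) :* ((x :- y) :* (x :- y)) := (i :* x :- i :* y)
            :* (i :* x :- i :* y))
            refl i (fromℕ (p l)) (fromℕ (p m)))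
          (approximable-* (i * i) (*-nonNeg 0≤i 0≤i) (approximable-integral p)) ,
        λ l m _ → close-weaken (proj₂ reciprocal (ℕ.suc (proj₁ reciprocal)) (ℕₚ.n≤1+n _) 0≤i qi≈1)
          (close-squares (errors l m)
            (≤-respˡ (solve 4 (λ a b c d → (b :- a) :- (d :- c) := (c :- d) :- (a :- b)) refl (t l) (t m) (τ l)
                (τ m)) (errors m l))
            (sums l m)
            (≤-respˡ (solve 4 (λ a b c d → (b :- a) :+ (d :- c) := :- ((a :- b) :+ (c :- d))) refl (t l) (t m)
                (τ l) (τ m)) (sums m l)))

  -- Only differences of `t` matter, so a translation makes it non-negative.
  approximable-squares : ∀ {n} (t : Fin n → R) → Approximable (squares t)
  approximable-squares t = approximable-cong
      (λ l m _ → solve 3 (λ x y s → (x :+ s :- (y :+ s)) :* (x :+ s :- (y :+ s)) := (x :- y) :* (x :- y)) refl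
          (t l) (t m) s)
      (approximable-squares⁺ (λ l → t l + s) (λ l → ≤-respˡ (-‿inverseʳ (t l)) (+-monoʳ-≤ (t l) (proj₂ bound′ l))))
    where
    bound′ = upperBoundᴿ (λ l → - t l)
    s = fromℕ (proj₁ bound′)

  dot : ∀ {B} → Vector R B → Vector R B → R
  dot v y = sum (λ b → v b * y b)

  dot-comm : ∀ {B} (v y : Vector R B) → dot v y ≈ dot y v
  dot-comm v y = sum-cong (λ b → *-comm (v b) (y b))

  dot-subtract : ∀ {B} k (v w y : Vector R B) → dot (λ b → v b - k * w b) y ≈ dot v y - k * dot w y
  dot-subtract k v w y = begin
    sum (λ b → (v b - k * w b) * y b)
      ≈⟨ sum-cong (λ b → solve 4 (λ v k w y → (v :- k :* w) :* y := v :* y :+ (:- k) :* (w :* y)) refl (v b) k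
          (w b) (y b)) ⟩
    sum (λ b → v b * y b + (- k) * (w b * y b))
      ≈⟨ sum-+ (λ b → v b * y b) (λ b → (- k) * (w b * y b)) ⟩
    dot v y + sum (λ b → (- k) * (w b * y b))
      ≈⟨ +-congˡ (sum-* (- k) (λ b → w b * y b)) ⟩
    dot v y + (- k) * dot w y
      ≈⟨ solve 3 (λ x k z → x :+ (:- k) :* z := x :- k :* z) refl (dot v y) k (dot w y) ⟩
    dot v y - k * dot w y ∎

  dot-subtractʳ : ∀ {B} k (v w y : Vector R B) → dot y (λ b → v b - k * w b) ≈ dot y v - k * dot y w
  dot-subtractʳ k v w y = trans (dot-comm y (λ b → v b - k * w b)) (trans (dot-subtract k v w y)
    (+-cong (dot-comm v y) (-‿cong (*-congˡ (dot-comm w y)))))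

  indicator : ∀ {n} → Fin n → Fin n → R → R
  indicator i l x = if does (i Finₚ.≟ l) then x else 0#

  indicator-≡ : ∀ {n} (l : Fin n) x → indicator l l x ≈ x
  indicator-≡ l x rewrite dec-true (l Finₚ.≟ l) ≡.refl = refl

  indicator-≢ : ∀ {n} {i l : Fin n} x → i ≢ l → indicator i l x ≈ 0#
  indicator-≢ {i = i} {l} x i≢l rewrite dec-false (i Finₚ.≟ l) i≢l = refl

  sum-indicator : ∀ {n} (f : Vector R n) l → sum (λ i → indicator i l (f i)) ≈ f l
  sum-indicator f l = trans (sum-single (λ i → indicator i l (f i)) l (λ i → indicator-≢ (f i))) (indicator-≡ l (f l))

  combination : ∀ {n B} → Vector R n → (Fin n → Vector R B) → Vector R B
  combination c u b = sum (λ i → c i * u i b)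

  -- Induction on the number of vectors. A functional that separates `w` from the other vectors
  -- either annihilates the new vector too, or serves to eliminate it.
  fredholm : ∀ n {B} (u : Fin n → Vector R B) (w : Vector R B) →
    (Σ (Vector R n) λ c → ∀ b → w b ≈ combination c u b) ⊎
    (Σ (Vector R B) λ v → (∀ i → dot v (u i) ≈ 0#) × dot v w ≈ 1#)
  fredholm ℕ.zero {B} u w with dec (∃[ b ] ¬ w b ≈ 0#)
  ... | yes (b , w≉0) = let (i , e) = inverse (w b) w≉0 in
    inj₂ ((λ b′ → indicator b′ b i) , (λ ()) , trans
      (sum-single (λ b′ → indicator b′ b i * w b′) b (λ b′ b′≢b → trans (*-congʳ (indicator-≢ i b′≢b)) (zeroˡ _)))
      (trans (*-congʳ (indicator-≡ b i)) (trans (*-comm i (w b)) e)))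
  ... | no ¬p = inj₁ ((λ ()) , λ b → stable b (dec (w b ≈ 0#)))
    where
    stable : ∀ b → Dec (w b ≈ 0#) → w b ≈ 0#
    stable b (yes p) = p
    stable b (no q)  = ⊥-elim (¬p (b , q))
  fredholm (ℕ.suc n) u w with fredholm n (u ∘ suc) w
  ... | inj₁ (c , e) = inj₁ ((λ { zero → 0# ; (suc i) → c i }) , λ b →
    trans (e b) (sym (trans (+-congʳ (zeroˡ _)) (+-identityˡ _))))
  ... | inj₂ (v , v⊥u , vw≈1) with dec (dot v (u zero) ≈ 0#)
  ...   | yes p = inj₂ (v , (λ { zero → p ; (suc i) → v⊥u i }) , vw≈1)
  ...   | no α≉0 with inverse (dot v (u zero)) α≉0
  -- The vector w - β u₀ is orthogonal to `v`. If it lies in the span of the other vectors, then `w`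
  -- lies in the span of all; if not, its separating functional v′ is corrected by the multiple k of
  -- `v` that makes it vanish at u₀.
  ...     | β , αβ≈1 with fredholm n (u ∘ suc) (λ b → w b - β * u zero b)
  ...       | inj₁ (c , e) = inj₁ ((λ { zero → β ; (suc i) → c i }) , λ b →
    trans (solve 2 (λ w x → w := x :+ (w :- x)) refl (w b) (β * u zero b)) (+-congˡ (e b)))
  ...       | inj₂ (v′ , v′⊥u , v′w≈1) = inj₂ (v″ , (λ { zero → v″⊥u₀ ; (suc i) → v″⊥u i }) , v″w≈1)
    where
    α = dot v (u zero)
    k = dot v′ (u zero) * β
    v″ = λ b → v′ b - k * v b
    v″⊥u : ∀ i → dot v″ (u (suc i)) ≈ 0#
    v″⊥u i = trans (dot-subtract k v′ v (u (suc i))) (trans (+-cong (v′⊥u i) (-‿cong (*-congˡ (v⊥u i))))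
      (solve 1 (λ k → :0 :- k :* :0 := :0) refl k))
    v″⊥u₀ : dot v″ (u zero) ≈ 0#
    v″⊥u₀ = trans (dot-subtract k v′ v (u zero)) (trans
      (solve 3 (λ x β α → x :- x :* β :* α := x :- x :* (α :* β)) refl (dot v′ (u zero)) β α)
      (trans (+-congˡ (-‿cong (*-congˡ αβ≈1))) (solve 1 (λ x → x :- x :* :1 := :0) refl (dot v′ (u zero)))))
    v″w≈1 : dot v″ w ≈ 1#
    v″w≈1 = trans (dot-subtract k v′ v w) (trans (+-congˡ (-‿cong (*-congˡ vw≈1))) (trans
      (solve 3 (λ x y β → x :- y :* β :* :1 := x :- β :* y) refl (dot v′ w) (dot v′ (u zero)) β)
      (trans (sym (dot-subtractʳ β w (u zero) v′)) v′w≈1)))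

  -- A damped projection of y off v: any γ ≤ 1 / |v|² leaves a positive multiple of (v · y)².
  shrink : ∀ {B} γ (v y : Vector R B) →
    dot y y ≈ (2# * γ - γ * γ * dot v v) * (dot v y * dot v y) + sum
        (λ b → (y b - γ * dot v y * v b) * (y b - γ * dot v y * v b))
  shrink γ v y = begin
    dot y y
      ≈⟨ solve 4 (λ Y V t γ → Y := (:2 :* γ :- γ :* γ :* V) :* (t :* t) :+
          ((Y :+ (γ :* t) :* (γ :* t) :* V) :- :2 :* ((γ :* t) :* t))) refl (dot y y) (dot v v) t γ ⟩
    η * (t * t) + ((dot y y + g * g * dot v v) - 2# * (g * t))
      ≈⟨ +-congˡ (sym (+-cong (+-congˡ squared) (-‿cong (*-congˡ mixed)))) ⟩
    η * (t * t) + ((dot y y + sum (λ b → (g * v b) * (g * v b))) - 2# * sum (λ b → y b * (g * v b)))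
      ≈⟨ +-congˡ (sym (sum-square-difference y (λ b → g * v b))) ⟩
    η * (t * t) + sum (λ b → (y b - g * v b) * (y b - g * v b)) ∎
    where
    t = dot v y
    g = γ * t
    η = 2# * γ - γ * γ * dot v v
    squared : sum (λ b → (g * v b) * (g * v b)) ≈ g * g * dot v v
    squared = trans (sum-cong (λ b → solve 2 (λ g v → (g :* v) :* (g :* v) := (g :* g) :* (v :* v)) refl g (v b)))
      (sum-* (g * g) (λ b → v b * v b))
    mixed : sum (λ b → y b * (g * v b)) ≈ g * t
    mixed = trans (sum-cong (λ b → solve 3 (λ y g v → y :* (g :* v) := g :* (v :* y)) refl (y b) g (v b)))
      (sum-* g (λ b → v b * y b))

  module _ {n-1} (x : Fin (ℕ.suc n-1) → Point) (independent : AffinelyIndependent x) where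
    private
      n = ℕ.suc n-1
      B = proj₁ (upperBound (λ l → bound (x l)))
      bound≤B = proj₂ (upperBound (λ l → bound (x l)))

      X : Fin n → Vector R B
      X i b = coord (x i) (toℕ b)

      -- A constant coordinate 1 in front turns affine independence into linear independence.
      X̂ : Fin n → Vector R (ℕ.suc B)
      X̂ i zero    = 1#
      X̂ i (suc b) = X i b

      -- Vertex `l` is replaced by the zero vector rather than removed, so that the indices stay in
      -- `Fin n`.
      others : Fin n → Fin n → Vector R (ℕ.suc B)
      others l i b = if does (i Finₚ.≟ l) then 0# else X̂ i b

    -- This is the barycentric coordinate of vertex `l`, as an affine function. It exists because
    -- the other alternative writes `X̂ l` as a combination of the remaining vertices, which affine
    -- independence forbids.
    dual : ∀ l → Σ (Vector R (ℕ.suc B)) λ v → ∀ i → dot v (X̂ i) ≈ indicator i l 1#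
    dual l with fredholm n (others l) (X̂ l)
    ... | inj₂ (v , ⊥others , vl≈1) = v , values-at
      where
      values-at : ∀ i → dot v (X̂ i) ≈ indicator i l 1#
      values-at i with i Finₚ.≟ l | ⊥others i
      ... | yes ≡.refl | _ = vl≈1
      ... | no _       | e = e
    ... | inj₁ (c , e) = ⊥-elim (1≉0 (trans (sym (-‿involutive 1#))
        (trans (-‿cong (trans (sym c′l≈-1) (independent c′ Σc′≈0 Σc′x≈0 l))) -0#≈0#)))
      where
      c′ : Vector R n
      -- The relation with `X̂ l` moved to the other side: coefficient -1 at `l`, where `others l`
      -- contributes nothing.
      c′ i = if does (i Finₚ.≟ l) then - 1# else c i
      c′l≈-1 : c′ l ≈ - 1#
      c′l≈-1 rewrite dec-true (l Finₚ.≟ l) ≡.refl = refl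
      term : ∀ i b → c′ i * X̂ i b ≈ c i * others l i b + indicator i l (- X̂ i b)
      term i b with i Finₚ.≟ l
      ... | yes _ = solve 2 (λ x c → (:- :1) :* x := c :* :0 :+ :- x) refl (X̂ i b) (c i)
      ... | no _  = sym (+-identityʳ _)
      vanish : ∀ b → sum (λ i → c′ i * X̂ i b) ≈ 0#
      vanish b = begin
        sum (λ i → c′ i * X̂ i b)
          ≈⟨ sum-cong (λ i → term i b) ⟩
        sum (λ i → c i * others l i b + indicator i l (- X̂ i b))
          ≈⟨ sum-+ (λ i → c i * others l i b) (λ i → indicator i l (- X̂ i b)) ⟩
        combination c (others l) b + sum (λ i → indicator i l (- X̂ i b))
          ≈⟨ +-cong (sym (e b)) (sum-indicator (λ i → - X̂ i b) l) ⟩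
        X̂ l b - X̂ l b
          ≈⟨ -‿inverseʳ (X̂ l b) ⟩
        0# ∎
      Σc′≈0 : sum c′ ≈ 0#
      Σc′≈0 = trans (sum-cong {f = c′} (λ i → sym (*-identityʳ (c′ i)))) (vanish zero)
      Σc′x≈0 : ∀ k → sum (λ i → c′ i * coord (x i) k) ≈ 0#
      Σc′x≈0 k with k ℕₚ.<? B
      ... | yes k<B = trans (sum-cong (λ i → *-congˡ {c′ i}
          (reflexive (≡.cong (coord (x i)) (≡.sym (Finₚ.toℕ-fromℕ< k<B)))))) (vanish (suc (Fin.fromℕ< k<B)))
      ... | no k≮B  = sum-zero (λ i → trans (*-congˡ {c′ i}
          (support (x i) k (ℕₚ.≤-trans (bound≤B i) (ℕₚ.≮⇒≥ k≮B)))) (zeroʳ _))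

    private
      v : Fin n → Vector R B
      v l b = proj₁ (dual l) (suc b)

      -- The linear part of the barycentric coordinate; its constant term cancels in differences.
      t : Fin n → Fin n → R
      t l i = dot (v l) (X i)

      t-difference : ∀ l i j → t l i - t l j ≈ indicator i l 1# - indicator j l 1#
      t-difference l i j = trans
        (solve 3 (λ x y β → x :- y := (β :+ x) :- (β :+ y)) refl (t l i) (t l j) (proj₁ (dual l) zero * 1#))
        (+-cong (proj₂ (dual l) i) (-‿cong (proj₂ (dual l) j)))

      total = sum (λ l → dot (v l) (v l))
      dot-nonNeg : ∀ l → 0# ≤ dot (v l) (v l)
      dot-nonNeg l = sum-nonNeg (λ b → v l b * v l b) (λ b → square-nonNeg _)
      0≤total = sum-nonNeg (λ l → dot (v l) (v l)) dot-nonNeg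
      -- One γ serves all l: with γ = 1 / (1 + total) one has γ |v l|² ≤ 1 for each of them.
      invγ = pos-inverse (pos-+-nonNeg 0<1 0≤total)
      γ = proj₁ invγ
      0<γ = proj₁ (proj₂ invγ)

      -- The coefficient 2γ - γ² |v|² in `shrink` is γ + surplus: a full γ is set aside for the
      -- regular part and the rest is still non-negative.
      surplus : Fin n → R
      surplus l = γ * (1# - γ * dot (v l) (v l))

      surplus-nonNeg : ∀ l → 0# ≤ surplus l
      surplus-nonNeg l = *-nonNeg (<⇒≤ 0<γ) (x≤y⇒0≤y-x (≤-respʳ (trans (*-comm γ _) (proj₂ (proj₂ invγ)))
        (*-monoʳ-≤ (<⇒≤ 0<γ) (≤.trans (≤-sum (λ l → dot (v l) (v l)) dot-nonNeg l) (≤-add 0≤1 (+-comm _ _))))))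

      -- What the l-th dual functional leaves of the squared distance.
      remainder : Fin n → Matrix n
      remainder l i j = surplus l * squares (t l) i j + sum (λ b → squares (λ i → X i b - γ * t l i * v l b) i j)

      remainder-approximable : ∀ l → Approximable (remainder l)
      remainder-approximable l = approximable-+
          (approximable-* (surplus l) (surplus-nonNeg l) (approximable-squares (t l)))
        (approximable-sum (λ b → squares (λ i → X i b - γ * t l i * v l b))
            (λ b → approximable-squares (λ i → X i b - γ * t l i * v l b)))

      D : Matrix n
      D i j = sqDist (x i) (x j)

      split : ∀ l i j → D i j ≈ γ * squares (t l) i j + remainder l i j
      split l i j = begin
        D i j
          ≈⟨ sqDist≈sumTo (x i) (x j) B (bound≤B i) (bound≤B j) ⟩
        dot y y
          ≈⟨ shrink γ (v l) y ⟩
        (2# * γ - γ * γ * dot (v l) (v l)) * (dot (v l) y * dot (v l) y) + sum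
            (λ b → (y b - γ * dot (v l) y * v l b) * (y b - γ * dot (v l) y * v l b))
          ≈⟨ +-cong (*-congˡ (square-cong dot-y))
              (sum-cong (λ b → square-cong (trans (+-congˡ (-‿cong (*-congʳ (*-congˡ dot-y))))
              (solve 6 (λ a b c d g w → (a :- b) :- g :* (c :- d) :* w := (a :- g :* c :* w) :-
                  (b :- g :* d :* w)) refl (X i b) (X j b) (t l i) (t l j) γ (v l b))))) ⟩
        (2# * γ - γ * γ * dot (v l) (v l)) * squares (t l) i j + sum
            (λ b → squares (λ i → X i b - γ * t l i * v l b) i j)
          ≈⟨ solve 4 (λ γ V s r → (:2 :* γ :- γ :* γ :* V) :* s :+ r := γ :* s :+ (γ :* (:1 :- γ :* V) :* s :+ r))
              refl γ (dot (v l) (v l)) (squares (t l) i j) _ ⟩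
        γ * squares (t l) i j + remainder l i j ∎
        where
        y : Vector R B
        y b = X i b - X j b
        dot-y : dot (v l) y ≈ t l i - t l j
        dot-y = trans (sum-cong (λ b → *-congˡ {v l b} (+-congˡ (-‿cong (sym (*-identityˡ (X j b)))))))
          (trans (dot-subtractʳ 1# (X i) (X j) (v l)) (+-congˡ (-‿cong (*-identityˡ _))))

      -- Between two distinct vertices exactly two barycentric coordinates change, each by 1.
      sum-squares : ∀ i j → i ≢ j → sum (λ l → squares (t l) i j) ≈ 2#
      sum-squares i j i≢j = begin
        sum (λ l → squares (t l) i j)
          ≈⟨ sum-cong (λ l → trans (square-cong (t-difference l i j)) (term l)) ⟩
        sum (λ l → indicator l i 1# + indicator l j 1#)
          ≈⟨ sum-+ (λ l → indicator l i 1#) (λ l → indicator l j 1#) ⟩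
        sum (λ l → indicator l i 1#) + sum (λ l → indicator l j 1#)
          ≈⟨ +-cong (sum-indicator {n} (λ _ → 1#) i) (sum-indicator {n} (λ _ → 1#) j) ⟩
        2# ∎
        where
        indicator-sym : ∀ (i l : Fin n) → indicator i l 1# ≈ indicator l i 1#
        indicator-sym i l with i Finₚ.≟ l
        ... | yes ≡.refl = sym (indicator-≡ i 1#)
        ... | no i≢l     = sym (indicator-≢ 1# (i≢l ∘ ≡.sym))
        term : ∀ l → (indicator i l 1# - indicator j l 1#) * (indicator i l 1# - indicator j l 1#) ≈ indicator l i
            1# + indicator l j 1#
        term l = trans (square-cong (+-cong (indicator-sym i l) (-‿cong (indicator-sym j l)))) (cases l)
          where
          cases : ∀ l → (indicator l i 1# - indicator l j 1#) * (indicator l i 1# - indicator l j 1#) ≈ indicator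
              l i 1# + indicator l j 1#
          cases l with l Finₚ.≟ i | l Finₚ.≟ j
          ... | yes ≡.refl | yes l≡j = ⊥-elim (i≢j l≡j)
          ... | yes _      | no _    = solve 0 ((:1 :- :0) :* (:1 :- :0) := :1 :+ :0) refl
          ... | no _       | yes _   = solve 0 ((:0 :- :1) :* (:0 :- :1) := :0 :+ :1) refl
          ... | no _       | no _    = solve 0 ((:0 :- :0) :* (:0 :- :0) := :0 :+ :0) refl

    -- Averaging the splittings over all l merges the squares set aside into the constant 2γ / n off
    -- the diagonal.
    simplex-decomposition : ∃[ ρ ] 0# < ρ × Σ (Matrix n) λ M → Approximable M ×
      ∀ i j → i ≢ j → sqDist (x i) (x j) ≈ ρ + M i j
    simplex-decomposition = N⁻¹ * (γ * 2#) , pos-* 0<N⁻¹ (pos-* 0<γ 0<2) ,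
      (λ i j → N⁻¹ * sum (λ l → remainder l i j)) ,
      approximable-* N⁻¹ (<⇒≤ 0<N⁻¹) (approximable-sum remainder remainder-approximable) ,
      λ i j i≢j → begin
        D i j
          ≈⟨ sym (trans (*-congʳ (trans (*-comm N⁻¹ (fromℕ n)) (proj₂ (proj₂ invN)))) (*-identityˡ _)) ⟩
        N⁻¹ * fromℕ n * D i j
          ≈⟨ *-assoc N⁻¹ (fromℕ n) (D i j) ⟩
        N⁻¹ * (fromℕ n * D i j)
          ≈⟨ *-congˡ (sym (sum-const n (D i j))) ⟩
        N⁻¹ * sum {n} (λ _ → D i j)
          ≈⟨ *-congˡ (sum-cong {n} (λ l → split l i j)) ⟩
        N⁻¹ * sum (λ l → γ * squares (t l) i j + remainder l i j)
          ≈⟨ *-congˡ (sum-+ (λ l → γ * squares (t l) i j) (λ l → remainder l i j)) ⟩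
        N⁻¹ * (sum (λ l → γ * squares (t l) i j) + sum (λ l → remainder l i j))
          ≈⟨ *-congˡ (+-congʳ (trans (sum-* γ (λ l → squares (t l) i j)) (*-congˡ (sum-squares i j i≢j)))) ⟩
        N⁻¹ * (γ * 2# + sum (λ l → remainder l i j))
          ≈⟨ distribˡ N⁻¹ _ _ ⟩
        N⁻¹ * (γ * 2#) + N⁻¹ * sum (λ l → remainder l i j) ∎
      where
      invN = pos-inverse (fromℕ-pos {n} (ℕ.s≤s ℕ.z≤n))
      N⁻¹ = proj₁ invN
      0<N⁻¹ = proj₁ (proj₂ invN)

-- The labels of two points meet only when the first is the j-th and the second the i-th: β i = α j.
module Labels {n} (i j : Fin n) where

  α β : Fin n → ℕ
  α l = if does (l Finₚ.≟ j) then ℕ.suc (2 ℕ.* toℕ i) else 2 ℕ.* toℕ l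
  β l = if does (l Finₚ.≟ j) then 2 ℕ.* n else ℕ.suc (2 ℕ.* toℕ l)

  odd<2n : ∀ l → ℕ.suc (2 ℕ.* toℕ {n} l) ℕ.< 2 ℕ.* n
  odd<2n l = ℕₚ.≤-trans (ℕₚ.≤-reflexive (≡.sym (ℕₚ.*-suc 2 (toℕ l)))) (ℕₚ.*-monoʳ-≤ 2 (Finₚ.toℕ<n l))

  α<β : ∀ l → α l ℕ.< β l
  α<β l with does (l Finₚ.≟ j)
  ... | true  = odd<2n i
  ... | false = ℕₚ.≤-refl

  β-bounded : ∀ l → β l ℕ.< ℕ.suc (2 ℕ.* n)
  β-bounded l with does (l Finₚ.≟ j)
  ... | true  = ℕₚ.≤-refl
  ... | false = ℕₚ.m≤n⇒m≤1+n (odd<2n l)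

  double-injective : ∀ {l m : Fin n} → 2 ℕ.* toℕ l ≡ 2 ℕ.* toℕ m → l ≡ m
  double-injective {l} {m} eq = Finₚ.toℕ-injective (ℕₚ.*-cancelˡ-≡ (toℕ l) (toℕ m) 2 eq)

  α-injective : ∀ {l m} → α l ≡ α m → l ≡ m
  α-injective {l} {m} eq with l Finₚ.≟ j | m Finₚ.≟ j
  ... | yes ≡.refl | yes ≡.refl = ≡.refl
  ... | yes _      | no _       = ⊥-elim (ℕₚ.even≢odd (toℕ m) (toℕ i) (≡.sym eq))
  ... | no _       | yes _      = ⊥-elim (ℕₚ.even≢odd (toℕ l) (toℕ i) eq)
  ... | no _       | no _       = double-injective eq

  β-injective : ∀ {l m} → β l ≡ β m → l ≡ m
  β-injective {l} {m} eq with l Finₚ.≟ j | m Finₚ.≟ j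
  ... | yes ≡.refl | yes ≡.refl = ≡.refl
  ... | yes _      | no _       = ⊥-elim (ℕₚ.even≢odd n (toℕ m) eq)
  ... | no _       | yes _      = ⊥-elim (ℕₚ.even≢odd n (toℕ l) (≡.sym eq))
  ... | no _       | no _       = double-injective (ℕₚ.suc-injective eq)

-- Two-element blocks and the motion of subset sums

module Realisation (em : ExcludedMiddle (lsuc 0ℓ)) (ℝ : RealNumbers) where
  open Decomposition em ℝ public
  open import Relation.Binary.Reasoning.Setoid setoid

  β≟α : ∀ {n} (i j l m : Fin n) x → l ≢ m →
    δ (Labels.β i j m) (Labels.α i j l) x ≈ indicator j l (indicator i m x)
  β≟α i j l m x l≢m with l Finₚ.≟ j | m Finₚ.≟ j
  ... | yes ≡.refl | yes ≡.refl = ⊥-elim (l≢m ≡.refl)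
  ... | no l≢j | yes _ = trans (δ-≢ x (λ eq → ℕₚ.<-irrefl (≡.sym eq)
      (ℕₚ.<-trans (ℕₚ.n<1+n _) (Labels.odd<2n i j l)))) (sym (indicator-≢ _ (l≢j ∘ ≡.sym)))
  ... | no l≢j | no _  = trans (δ-≢ x (ℕₚ.even≢odd (toℕ l) (toℕ m) ∘ ≡.sym)) (sym (indicator-≢ _ (l≢j ∘ ≡.sym)))
  ... | yes ≡.refl | no _ with i Finₚ.≟ m
  ...   | yes ≡.refl = trans (δ-≡ x (≡.refl {x = ℕ.suc (2 ℕ.* toℕ m)})) (sym (indicator-≡ l x))
  ...   | no i≢m = trans (δ-≢ x (λ eq → i≢m (≡.sym (Labels.double-injective i l (ℕₚ.suc-injective eq)))))
            (sym (indicator-≡ l 0#))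

  pairBlockMatrix : ∀ {n} → Fin n → Fin n → R → Matrix n
  pairBlockMatrix i j c l m = 2# * c + (indicator j l (indicator i m c) + indicator j m (indicator i l c))

  module _ {n} (i j : Fin n) (c : R) (0≤c : 0# ≤ c) where
    open Labels i j
    private
      0≤½c = *-nonNeg (<⇒≤ 0<½) 0≤c
      s = sqrt (½ * c) 0≤½c
      2s²≈c : 2# * (s * s) ≈ c
      2s²≈c = trans (*-congˡ (sqrt-square (½ * c) 0≤½c))
          (trans (sym (*-assoc 2# ½ c)) (trans (*-congʳ 2½≈1) (*-identityˡ c)))

    pairScheme : Scheme n 2
    pairScheme = record
      { a          = s ∷ - s ∷ []
      ; J          = λ l → α l ∷ β l ∷ []
      ; size       = ℕ.suc (2 ℕ.* n)
      ; increasing = λ l → ℕ.z≤n , α<β l , tt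
      ; bounded    = λ l → ℕₚ.<-trans (α<β l) (β-bounded l) ∷ β-bounded l ∷ []
      }

    private
      products : ∀ l m {x y z w} → δ (α m) (α l) s ≈ x → δ (β m) (α l) (- s) ≈ y → δ (α m) (β l) s ≈ z → δ (β m)
          (β l) (- s) ≈ w →
        pair (s ∷ - s ∷ []) (α l ∷ β l ∷ []) (coordinate (s ∷ - s ∷ []) (α m ∷ β m ∷ [])) ≈ s * (x + y) - s * (z + w)
      products l m p q r t = trans
        (+-cong (*-congˡ (+-cong p (trans (+-identityʳ _) q)))
            (+-congʳ (*-congˡ (+-cong r (trans (+-identityʳ _) t)))))
        (solve 5 (λ s x y z w → s :* (x :+ y) :+ ((:- s) :* (z :+ w) :+ :0) := s :* (x :+ y) :- s :* (z :+ w))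
            refl s _ _ _ _)

      norm : ∀ l → norm² (s ∷ - s ∷ []) (α l ∷ β l ∷ []) ≈ c
      norm l = trans (products l l (δ-≡ s (≡.refl {x = α l})) (δ-≢ (- s) (λ eq → ℕₚ.<-irrefl (≡.sym eq) (α<β l)))
          (δ-≢ s (λ eq → ℕₚ.<-irrefl eq (α<β l))) (δ-≡ (- s) (≡.refl {x = β l})))
        (trans (solve 1 (λ s → s :* (s :+ :0) :- s :* (:0 :- s) := :2 :* (s :* s)) refl s) 2s²≈c)

      indicator-cong : ∀ {i l : Fin n} {x y} → x ≈ y → indicator i l x ≈ indicator i l y
      indicator-cong {i} {l} e with i Finₚ.≟ l
      ... | yes _ = e
      ... | no _  = refl

      indicator-* : ∀ (i l : Fin n) x y → x * indicator i l y ≈ indicator i l (x * y)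
      indicator-* i l x y with i Finₚ.≟ l
      ... | yes _ = refl
      ... | no _  = zeroʳ x

      indicator₂-* : ∀ (i l j m : Fin n) x y → x * indicator i l (indicator j m y) ≈ indicator i l
          (indicator j m (x * y))
      indicator₂-* i l j m x y = trans (indicator-* i l x _) (indicator-cong {i} {l} (indicator-* j m x y))

      δ-symmetric : ∀ p q x → δ p q x ≈ δ q p x
      δ-symmetric p q x with p ℕₚ.≟ q
      ... | yes ≡.refl = trans (δ-≡ x (≡.refl {x = p})) (sym (δ-≡ x (≡.refl {x = p})))
      ... | no p≢q     = trans (δ-≢ x p≢q) (sym (δ-≢ x (p≢q ∘ ≡.sym)))

    -- The slots carry `s` and `- s`, so a label shared across slots contributes -s² to the inner
    -- product and raises the squared distance from 4s² = 2c to 6s² = 3c. For c > 0 this exceeds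
    -- every subset sum 0, c, 2c of the block's weights. If i = j, no labels meet and the block is
    -- constant off the diagonal.
    pairScheme-realises : Realises (c ∷ c ∷ []) (pairBlockMatrix i j c)
    pairScheme-realises = record
      { scheme  = pairScheme
      ; weights = 2s²≈c ∷ trans (solve 1 (λ s → :2 :* ((:- s) :* (:- s)) := :2 :* (s :* s)) refl s) 2s²≈c ∷ []
      ; matrix  = matrix
      }
      where
      double : ∀ (i l j m : Fin n) → 2# * (s * indicator i l (indicator j m s)) ≈ indicator i l (indicator j m c)
      double i l j m = trans (sym (*-assoc 2# s _)) (trans (indicator₂-* i l j m (2# * s) s)
        (indicator-cong {i} {l} (indicator-cong {j} {m} (trans (*-assoc 2# s s) 2s²≈c))))
      matrix : Scheme.matrix pairScheme ≋ pairBlockMatrix i j c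
      matrix l m l≢m = begin
        Scheme.matrix pairScheme l m
          ≈⟨ +-cong (+-cong (norm l) (norm m)) (-‿cong (*-congˡ (products l m
               (δ-≢ s (l≢m ∘ ≡.sym ∘ α-injective)) (trans (β≟α i j l m (- s) l≢m) (negate j l i m))
               (trans (δ-symmetric (α m) (β l) s) (β≟α i j m l s (l≢m ∘ ≡.sym)))
                   (δ-≢ (- s) (l≢m ∘ ≡.sym ∘ β-injective))))) ⟩
        (c + c) - 2# * (s * (0# - X) - s * (Z + 0#))
          ≈⟨ solve 4 (λ c s x z → (c :+ c) :- :2 :* (s :* (:0 :- x) :- s :* (z :+ :0)) := :2 :* c :+
              (:2 :* (s :* x) :+ :2 :* (s :* z))) refl c s X Z ⟩
        2# * c + (2# * (s * X) + 2# * (s * Z))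
          ≈⟨ +-congˡ (+-cong (double j l i m) (double j m i l)) ⟩
        pairBlockMatrix i j c l m ∎
        where
        X = indicator j l (indicator i m s)
        Z = indicator j m (indicator i l s)
        negate : ∀ (i l j m : Fin n) → indicator i l (indicator j m (- s)) ≈ - indicator i l (indicator j m s)
        negate i l j m with i Finₚ.≟ l | j Finₚ.≟ m
        ... | yes _ | yes _ = refl
        ... | yes _ | no _  = sym -0#≈0#
        ... | no _  | yes _ = sym -0#≈0#
        ... | no _  | no _  = sym -0#≈0#

  -- One slot with pairwise distinct labels: orthogonal vectors of equal length.
  regular : ∀ {n} r → 0# ≤ r → Realises {n} (r ∷ []) (λ _ _ → r)
  regular {n} r 0≤r = record
    { scheme = record
      { a = s ∷ [] ; J = λ l → toℕ l ∷ [] ; size = n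
      ; increasing = λ l → ℕ.z≤n , tt ; bounded = λ l → Finₚ.toℕ<n l ∷ [] }
    ; weights = 2s²≈r ∷ []
    ; matrix = λ l m l≢m → trans
        (+-cong (+-cong (product l l (δ-≡ s (≡.refl {x = toℕ l}))) (product m m (δ-≡ s (≡.refl {x = toℕ m}))))
          (-‿cong (*-congˡ (product l m (δ-≢ s (l≢m ∘ ≡.sym ∘ Finₚ.toℕ-injective))))))
        (trans (solve 1 (λ s → (s :* s :+ s :* s) :- :2 :* (s :* :0) := :2 :* (s :* s)) refl s) 2s²≈r)
    }
    where
    0≤½r = *-nonNeg (<⇒≤ 0<½) 0≤r
    s = sqrt (½ * r) 0≤½r
    2s²≈r : 2# * (s * s) ≈ r
    2s²≈r = trans (*-congˡ (sqrt-square (½ * r) 0≤½r))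
        (trans (sym (*-assoc 2# ½ r)) (trans (*-congʳ 2½≈1) (*-identityˡ r)))
    product : ∀ (l m : Fin n) {x} → δ (toℕ m) (toℕ l) s ≈ x →
      pair (s ∷ []) (toℕ l ∷ []) (coordinate (s ∷ []) (toℕ m ∷ [])) ≈ s * x
    product l m e = trans (+-identityʳ _) (*-congˡ (trans (+-identityʳ _) e))

  flatten : ∀ {m k} → (Fin m → Vec R k) → Vec R (m ℕ.* k)
  flatten {ℕ.zero}  w = []
  flatten {ℕ.suc m} w = w zero ++ flatten (w ∘ suc)

  realises-sum : ∀ {n m k} (w : Fin m → Vec R k) (D : Fin m → Matrix n) →
    (∀ i → Realises (w i) (D i)) → Realises (flatten w) (λ l l′ → sum (λ i → D i l l′))
  realises-sum {m = ℕ.zero}  w D r = empty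
  realises-sum {m = ℕ.suc m} w D r = append (r zero) (realises-sum (w ∘ suc) (D ∘ suc) (r ∘ suc))

  flatten-pointwise : ∀ {m k} {_∼_ : R → R → Set} {w w′ : Fin m → Vec R k} →
    (∀ i → Pointwise _∼_ (w i) (w′ i)) → Pointwise _∼_ (flatten w) (flatten w′)
  flatten-pointwise {ℕ.zero}  p = []
  flatten-pointwise {ℕ.suc m} p = Pointwise.++⁺ (p zero) (flatten-pointwise (p ∘ suc))

  ones : ∀ {k} → Vec Bool k → ℕ
  ones []          = 0
  ones (true ∷ b)  = ℕ.suc (ones b)
  ones (false ∷ b) = ones b

  ones-bound : ∀ {k} (b : Vec Bool k) → ones b ℕ.≤ k
  ones-bound []          = ℕ.z≤n
  ones-bound (true ∷ b)  = ℕ.s≤s (ones-bound b)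
  ones-bound (false ∷ b) = ℕₚ.m≤n⇒m≤1+n (ones-bound b)

  subsetSum-empty : ∀ {k} (w : Vec R k) b → ones b ≡ 0 → subsetSum w b ≈ 0#
  subsetSum-empty []       []          _ = refl
  subsetSum-empty (w ∷ ws) (false ∷ b) p = trans (+-identityˡ _) (subsetSum-empty ws b p)

  -- Subset sums are affine in the shift, with the number of chosen weights as slope.
  subsetSum-shift : ∀ {k h} {w w′ : Vec R k} → Pointwise (λ x y → x ≈ y + h) w w′ →
    ∀ b → subsetSum w b ≈ subsetSum w′ b + fromℕ (ones b) * h
  subsetSum-shift {h = h} [] [] = solve 1 (λ h → :0 := :0 :+ :0 :* h) refl h
  subsetSum-shift {h = h} (p ∷ ps) (true ∷ b) = trans (+-cong p (subsetSum-shift ps b))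
    (solve 4 (λ y h s o → (y :+ h) :+ (s :+ o :* h) := (y :+ s) :+ (:1 :+ o) :* h) refl _ h _ _)
  subsetSum-shift {h = h} (p ∷ ps) (false ∷ b) = trans (+-congˡ (subsetSum-shift ps b)) (sym (+-assoc _ _ _))

  -- Truth for all sufficiently small positive h. Such properties are closed under finite
  -- conjunctions, in particular over all subsets.
  Eventually : (R → Set) → Set
  Eventually P = ∃[ θ ] 0# < θ × (∀ h → 0# < h → h < θ → P h)

  eventually-× : ∀ {P Q : R → Set} → Eventually P → Eventually Q → Eventually (λ h → P h × Q h)
  eventually-× (θ , 0<θ , p) (θ′ , 0<θ′ , q) =
    let (z , 0<z , z≤θ , z≤θ′) = min₊ θ θ′ 0<θ 0<θ′ in
    z , 0<z , λ h 0<h h<z → p h 0<h (<-≤-trans h<z z≤θ) , q h 0<h (<-≤-trans h<z z≤θ′)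

  eventually-∀ : ∀ k {P : Vec Bool k → R → Set} → (∀ b → Eventually (P b)) → Eventually (λ h → ∀ b → P b h)
  eventually-∀ ℕ.zero    p = let (θ , 0<θ , q) = p [] in θ , 0<θ , λ h 0<h h<θ → λ { [] → q h 0<h h<θ }
  eventually-∀ (ℕ.suc k) p =
    let (θ , 0<θ , q) = eventually-× (eventually-∀ k (p ∘ (true ∷_))) (eventually-∀ k (p ∘ (false ∷_))) in
    θ , 0<θ , λ h 0<h h<θ → λ { (true ∷ b) → proj₁ (q h 0<h h<θ) b ; (false ∷ b) → proj₂ (q h 0<h h<θ) b }

  eventually-witness : ∀ {P : R → Set} → Eventually P → ∃[ h ] 0# < h × P h
  eventually-witness (θ , 0<θ , p) = ½ * θ , 0<½θ , p (½ * θ) 0<½θ (<-respʳ (halves θ) (x<x+y 0<½θ))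
    where 0<½θ = pos-* 0<½ 0<θ

  -- A non-constant affine function takes the value `v` at a single root, so a positive root serves
  -- as the threshold and a root ≤ 0 never interferes. The hypothesis settles the constant case.
  eventually-≉ : ∀ A B v → (B ≈ 0# → ¬ A ≈ v) → Eventually (λ h → ¬ A + B * h ≈ v)
  eventually-≉ A B v p with dec (B ≈ 0#)
  ... | yes B≈0 = 1# , 0<1 , λ h _ _ e → p B≈0
      (trans (sym (trans (+-congˡ (trans (*-congʳ B≈0) (zeroˡ h))) (+-identityʳ A))) e)
  ... | no B≉0 with inverse B B≉0
  ...   | i , Bi≈1 = cases (root ≤? 0#)
    where
    root = (v - A) * i
    h≈root : ∀ {h} → A + B * h ≈ v → h ≈ root
    h≈root {h} e = sym (trans (*-congʳ (+-congʳ (sym e))) (trans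
      (solve 4 (λ A B h i → (A :+ B :* h :- A) :* i := (B :* i) :* h) refl A B h i)
      (trans (*-congʳ Bi≈1) (*-identityˡ h))))
    cases : root ≤ 0# ⊎ 0# < root → Eventually (λ h → ¬ A + B * h ≈ v)
    cases (inj₁ q) = 1# , 0<1 , λ h 0<h _ e → <⇒≱ 0<h (≤-respˡ (sym (h≈root e)) q)
    cases (inj₂ q) = root , q , λ h _ h<root e → <⇒≉ h<root (h≈root e)

  eventually-≤ : ∀ κ r → 0# ≤ κ → 0# < r → Eventually (λ h → κ * h ≤ r)
  eventually-≤ κ r 0≤κ 0<r =
    let (i , 0<i , e) = pos-inverse (pos-+-nonNeg 0<1 0≤κ) in
    i * r , pos-* 0<i 0<r , λ h 0<h h<ir → ≤.trans
      (≤-add (<⇒≤ 0<h) (solve 2 (λ κ h → κ :* h :+ h := (:1 :+ κ) :* h) refl κ h))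
      (≤-respʳ (trans (sym (*-assoc _ i r)) (trans (*-congʳ e) (*-identityˡ r)))
        (*-monoʳ-≤ (nonNeg-+ 0≤1 0≤κ) (<⇒≤ h<ir)))

  fromℕ-injective-0 : ∀ m → fromℕ m ≈ 0# → m ≡ 0
  fromℕ-injective-0 ℕ.zero    _ = ≡.refl
  fromℕ-injective-0 (ℕ.suc m) e = ⊥-elim (>⇒≉ (fromℕ-pos {ℕ.suc m} (ℕ.s≤s ℕ.z≤n)) e)

  sum₂ : ∀ {n} → Matrix n → R
  sum₂ c = sum (λ i → sum (λ j → c i j))

  sum₂-mono-≤ : ∀ {n} {c d : Matrix n} → (∀ i j → c i j ≤ d i j) → sum₂ c ≤ sum₂ d
  sum₂-mono-≤ p = sum-mono-≤ (λ i → sum-mono-≤ (p i))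

  sum₂-+ : ∀ {n} (c d : Matrix n) → sum₂ (λ i j → c i j + d i j) ≈ sum₂ c + sum₂ d
  sum₂-+ c d = trans (sum-cong (λ i → sum-+ (c i) (d i))) (sum-+ (λ i → sum (c i)) (λ i → sum (d i)))

  sum₂-const : ∀ n x → sum₂ {n} (λ _ _ → x) ≈ fromℕ n * (fromℕ n * x)
  sum₂-const n x = trans (sum-cong {n} (λ _ → sum-const n x)) (sum-const n (fromℕ n * x))

  sum₂-* : ∀ {n} k (c : Matrix n) → sum₂ (λ i j → k * c i j) ≈ k * sum₂ c
  sum₂-* k c = trans (sum-cong (λ i → sum-* k (c i))) (sum-* k (λ i → sum (c i)))

  sum₂-indicator : ∀ {n} (c : Matrix n) l m → sum₂ (λ i j → indicator j l (indicator i m (c i j))) ≈ c m l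
  sum₂-indicator c l m = trans (sum-cong (λ i → sum-indicator (λ j → indicator i m (c i j)) l))
      (sum-indicator (λ i → c i l) m)

  blockWeights : ∀ {n} → Matrix n → Vec R (n ℕ.* (n ℕ.* 2))
  blockWeights c = flatten (λ i → flatten (λ j → c i j ∷ c i j ∷ []))

  blockWeights-shift : ∀ {n} (c : Matrix n) h →
    Pointwise (λ x y → x ≈ y + h) (blockWeights (λ i j → c i j + h)) (blockWeights c)
  blockWeights-shift {n} c h =
    flatten-pointwise {w = λ i → row (λ j → c i j + h)} {w′ = λ i → row (c i)} (λ i →
      flatten-pointwise {w = λ j → c i j + h ∷ c i j + h ∷ []} {w′ = λ j → c i j ∷ c i j ∷ []}
          (λ j → refl ∷ refl ∷ []))
    where
    row : (Fin n → R) → Vec R (n ℕ.* 2)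
    row f = flatten (λ j → f j ∷ f j ∷ [])

  -- One block for each ordered pair: every block adds twice its size to all entries, and entry (l ,
  -- m) is raised further by the blocks (m , l) and (l , m) alone.
  blocks : ∀ {n} (c : Matrix n) → (∀ i j → 0# ≤ c i j) →
    Realises (blockWeights c) (λ l m → 2# * sum₂ c + (c m l + c l m))
  blocks c 0≤c = realises-cong total
    (realises-sum (λ i → flatten (λ j → c i j ∷ c i j ∷ [])) (λ i l m → sum (λ j → pairBlockMatrix i j (c i j) l m))
      (λ i → realises-sum (λ j → c i j ∷ c i j ∷ []) (λ j → pairBlockMatrix i j (c i j))
        (λ j → pairScheme-realises i j (c i j) (0≤c i j))))
    where
    total : (λ l m → sum (λ i → sum (λ j → pairBlockMatrix i j (c i j) l m))) ≋
        (λ l m → 2# * sum₂ c + (c m l + c l m))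
    total l m _ = trans (sum₂-+ (λ i j → 2# * c i j)
        (λ i j → indicator j l (indicator i m (c i j)) + indicator j m (indicator i l (c i j))))
      (+-cong (sum₂-* 2# c) (trans (sum₂-+ (λ i j → indicator j l (indicator i m (c i j)))
          (λ i j → indicator j m (indicator i l (c i j))))
        (+-cong (sum₂-indicator c l m) (sum₂-indicator c m l))))

-- Choice of the parameters and conclusion

module Conclusion (em : ExcludedMiddle (lsuc 0ℓ)) (ℝ : RealNumbers) where
  open Realisation em ℝ public
  open import Relation.Binary.Reasoning.Setoid setoid

  -- Halved because an entry is raised by the blocks of both orders of its pair.
  excess : ∀ {n} → Matrix n → R → Matrix n
  excess E L l m = if does (l Finₚ.≟ m) then 0# else ½ * (E l m - L)

  excess-≢ : ∀ {n} (E : Matrix n) L {l m} → l ≢ m → excess E L l m ≈ ½ * (E l m - L)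
  excess-≢ E L {l} {m} l≢m with l Finₚ.≟ m
  ... | yes l≡m = ⊥-elim (l≢m l≡m)
  ... | no _    = refl

  module _ {n} (E : Matrix n) (E-symmetric : ∀ l m → l ≢ m → E l m ≈ E m l)
    (L : R) (L≤E : ∀ l m → l ≢ m → L ≤ E l m) (0<r : 0# < L - 2# * sum₂ (excess E L)) where
    private
      N = n ℕ.* (n ℕ.* 2)
      -- Enlarging all n² blocks by h raises every entry by 2n²h through the constants and by 2h
      -- through its own two blocks; the regular part is lowered by this total κ h.
      κ = fromℕ (ℕ.suc (ℕ.suc N))
      c = excess E L
      r = L - 2# * sum₂ c

      0≤c : ∀ l m → 0# ≤ c l m
      0≤c l m with l Finₚ.≟ m
      ... | yes _  = ≤.refl
      ... | no l≢m = *-nonNeg (<⇒≤ 0<½) (x≤y⇒0≤y-x (L≤E l m l≢m))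

      shifted : R → Matrix n
      shifted h l m = c l m + h

      weightsAt : R → Vec R (ℕ.suc N)
      weightsAt h = (r - κ * h) ∷ blockWeights (shifted h)

      realisesAt : ∀ h → 0# ≤ h → κ * h ≤ r → Realises (weightsAt h) E
      realisesAt h 0≤h κh≤r = realises-cong total
        (append (regular (r - κ * h) (x≤y⇒0≤y-x κh≤r)) (blocks (shifted h) (λ i j → nonNeg-+ (0≤c i j) 0≤h)))
        where
        κ≈ : κ ≈ 1# + (1# + fromℕ n * (fromℕ n * 2#))
        κ≈ = +-congˡ (+-congˡ (trans (·1-homo-* n (n ℕ.* 2)) (*-congˡ (trans (·1-homo-* n 2)
          (*-congˡ (+-congˡ (+-identityʳ 1#)))))))
        entries : ∀ l m → l ≢ m → c m l + c l m ≈ E l m - L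
        entries l m l≢m = trans (+-cong (trans (excess-≢ E L (l≢m ∘ ≡.sym))
            (*-congˡ (+-congʳ (sym (E-symmetric l m l≢m))))) (excess-≢ E L l≢m))
          (halves (E l m - L))
        total : (λ l m → (r - κ * h) + (2# * sum₂ (shifted h) + (shifted h m l + shifted h l m))) ≋ E
        total l m l≢m = begin
          (r - κ * h) + (2# * sum₂ (shifted h) + (shifted h m l + shifted h l m))
            ≈⟨ +-cong (+-congˡ (-‿cong (*-congʳ κ≈)))
                (+-congʳ (*-congˡ (trans (sum₂-+ c (λ _ _ → h)) (+-congˡ (sum₂-const n h))))) ⟩
          (r - (1# + (1# + fromℕ n * (fromℕ n * 2#))) * h) +
              (2# * (sum₂ c + fromℕ n * (fromℕ n * h)) + (shifted h m l + shifted h l m))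
            ≈⟨ solve 6 (λ L S n h x y →
                 (L :- :2 :* S :- (:1 :+ (:1 :+ n :* (n :* :2))) :* h) :+
                     (:2 :* (S :+ n :* (n :* h)) :+ ((x :+ h) :+ (y :+ h)))
                 := L :+ (x :+ y)) refl L (sum₂ c) (fromℕ n) h (c m l) (c l m) ⟩
          L + (c m l + c l m)
            ≈⟨ +-congˡ (entries l m l≢m) ⟩
          L + (E l m - L)
            ≈⟨ solve 2 (λ L e → L :+ (e :- L) := e) refl L (E l m) ⟩
          E l m ∎

      blockSum : ∀ h b → subsetSum (blockWeights (shifted h)) b ≈ subsetSum (blockWeights c) b + fromℕ (ones b) * h
      blockSum h = subsetSum-shift (blockWeights-shift c h)

    -- As h grows by dh, every block weight grows by dh and the first weight shrinks by κ dh,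
    -- more than all the blocks together: no non-empty subset sum is constant in h.
    weights-avoid : ∀ b v → ¬ v ≈ 0# → Eventually (λ h → ¬ subsetSum (weightsAt h) b ≈ v)
    weights-avoid (false ∷ b) v v≉0 =
      let (θ , 0<θ , p) = eventually-≉ (subsetSum (blockWeights c) b) (fromℕ (ones b)) v
            (λ B≈0 A≈v → v≉0 (trans (sym A≈v) (subsetSum-empty (blockWeights c) b (fromℕ-injective-0 (ones b) B≈0))))
      in θ , 0<θ , λ h 0<h h<θ e → p h 0<h h<θ (trans (sym (blockSum h b)) (trans (sym (+-identityˡ _)) e))
    weights-avoid (true ∷ b) v v≉0 =
      let (θ , 0<θ , p) = eventually-≉ (r + subsetSum (blockWeights c) b) (fromℕ (ones b) - κ) v
            (λ B≈0 _ → <⇒≉ ones<κ (difference≈0 B≈0))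
      in θ , 0<θ , λ h 0<h h<θ e → p h 0<h h<θ (trans
           (solve 5 (λ r s o κ h → (r :+ s) :+ (o :- κ) :* h := (r :- κ :* h) :+ (s :+ o :* h)) refl r
               (subsetSum (blockWeights c) b) (fromℕ (ones b)) κ h)
           (trans (+-congˡ (sym (blockSum h b))) e))
      where
      ones<κ : fromℕ (ones b) < κ
      ones<κ = ≤-<-trans (fromℕ-mono-≤ (ℕₚ.m≤n⇒m≤1+n (ones-bound b)))
        (<-respʳ (+-comm _ 1#) (x<x+y 0<1))

    -- The pairs of subsets give finitely many conditions on h, each true for small h, as is κ h ≤
    -- r. The empty subset sums to 0 for every h, so `F` has to avoid 0.
    nearlyRegular : ∀ {k} (F : Vec Bool k → R) → (∀ b → ¬ F b ≈ 0#) →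
      Σ (Vec R (ℕ.suc N)) λ w → Realises w E × ∀ b b′ → ¬ subsetSum w b ≈ F b′
    nearlyRegular {k} F F≉0 =
      let (h , 0<h , κh≤r , avoid) = eventually-witness (eventually-×
            (eventually-≤ κ r (fromℕ-nonNeg (ℕ.suc (ℕ.suc N))) 0<r)
            (eventually-∀ (ℕ.suc N) (λ b → eventually-∀ k (λ b′ → weights-avoid b (F b′) (F≉0 b′)))))
      in weightsAt h , realisesAt h (<⇒≤ 0<h) κh≤r , avoid

  module _ {n k₀} (D : Matrix n) (D-symmetric : ∀ l m → D l m ≈ D m l) (S : Scheme n k₀) where
    private
      G = Scheme.matrix S
      wG = Scheme.weights S
      g = sum₂ G
      n² = fromℕ n * fromℕ n

    module _ (L ε : R) (0<ε : 0# < ε) (L≈ : 2# * ε + 2# * n² * (2# * ε) ≈ L)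
      (L+G≤D : ∀ l m → l ≢ m → L + G l m ≤ D l m)
      (D≤L+G : ∀ l m → l ≢ m → D l m ≤ L + 2# * (2# * ε) + G l m) where

      -- D is realised as (1 - θ) G + E with E nearly regular.
      module _ (θ : R) (0≤θ : 0# ≤ θ) (θ≤1 : θ ≤ 1#) (gθ≤ε : g * θ ≤ ε) where
        private
          μ = 1# - θ

          0≤μ : 0# ≤ μ
          0≤μ = x≤y⇒0≤y-x θ≤1

          E : Matrix n
          E l m = D l m - μ * G l m

          E-symmetric : ∀ l m → l ≢ m → E l m ≈ E m l
          E-symmetric l m _ = +-cong (D-symmetric l m) (-‿cong (*-congˡ (matrix-symmetric S l m)))

          L≤E : ∀ l m → l ≢ m → L ≤ E l m
          L≤E l m l≢m = ≤-add (nonNeg-+ (x≤y⇒0≤y-x (L+G≤D l m l≢m)) (*-nonNeg 0≤θ (matrix-nonNeg S l m)))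
            (solve 4 (λ L g d θ → L :+ ((d :- (L :+ g)) :+ θ :* g) := d :- (:1 :- θ) :* g) refl L (G l m) (D l m) θ)

          excess≤ : ∀ l m → excess E L l m ≤ ½ * (2# * (2# * ε) + θ * G l m)
          excess≤ l m with l Finₚ.≟ m
          ... | yes _  = *-nonNeg (<⇒≤ 0<½) (nonNeg-+ (*-nonNeg (<⇒≤ 0<2) (*-nonNeg (<⇒≤ 0<2) (<⇒≤ 0<ε)))
              (*-nonNeg 0≤θ (matrix-nonNeg S l m)))
          ... | no l≢m = *-monoʳ-≤ (<⇒≤ 0<½) (≤-add (x≤y⇒0≤y-x (D≤L+G l m l≢m))
              (solve 5 (λ L g d θ e → (d :- (:1 :- θ) :* g :- L) :+ (L :+ e :+ g :- d) := e :+ θ :* g) refl L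
                  (G l m) (D l m) θ (2# * (2# * ε))))

          T = sum₂ (excess E L)

          total≤ : 2# * T ≤ 2# * n² * (2# * ε) + g * θ
          total≤ = ≤.trans (*-monoʳ-≤ (<⇒≤ 0<2) (sum₂-mono-≤ excess≤)) (≤-reflexive (begin
            2# * sum₂ (λ l m → ½ * (2# * (2# * ε) + θ * G l m))
              ≈⟨ *-congˡ (trans (sum₂-* ½ (λ l m → 2# * (2# * ε) + θ * G l m))
                  (*-congˡ (sum₂-+ (λ _ _ → 2# * (2# * ε)) (λ l m → θ * G l m)))) ⟩
            2# * (½ * (sum₂ {n} (λ _ _ → 2# * (2# * ε)) + sum₂ (λ l m → θ * G l m)))
              ≈⟨ trans (sym (*-assoc 2# ½ _)) (trans (*-congʳ 2½≈1) (*-identityˡ _)) ⟩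
            sum₂ {n} (λ _ _ → 2# * (2# * ε)) + sum₂ (λ l m → θ * G l m)
              ≈⟨ +-cong (sum₂-const n (2# * (2# * ε))) (sum₂-* θ G) ⟩
            fromℕ n * (fromℕ n * (2# * (2# * ε))) + θ * g
              ≈⟨ solve 4 (λ n d θ g → n :* (n :* (:2 :* (:2 :* d))) :+ θ :* g := :2 :* (n :* n) :* (:2 :* d) :+ g
                  :* θ) refl (fromℕ n) ε θ g ⟩
            2# * n² * (2# * ε) + g * θ ∎))

          -- The blocks cost at most 2n² · 2ε + g θ, and L exceeds the first term by 2ε. With g θ ≤
          -- ε, at least ε is left for the regular part.
          0<r : 0# < L - 2# * T
          0<r = <-≤-trans 0<ε (≤-add (nonNeg-+ (x≤y⇒0≤y-x total≤) (x≤y⇒0≤y-x gθ≤ε)) (trans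
            (solve 4 (λ n d t s → d :+ ((:2 :* n :* (:2 :* d) :+ t :- s) :+ (d :- t)) := :2 :* d :+ :2 :* n :*
                (:2 :* d) :- s) refl n² ε (g * θ) (2# * T))
            (+-congʳ L≈)))

          combine : ∀ {K} v (w : Vec R K) → Realises w E →
            (∀ b b′ → ¬ subsetSum w b ≈ v - μ * subsetSum wG b′) →
            Realises (w ++ Vec.map (μ *_) wG) D × ∀ b → ¬ subsetSum (w ++ Vec.map (μ *_) wG) b ≈ v
          combine v w realises avoids =
            realises-cong (λ l m _ → solve 3 (λ d μ g → (d :- μ :* g) :+ μ :* g := d) refl (D l m) μ (G l m))
              (append realises (scale μ 0≤μ (realised S))) ,
            λ b e → let (b₁ , b₂ , split) = subsetSum-++ w (Vec.map (μ *_) wG) b in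
              avoids b₁ b₂ (trans
                (solve 2 (λ x y → x := x :+ y :- y) refl (subsetSum w b₁) (μ * subsetSum wG b₂))
                (+-congʳ (trans (+-congˡ (sym (subsetSum-scale μ wG b₂))) (trans (sym split) e))))

          nonzero : ∀ v → (∀ b → ¬ subsetSum wG b + (- subsetSum wG b) * θ ≈ v) → ∀ b → ¬ v - μ * subsetSum wG b ≈ 0#
          nonzero v avoid b e = avoid b (trans
            (solve 2 (λ s θ → s :+ (:- s) :* θ := (:1 :- θ) :* s) refl (subsetSum wG b) θ) (sym (difference≈0 e)))

        realise-at : ∀ v → (∀ b → ¬ subsetSum wG b + (- subsetSum wG b) * θ ≈ v) →
          Σ (Vec R (ℕ.suc (n ℕ.* (n ℕ.* 2)) ℕ.+ k₀)) λ w → Realises w D × ∀ b → ¬ subsetSum w b ≈ v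
        realise-at v avoid =
          let (w , realises , avoids) = nearlyRegular E E-symmetric L L≤E 0<r (λ b → v - μ * subsetSum wG b) (nonzero v avoid)
          in w ++ Vec.map (μ *_) wG , combine v w realises avoids

      -- For a subset sum s of `wG` the function s - s θ is constant only if s = 0, and then it
      -- misses `v` because `v` is non-zero.
      parameter : ∀ v → ¬ v ≈ 0# → ∃[ θ ] 0# < θ × 1# * θ ≤ 1# × g * θ ≤ ε ×
        (∀ b → ¬ subsetSum wG b + (- subsetSum wG b) * θ ≈ v)
      parameter v v≉0 = eventually-witness (eventually-× (eventually-≤ 1# 1# 0≤1 0<1) (eventually-×
        (eventually-≤ g ε (sum-nonNeg _ (λ i → sum-nonNeg _ (λ j → matrix-nonNeg S i j))) 0<ε)
        (eventually-∀ k₀ (λ b → eventually-≉ (subsetSum wG b) (- subsetSum wG b) v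
          (λ B≈0 A≈v → v≉0 (trans (sym A≈v) (trans (sym (-‿involutive _)) (trans (-‿cong B≈0) -0#≈0#))))))))

      realise : ∀ v → ¬ v ≈ 0# →
        Σ (Vec R (ℕ.suc (n ℕ.* (n ℕ.* 2)) ℕ.+ k₀)) λ w → Realises w D × ∀ b → ¬ subsetSum w b ≈ v
      realise v v≉0 = let (θ , 0<θ , θ≤1 , gθ≤ε , avoid) = parameter v v≉0 in
        realise-at θ (<⇒≤ 0<θ) (≤-respˡ (*-identityˡ θ) θ≤1) gθ≤ε v avoid

  realisation : ∀ {n} (D : Matrix n) → (∀ l m → D l m ≈ D m l) → ∀ ρ → 0# < ρ → ∀ M → Approximable M →
    (∀ l m → l ≢ m → D l m ≈ ρ + M l m) →
    (∀ l m → l ≢ m → ¬ D l m ≈ 0#) ×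
    (∀ v → ¬ v ≈ 0# → ∃[ k ] Σ (Vec R (ℕ.suc k)) λ w → Realises w D × ∀ b → ¬ subsetSum w b ≈ v)
  realisation {n} D D-symmetric ρ 0<ρ M M-approximable D≈
    with pos-inverse (pos-+-nonNeg 0<2 (*-nonNeg (<⇒≤ 0<2) (*-nonNeg (fromℕ-nonNeg n) (fromℕ-nonNeg n))))
  ... | i , 0<i , inv with M-approximable (i * ρ) (pos-* 0<i 0<ρ)
  ...   | k , S , close = distinct , λ v v≉0 → _ , realise D D-symmetric S L ε (pos-* 0<½ 0<δ) L≈ lower upper v v≉0
    where
    n² = fromℕ n * fromℕ n
    -- δ′ = ρ / (2 + 2n²) makes L = ρ - δ′ equal to δ′ + 2n² δ′: the blocks may consume about 2n²
    -- δ′, and a further δ′ is in reserve.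
    δ′ = i * ρ
    0<δ : 0# < δ′
    0<δ = pos-* 0<i 0<ρ
    ε = ½ * δ′
    -- Off the diagonal G is within δ′ of M = D - ρ, so lowering ρ by δ′ puts D - L - G into the
    -- interval from 0 to 2δ′.
    L = ρ - δ′
    G = Scheme.matrix S
    2ε≈δ : 2# * ε ≈ δ′
    2ε≈δ = trans (sym (*-assoc 2# ½ δ′)) (trans (*-congʳ 2½≈1) (*-identityˡ δ′))
    L≈′ : δ′ + 2# * n² * δ′ ≈ L
    L≈′ = trans (solve 2 (λ n d → d :+ :2 :* n :* d := ((:2 :+ :2 :* n) :* d) :- d) refl n² δ′)
      (+-congʳ (trans (sym (*-assoc _ i ρ)) (trans (*-congʳ inv) (*-identityˡ ρ))))
    L≈ : 2# * ε + 2# * n² * (2# * ε) ≈ L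
    L≈ = trans (+-cong 2ε≈δ (*-congˡ 2ε≈δ)) L≈′
    lower : ∀ l m → l ≢ m → L + G l m ≤ D l m
    lower l m l≢m = ≤-add (x≤y⇒0≤y-x (proj₁ (close l m l≢m))) (trans
      (solve 4 (λ ρ d g m → (ρ :- d :+ g) :+ (m :+ d :- g) := ρ :+ m) refl ρ δ′ (G l m) (M l m)) (sym (D≈ l m l≢m)))
    upper : ∀ l m → l ≢ m → D l m ≤ L + 2# * (2# * ε) + G l m
    upper l m l≢m = ≤-add (x≤y⇒0≤y-x (proj₂ (close l m l≢m))) (trans (+-congʳ (D≈ l m l≢m)) (trans
      (solve 4 (λ ρ d g m → (ρ :+ m) :+ (g :+ d :- m) := ρ :- d :+ :2 :* d :+ g) refl ρ δ′ (G l m) (M l m))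
      (+-congʳ (+-congˡ (*-congˡ (sym 2ε≈δ))))))
    -- The entry is at least L + G l m, where L > 0 and G is non-negative.
    distinct : ∀ l m → l ≢ m → ¬ D l m ≈ 0#
    distinct l m l≢m = >⇒≉ (<-≤-trans (pos-+-nonNeg (<-respʳ L≈′ (pos-+-nonNeg 0<δ
      (*-nonNeg (*-nonNeg (<⇒≤ 0<2) (*-nonNeg (fromℕ-nonNeg n) (fromℕ-nonNeg n))) (<⇒≤ 0<δ))))
          (matrix-nonNeg S l m)) (lower l m l≢m))

  sqDist-symmetric : ∀ x y → sqDist x y ≈ sqDist y x
  sqDist-symmetric x y = begin
    sqDist x y  ≈⟨ sqDist≈sumTo x y B (ℕₚ.m≤m⊔n _ _) (ℕₚ.m≤n⊔m (bound x) _) ⟩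
    sumTo B (λ k → (coord x k - coord y k) * (coord x k - coord y k))
      ≈⟨ sum-cong {B} (λ i → square-difference-comm _ _) ⟩
    sumTo B (λ k → (coord y k - coord x k) * (coord y k - coord x k))
      ≈⟨ sym (sqDist≈sumTo y x B (ℕₚ.m≤n⊔m (bound x) _) (ℕₚ.m≤m⊔n _ _)) ⟩
    sqDist y x ∎
    where B = bound x ℕ.⊔ bound y

  module _ {d} (S : Configuration) (e : HasCardinality S (ℕ.suc (ℕ.suc d))) where
    private
      x : Fin (ℕ.suc (ℕ.suc d)) → Point
      x l = proj₁ (Bijection.to e l)

      D : Matrix (ℕ.suc (ℕ.suc d))
      D l m = sqDist (x l) (x m)

      D₀₁ = D zero (suc zero)

    realised⇒pRamsey : (∀ l m → l ≢ m → ¬ D l m ≈ 0#) →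
      (∃[ k ] Σ (Vec R (ℕ.suc k)) λ w → Realises w D × ∀ b → ¬ subsetSum w b ≈ D₀₁) → PRamsey S
    realised⇒pRamsey distinct (k , w , r , avoids) = pRamsey S e (Realises.scheme r) (Realises.matrix r) distinct
      (λ b eq → avoids b (trans (sym (subsetSum-cong (Realises.weights r) b)) eq))

    decomposed⇒pRamsey : (∃[ ρ ] 0# < ρ × Σ (Matrix (ℕ.suc (ℕ.suc d))) λ M → Approximable M ×
      ∀ i j → i ≢ j → D i j ≈ ρ + M i j) → PRamsey S
    decomposed⇒pRamsey (ρ , 0<ρ , M , M-approximable , D≈) = realised⇒pRamsey (proj₁ r)
      (proj₂ r D₀₁ (proj₁ r zero (suc zero) (λ ())))
      where r = realisation D (λ l m → sqDist-symmetric (x l) (x m)) ρ 0<ρ M M-approximable D≈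

  -- The condition d ≥ 1 supplies the two vertices whose distance the sparse sets avoid.
  simplex-pRamsey : ∀ d → 1 ℕ.≤ d → (S : Configuration) → IsSimplex d S → PRamsey S
  simplex-pRamsey (ℕ.suc d) _ S (e , independent) =
    decomposed⇒pRamsey S e (simplex-decomposition (λ l → proj₁ (Bijection.to e l)) independent)

theorem1p3 : ExcludedMiddle (lsuc 0ℓ) →
    (ℝ : RealNumbers) → let open Euclidean ℝ in
    (d : ℕ) → 1 ℕ.≤ d →
    (S : Configuration) → IsSimplex d S → PRamsey S
theorem1p3 em ℝ = Conclusion.simplex-pRamsey em ℝ
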